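{- Let $G(1;x,y,p,q)=\sum_{\nu}x^{v(\nu)}y^{h(\nu)}p^{B(\nu)}q^{U(\nu)}$, summed over all convex polyominoes $\nu$, and let \[ u_\pm=1+\frac{(p+q)x\pm\sqrt{(p-q)^2x^2+4x}}{2(1-pqx)}. \] Then $G(1;x,y,p,q)$ equals \begin{align*} &\frac{y(y-1)(1-u_+)(1-u_-)}{(1-yu_+)(1-yu_-)}\\ &+\frac{y^2(1-u_+)(1-u_-)}{u_+-u_- }\left(\frac{u_+^2(1-u_+)G^{bt}(u_+;x,y,p,q)}{(1-yu_+)^2}-\frac{u_-^2(1-u_-)G^{bt}(u_-;x,y,p,q)}{(1-yu_-)^2}\right)\\ &-\frac{yu_+(1-u_+)(1-u_-)}{(u_+-u_-)(1-yu_+)}\Bigl((1-p(1-u_+))G^t(u_+;x,y,p,q)+(1-q(1-u_+))G^t(u_+;x,y,q,p)\Bigr)\\ &+\frac{yu_-(1-u_+)(1-u_-)}{(u_+-u_-)(1-yu_-)}\Bigl((1-p(1-u_-))G^t(u_-;x,y,p,q)+(1-q(1-u_-))G^t(u_-;x,y,q,p)\Bigr)\\ &+\frac{y(1-u_+)(1-u_-)}{(1-yu_+)(1-yu_-)}\bigl(G^t(1;x,y,p,q)+G^t(1;x,y,q,p)\bigr). \end{align*}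
   Context: A cell is a unit square of the square lattice; a polyomino is a finite nonempty edge-connected set of cells, considered up to translation. A polyomino is convex if each column and each row is a contiguous block of cells. For a convex polyomino $\nu$ with $m$ columns numbered $1,\dots,m$ from left to right, let $b_j(\nu)$ (resp. $u_j(\nu)$) be the height of the bottom edge of the lowest cell (resp. the top edge of the highest cell) of column $j$. $B(\nu)=|\{1\le j\le m-1:b_j=b_{j+1}\}|$, $U(\nu)=|\{1\le j\le m-1:u_j=u_{j+1}\}|$, $v(\nu)=m$ is the number of columns, $h(\nu)$ the number of rows, and $a(\nu)$ the number of cells of the leftmost column. $\mathcal{CP}^t$ is the set of convex polyominoes with $u_s(\nu)\le u_j(\nu)$ for all $j<s$; $\mathcal{CP}^b$ those with $b_s(\nu)\ge b_j(\nu)$ for all $j<s$; $\mathcal{CP}^{bt}=\mathcal{CP}^t\cap\mathcal{CP}^b$. Define $G^{bt}(u;x,y,p,q)=\sum_{\nu\in\mathcal{CP}^{bt}}x^{v(\nu)}y^{h(\nu)}p^{B(\nu)}q^{U(\nu)}u^{a(\nu)-1}$ and $G^{t}(u;x,y,p,q)=\sum_{\nu\in\mathcal{CP}^{t}}x^{v(\nu)}y^{h(\nu)}p^{B(\nu)}q^{U(\nu)}u^{a(\nu)-1}$; $G^t(u;x,y,q,p)$ denotes the same series with the roles of $p$ and $q$ interchanged. Here $u_\pm$ are formal power series in $\sqrt{x}$ and are substituted for $u$ formally. -}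

module Defs where

open import Data.Nat as ℕ using (ℕ; zero; suc)
open import Data.Integer as ℤ using (+_)
open import Data.Rational as Q using (ℚ; 0ℚ; 1ℚ; ½; 1/_)
open import Data.Rational.Properties as QP using ()
open import Data.Bool using (Bool; true; false; _∧_; _∨_; not; if_then_else_)
open import Data.List using (List; []; _∷_; map; concatMap; filterᵇ; foldr; length; applyUpTo)
open import Data.Product using (_×_; _,_; proj₁; proj₂)
open import Relation.Nullary using (yes; no)
open import Relation.Nullary.Decidable using (⌊_⌋)
open import Relation.Binary.PropositionalEquality using (_≡_)

sumTo : ℕ → (ℕ → ℚ) → ℚ
sumTo zero    f = f 0
sumTo (suc n) f = sumTo n f Q.+ f (suc n)

-- Formal power series in four commuting variables  t, y, p, q  over ℚ,
-- where t stands for √x  (so x = t²).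
-- PS f : coefficient of  t^i y^h p^j q^k  is  f i h j k.

PS : Set
PS = ℕ → ℕ → ℕ → ℕ → ℚ

_≈_ : PS → PS → Set
f ≈ g = ∀ i h j k → f i h j k ≡ g i h j k

infixl 6 _⊕_ _⊖_
infixl 7 _⊛_ _·_
infixr 8 _^^_

_⊕_ : PS → PS → PS
(f ⊕ g) i h j k = f i h j k Q.+ g i h j k

_·_ : ℚ → PS → PS
(c · f) i h j k = c Q.* f i h j k

_⊖_ : PS → PS → PS
(f ⊖ g) i h j k = f i h j k Q.- g i h j k

_⊛_ : PS → PS → PS
(f ⊛ g) i h j k =
  sumTo i λ a → sumTo h λ b → sumTo j λ c → sumTo k λ d →
    f a b c d Q.* g (i ℕ.∸ a) (h ℕ.∸ b) (j ℕ.∸ c) (k ℕ.∸ d)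

mono : ℕ → ℕ → ℕ → ℕ → ℚ → PS
mono a b c d r i h j k =
  if ⌊ a ℕ.≟ i ⌋ ∧ ⌊ b ℕ.≟ h ⌋ ∧ ⌊ c ℕ.≟ j ⌋ ∧ ⌊ d ℕ.≟ k ⌋ then r else 0ℚ

cst : ℚ → PS
cst r = mono 0 0 0 0 r

𝟘 𝟙 Tv Yv Pv Qv Xv : PS
𝟘  = cst 0ℚ
𝟙  = cst 1ℚ
Tv = mono 1 0 0 0 1ℚ
Yv = mono 0 1 0 0 1ℚ
Pv = mono 0 0 1 0 1ℚ
Qv = mono 0 0 0 1 1ℚ
Xv = mono 2 0 0 0 1ℚ

_^^_ : PS → ℕ → PS
f ^^ zero  = 𝟙
f ^^ suc n = f ⊛ (f ^^ n)

sumPS : ℕ → (ℕ → PS) → PS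
sumPS zero    g = g 0
sumPS (suc n) g = sumPS n g ⊕ g (suc n)

const : PS → ℚ
const f = f 0 0 0 0

-- Inverse of a series with constant term 1, via the geometric series
-- Σₙ (1 - f)ⁿ; since (1 - f)ⁿ only has monomials of total degree ≥ n,
-- the coefficient of total degree d is given by the sum up to n = d.
inv₁ : PS → PS
inv₁ f i h j k = sumPS (i ℕ.+ h ℕ.+ j ℕ.+ k) (λ n → (𝟙 ⊖ f) ^^ n) i h j k

-- multiplicative inverse of a series with nonzero constant term c:
-- 1/f = c⁻¹ · inv₁ (c⁻¹ · f).  (Junk value 0 when c = 0; never used so.)
invPS : PS → PS
invPS f with const f QP.≟ 0ℚ
... | yes _  = 𝟘
... | no c≢0 = (1/_ (const f) {{Q.≢-nonZero c≢0}}) ·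
                 inv₁ ((1/_ (const f) {{Q.≢-nonZero c≢0}}) · f)

halfBinom : ℕ → ℚ
halfBinom zero    = 1ℚ
halfBinom (suc n) = halfBinom n Q.* (½ Q.- (+ n Q./ 1)) Q.* (+ 1 Q./ suc n)

-- square root of a series with constant term 1 (the one with constant
-- term 1):  √f = Σₙ binom(1/2,n) (f - 1)ⁿ, truncated by total degree.
sqrt₁ : PS → PS
sqrt₁ f i h j k =
  sumPS (i ℕ.+ h ℕ.+ j ℕ.+ k) (λ n → halfBinom n · ((f ⊖ 𝟙) ^^ n)) i h j k

-- divide by tᵐ (exact when f has t-order ≥ m)
divT : ℕ → PS → PS
divT m f i = f (i ℕ.+ m)

-- Laurent series in t (finitely many negative powers of t):
-- (n , f) stands for  t⁻ⁿ · f.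

record LS : Set where
  constructor laurent
  field
    shift : ℕ
    ser   : PS
open LS public

ι : PS → LS
ι f = laurent 0 f

_≈L_ : LS → LS → Set
laurent n f ≈L laurent m g = ((Tv ^^ m) ⊛ f) ≈ ((Tv ^^ n) ⊛ g)

infixl 6 _⊕L_ _⊖L_
infixl 7 _⊛L_

_⊕L_ : LS → LS → LS
laurent n f ⊕L laurent m g = laurent (n ℕ.+ m) (((Tv ^^ m) ⊛ f) ⊕ ((Tv ^^ n) ⊛ g))

_⊖L_ : LS → LS → LS
laurent n f ⊖L laurent m g = laurent (n ℕ.+ m) (((Tv ^^ m) ⊛ f) ⊖ ((Tv ^^ n) ⊛ g))

_⊛L_ : LS → LS → LS
laurent n f ⊛L laurent m g = laurent (n ℕ.+ m) (f ⊛ g)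

-- reciprocal of a series f of the form tᵐ·g with g(0) ≠ 0:
-- 1/f = t⁻ᵐ · (1/g)
recipL : ℕ → PS → LS
recipL m f = laurent m (invPS (divT m f))

-- Convex polyominoes, encoded by their columns.
-- A column is a pair (b , u) (bottom edge height, top edge height), b < u.
-- A convex polyomino with m columns and h rows is, up to translation,
-- the list of its m columns from left to right, normalised so that the
-- lowest bottom edge is at height 0 (hence the highest top edge is at h).

Col : Set
Col = ℕ × ℕ

_==_ : ℕ → ℕ → Bool
a == b = ⌊ a ℕ.≟ b ⌋

_≤b_ : ℕ → ℕ → Bool
a ≤b b = ⌊ a ℕ.≤? b ⌋

_<b_ : ℕ → ℕ → Bool
a <b b = ⌊ suc a ℕ.≤? b ⌋

all : {A : Set} → (A → Bool) → List A → Bool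
all P = foldr (λ a r → P a ∧ r) true

any : {A : Set} → (A → Bool) → List A → Bool
any P = foldr (λ a r → P a ∨ r) false

colsUpTo : ℕ → List Col
colsUpTo n = concatMap (λ b → concatMap (λ u → if b <b u then (b , u) ∷ [] else [])
                                         (applyUpTo (λ u → u) (suc n)))
                       (applyUpTo (λ b → b) (suc n))

colLists : ℕ → ℕ → List (List Col)
colLists zero    n = [] ∷ []
colLists (suc m) n = concatMap (λ c → map (c ∷_) (colLists m n)) (colsUpTo n)

-- normalisation: lowest bottom edge is 0 and highest top edge is n
-- (all columns satisfy 0 ≤ b < u ≤ n by construction)
hasBottom0 : List Col → Bool
hasBottom0 = any (λ c → proj₁ c == 0)

hasTop : ℕ → List Col → Bool
hasTop n = any (λ c → proj₂ c == n)

connected : List Col → Bool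
connected []                 = true
connected (_ ∷ [])           = true
connected ((b , u) ∷ (b' , u') ∷ cs) =
  ((b ℕ.⊔ b') <b (u ℕ.⊓ u')) ∧ connected ((b' , u') ∷ cs)

contiguous : List Bool → Bool
contiguous = go false false
  where
  go : Bool → Bool → List Bool → Bool
  go seen ended []           = true
  go seen ended (true  ∷ bs) = not ended ∧ go true ended bs
  go seen ended (false ∷ bs) = go seen seen bs

-- row r (between heights r and r+1) meets column (b , u) iff b ≤ r < u
inRow : ℕ → Col → Bool
inRow r (b , u) = (b ≤b r) ∧ (r <b u)

rowConvex : ℕ → List Col → Bool
rowConvex n cs = all (λ r → contiguous (map (inRow r) cs)) (applyUpTo (λ r → r) n)

convexPolys : ℕ → ℕ → List (List Col)
convexPolys m n =
  filterᵇ (λ cs → hasBottom0 cs ∧ hasTop n cs ∧ connected cs ∧ rowConvex n cs)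
         (colLists m n)

forallEarlier : (Col → Col → Bool) → List Col → Bool
forallEarlier R = go []
  where
  go : List Col → List Col → Bool
  go prev []       = true
  go prev (c ∷ cs) = all (R c) prev ∧ go (c ∷ prev) cs

isT : List Col → Bool
isT = forallEarlier (λ cs cj → proj₂ cs ≤b proj₂ cj)

isB : List Col → Bool
isB = forallEarlier (λ cs cj → proj₁ cj ≤b proj₁ cs)

isBT : List Col → Bool
isBT cs = isT cs ∧ isB cs

countB : List Col → ℕ
countB []                   = 0
countB (_ ∷ [])             = 0
countB (c ∷ c' ∷ cs) = (if proj₁ c == proj₁ c' then 1 else 0) ℕ.+ countB (c' ∷ cs)

countU : List Col → ℕ
countU []                   = 0
countU (_ ∷ [])             = 0
countU (c ∷ c' ∷ cs) = (if proj₂ c == proj₂ c' then 1 else 0) ℕ.+ countU (c' ∷ cs)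

leftHeight : List Col → ℕ
leftHeight []            = 0
leftHeight ((b , u) ∷ _) = u ℕ.∸ b

-- The generating functions, with u replaced by a series U.
-- G_S(U; x,y,p,q) = Σ_{ν ∈ S} x^{v(ν)} y^{h(ν)} p^{B(ν)} q^{U(ν)} U^{a(ν)-1}
-- (with x = t²).  If swap = true, p and q are interchanged (i.e. the
-- series G_S(U; x,y,q,p)); U itself is not altered.
-- The coefficient of t^i y^h … only receives contributions from
-- polyominoes with 2·v ≤ i and h(ν) ≤ h, so the infinite sum is
-- computed coefficientwise by the finite truncation below.

weight : Bool → List Col → ℕ → ℕ → PS → PS
weight swap cs v hh U =
  mono (2 ℕ.* v) hh (if swap then countU cs else countB cs)
                    (if swap then countB cs else countU cs) 1ℚ
  ⊛ (U ^^ (leftHeight cs ℕ.∸ 1))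

sumList : List PS → PS
sumList = foldr _⊕_ 𝟘

genFun : (List Col → Bool) → Bool → PS → PS
genFun S swap U i h j k =
  sumPS i (λ v → sumPS h (λ hh →
    sumList (map (λ cs → weight swap cs v hh U)
                 (filterᵇ S (convexPolys v hh))))) i h j k

Gall : PS → PS
Gall = genFun (λ _ → true) false

Gt Gtsw : PS → PS
Gt   = genFun isT false
Gtsw = genFun isT true

Gbt : PS → PS
Gbt = genFun isBT false

-- u₊ and u₋ .
-- D = (p-q)²x² + 4x = t²·(4 + (p-q)²t²), and
-- √D := 2t·√(1 + (p-q)²x/4)  (the branch that is a power series in √x
-- with leading term 2√x).

Dser : PS
Dser = (((Pv ⊖ Qv) ^^ 2) ⊛ (Xv ^^ 2)) ⊕ ((+ 4 Q./ 1) · Xv)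

sqrtD : PS
sqrtD = (+ 2 Q./ 1) · (Tv ⊛ sqrt₁ ((+ 1 Q./ 4) · divT 2 Dser))

uPlus uMinus : PS
uPlus  = 𝟙 ⊕ (((Pv ⊕ Qv) ⊛ Xv ⊕ sqrtD) ⊛ invPS ((+ 2 Q./ 1) · (𝟙 ⊖ Pv ⊛ Qv ⊛ Xv)))
uMinus = 𝟙 ⊕ (((Pv ⊕ Qv) ⊛ Xv ⊖ sqrtD) ⊛ invPS ((+ 2 Q./ 1) · (𝟙 ⊖ Pv ⊛ Qv ⊛ Xv)))

module RHS where
  A : PS
  A = (𝟙 ⊖ uPlus) ⊛ (𝟙 ⊖ uMinus)

  Dp Dm : PS
  Dp = 𝟙 ⊖ Yv ⊛ uPlus
  Dm = 𝟙 ⊖ Yv ⊛ uMinus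

  δ : LS            -- 1 / (u₊ - u₋)   (u₊ - u₋ has t-order 1)
  δ = recipL 1 (uPlus ⊖ uMinus)

  term1 : PS
  term1 = Yv ⊛ (Yv ⊖ 𝟙) ⊛ A ⊛ invPS (Dp ⊛ Dm)

  term2 : LS
  term2 = ι ((Yv ^^ 2) ⊛ A) ⊛L δ ⊛L
          ι (  (uPlus ^^ 2) ⊛ (𝟙 ⊖ uPlus) ⊛ Gbt uPlus ⊛ invPS (Dp ^^ 2)
             ⊖ (uMinus ^^ 2) ⊛ (𝟙 ⊖ uMinus) ⊛ Gbt uMinus ⊛ invPS (Dm ^^ 2))

  term3 : LS
  term3 = ι (Yv ⊛ uPlus ⊛ A) ⊛L δ ⊛L
          ι (invPS Dp ⊛ ( (𝟙 ⊖ Pv ⊛ (𝟙 ⊖ uPlus)) ⊛ Gt uPlus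
                        ⊕ (𝟙 ⊖ Qv ⊛ (𝟙 ⊖ uPlus)) ⊛ Gtsw uPlus))

  term4 : LS
  term4 = ι (Yv ⊛ uMinus ⊛ A) ⊛L δ ⊛L
          ι (invPS Dm ⊛ ( (𝟙 ⊖ Pv ⊛ (𝟙 ⊖ uMinus)) ⊛ Gt uMinus
                        ⊕ (𝟙 ⊖ Qv ⊛ (𝟙 ⊖ uMinus)) ⊛ Gtsw uMinus))

  term5 : PS
  term5 = Yv ⊛ A ⊛ invPS (Dp ⊛ Dm) ⊛ (Gt 𝟙 ⊕ Gtsw 𝟙)

  total : LS
  total = ι term1 ⊕L term2 ⊖L term3 ⊕L term4 ⊕L ι term5

{-# OPTIONS --safe #-}
-- Deleting the leftmost column of a convex polyomino leaves a convex polyomino, and a column may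
-- stick out beyond its right neighbour at the top (bottom) only if all later tops decrease (bottoms
-- increase).  Writing w = 1 - u, this gives (1 - pqx) G(u) = x (R(u) + (p+q) Q₁ + Q₂), where
-- w Q₁ = G(1) - G(u), w Q₂ = G'(1) - Q₁ and R(u) collects the single columns and the columns that
-- stick out.  The roots u± of the kernel (1 - pqx) w² = x (1 - (p+q) w) make Q₂ cancel, leaving two
-- linear equations for G(1) and G'(1), from which G'(1) is eliminated.  The series G^t(u; x,y,q,p)
-- enters because a reflection in a horizontal line turns columns sticking out at the bottom into
-- columns sticking out at the top and exchanges p and q.
--
-- All of this happens in the ring of power series modulo total degree > N, for each N separately:
-- there every generating function is a finite sum, and geometric series and square roots are
-- polynomials.  No step divides by t = √x.
module Submission where

open import Algebra.Bundles using (CommutativeRing)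
open import Data.Bool using (Bool; true; false; _∧_; _∨_; not; if_then_else_)
open import Data.Bool.Properties using (∧-identityʳ; ∧-zeroʳ; ∧-comm)
open import Data.Empty using (⊥; ⊥-elim)
open import Data.Integer as ℤ using (ℤ; +_; -[1+_])
import Data.Integer.Properties as ℤP
open import Data.List using (List; []; _∷_; _++_; map; concatMap; filterᵇ; foldr; applyUpTo)
open import Data.List.Relation.Unary.All as All using (All; []; _∷_)
import Data.Maybe as Maybe
open import Data.Nat as ℕ using (ℕ; zero; suc; _≤_; _<_; z≤n; s≤s; _∸_; _⊔_; _⊓_; _≡ᵇ_)
import Data.Nat.Properties as ℕP
import Data.Nat.Solver as ℕSolver
open import Data.Product using (∃; _×_; _,_; proj₁; proj₂)
open import Data.Rational as Q using (ℚ; 0ℚ; 1ℚ; ½; 1/_)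
import Data.Rational.Properties as QP
import Data.Rational.Unnormalised as U
import Data.Rational.Unnormalised.Properties as UP
open import Data.Sum using (_⊎_; inj₁; inj₂)
import Level
open import Relation.Binary using (tri<; tri≈; tri>)
open import Relation.Binary.PropositionalEquality as ≡ using (_≡_; cong; cong₂; subst)
open import Relation.Nullary using (¬_; Dec; yes; no; contradiction)
open import Relation.Nullary.Decidable using (⌊_⌋; isYes≗does; dec⇒maybe)
open import Defs using (Col; all; _==_; _≤b_; _<b_; colsUpTo; colLists; hasBottom0; hasTop; connected; contiguous; inRow; rowConvex; convexPolys; forallEarlier; isT; isB; countB; countU; leftHeight)

-- The series 1 - u± have constant term 0, so Q₁ and Q₂ cannot be defined by division. Instead the
-- factor u^k in the weight of a polyomino is replaced by another function of k: by 1 + u + ... +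
-- u^(k-1) for Q₁, by the sum of these for Q₂, by k itself for G'(1). The relations with w then hold
-- term by term, and the same functions appear when the columns that fit inside a given column are
-- counted. For the same reason nothing is cancelled at the end: the factor x that the elimination
-- leaves is absorbed by (1 - u₊)(1 - u₋) = -x / (1 - pqx), and u₊ - u₋ = t F with F invertible, so
-- that an identity for t G(1) results. The other obstacle is the normalisation to a box of exact
-- height n: when a column that sticks out is deleted, the rest lies in a smaller box, possibly at
-- another height. Such sums are computed by recursion on the height of the strip, and each
-- recursion becomes a factor 1 / (1 - yu) of the generating function.

-- Integer coefficients for polynomial identities in a commutative ring.

module RingTools {c ℓ} (K : CommutativeRing c ℓ) where

  open CommutativeRing K
  open import Algebra.Properties.Ring ring
  open import Algebra.Properties.Semiring.Mult.TCOptimised semiring renaming (_×_ to _⨯_)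
  open import Algebra.Properties.AbelianGroup +-abelianGroup
  open import Algebra.Solver.Ring.AlmostCommutativeRing
  open import Relation.Binary.Reasoning.Setoid setoid

  ℤ→K : ℤ → Carrier
  ℤ→K (+ n)    = n ⨯ 1#
  ℤ→K -[1+ n ] = - (suc n ⨯ 1#)

  cancel-1# : ∀ a b → (1# + a) - (1# + b) ≈ a - b
  cancel-1# a b = begin
    (1# + a) - (1# + b)      ≈⟨ +-congˡ (⁻¹-∙-comm 1# b) ⟨
    (1# + a) + (- 1# - b)    ≈⟨ +-assoc _ _ _ ⟩
    1# + (a + (- 1# - b))    ≈⟨ +-congˡ (+-assoc _ _ _) ⟨
    1# + ((a - 1#) - b)      ≈⟨ +-congˡ (+-congʳ (+-comm _ _)) ⟩
    1# + ((- 1# + a) - b)    ≈⟨ +-congˡ (+-assoc _ _ _) ⟩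
    1# + (- 1# + (a - b))    ≈⟨ +-assoc _ _ _ ⟨
    (1# - 1#) + (a - b)      ≈⟨ +-congʳ (-‿inverseʳ 1#) ⟩
    0# + (a - b)             ≈⟨ +-identityˡ _ ⟩
    a - b                    ∎

  ⊖-homo : ∀ m n → ℤ→K (m ℤ.⊖ n) ≈ m ⨯ 1# - n ⨯ 1#
  ⊖-homo m       zero    = sym (trans (+-congˡ ε⁻¹≈ε) (+-identityʳ _))
  ⊖-homo zero    (suc n) = sym (+-identityˡ _)
  ⊖-homo (suc m) (suc n) = begin
    ℤ→K (suc m ℤ.⊖ suc n)          ≡⟨ ≡.cong ℤ→K (ℤP.[1+m]⊖[1+n]≡m⊖n m n) ⟩
    ℤ→K (m ℤ.⊖ n)                  ≈⟨ ⊖-homo m n ⟩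
    m ⨯ 1# - n ⨯ 1#              ≈⟨ cancel-1# _ _ ⟨
    (1# + m ⨯ 1#) - (1# + n ⨯ 1#) ≈⟨ +-cong (1+× m 1#) (-‿cong (1+× n 1#)) ⟨
    suc m ⨯ 1# - suc n ⨯ 1#      ∎

  +-homo : ∀ i j → ℤ→K (i ℤ.+ j) ≈ ℤ→K i + ℤ→K j
  +-homo (+ m)    (+ n)    = ×-homo-+ 1# m n
  +-homo (+ m)    -[1+ n ] = ⊖-homo m (suc n)
  +-homo -[1+ m ] (+ n)    = trans (⊖-homo n (suc m)) (+-comm _ _)
  +-homo -[1+ m ] -[1+ n ] = begin
    - (suc (suc (m ℕ.+ n)) ⨯ 1#)      ≡⟨ ≡.cong (λ k → - (suc k ⨯ 1#)) (≡.sym (ℕP.+-suc m n)) ⟩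
    - ((suc m ℕ.+ suc n) ⨯ 1#)        ≈⟨ -‿cong (×-homo-+ 1# (suc m) (suc n)) ⟩
    - (suc m ⨯ 1# + suc n ⨯ 1#)       ≈⟨ ⁻¹-∙-comm _ _ ⟨
    - (suc m ⨯ 1#) - suc n ⨯ 1#       ∎

  neg-homo : ∀ i → ℤ→K (ℤ.- i) ≈ - ℤ→K i
  neg-homo (+ zero)  = sym ε⁻¹≈ε
  neg-homo (+ suc n) = refl
  neg-homo -[1+ n ]  = sym (⁻¹-involutive _)

  *-homo : ∀ i j → ℤ→K (i ℤ.* j) ≈ ℤ→K i * ℤ→K j
  *-homo (+ m)    (+ n)    = trans (reflexive (≡.cong ℤ→K (≡.sym (ℤP.pos-* m n)))) (×1-homo-* m n)
  *-homo (+ m)    -[1+ n ] = begin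
    ℤ→K (+ m ℤ.* -[1+ n ])        ≡⟨ ≡.cong ℤ→K (ℤP.neg-distribʳ-* (+ m) (+ suc n)) ⟨
    ℤ→K (ℤ.- (+ m ℤ.* + suc n))   ≈⟨ neg-homo (+ m ℤ.* + suc n) ⟩
    - ℤ→K (+ m ℤ.* + suc n)       ≈⟨ -‿cong (*-homo (+ m) (+ suc n)) ⟩
    - (m ⨯ 1# * (suc n ⨯ 1#))     ≈⟨ -‿distribʳ-* _ _ ⟩
    m ⨯ 1# * - (suc n ⨯ 1#)       ∎
  *-homo -[1+ m ] (+ n)    = begin
    ℤ→K (-[1+ m ] ℤ.* + n)        ≡⟨ ≡.cong ℤ→K (ℤP.neg-distribˡ-* (+ suc m) (+ n)) ⟨
    ℤ→K (ℤ.- (+ suc m ℤ.* + n))   ≈⟨ neg-homo (+ suc m ℤ.* + n) ⟩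
    - ℤ→K (+ suc m ℤ.* + n)       ≈⟨ -‿cong (*-homo (+ suc m) (+ n)) ⟩
    - (suc m ⨯ 1# * (n ⨯ 1#))     ≈⟨ -‿distribˡ-* _ _ ⟩
    - (suc m ⨯ 1#) * (n ⨯ 1#)     ∎
  *-homo -[1+ m ] -[1+ n ] = begin
    (suc m ℕ.* suc n) ⨯ 1#           ≈⟨ ×1-homo-* (suc m) (suc n) ⟩
    a * b                            ≈⟨ ⁻¹-involutive _ ⟨
    - - (a * b)                      ≈⟨ -‿cong (-‿distribʳ-* a b) ⟩
    - (a * - b)                      ≈⟨ -‿distribˡ-* a (- b) ⟩
    - a * - b                        ∎
    where
    a = suc m ⨯ 1#
    b = suc n ⨯ 1#

  -- An abstract carrier has no decidable equality, so coefficients are taken in ℤ: there opposite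
  -- terms are recognised and cancelled, which identities with subtraction require.
  ℤ-morphism : CommutativeRing.rawRing ℤP.+-*-commutativeRing -Raw-AlmostCommutative⟶ fromCommutativeRing K
  ℤ-morphism = record
    { ⟦_⟧    = ℤ→K
    ; +-homo = +-homo
    ; *-homo = *-homo
    ; -‿homo = neg-homo
    ; 0-homo = refl
    ; 1-homo = refl
    }

  open import Algebra.Solver.Ring (CommutativeRing.rawRing ℤP.+-*-commutativeRing) (fromCommutativeRing K) ℤ-morphism
    (λ i j → Maybe.map (λ eq → reflexive (≡.cong ℤ→K eq)) (dec⇒maybe (i ℤ.≟ j)))
    public using (Polynomial; solve; _:=_; _:+_; _:*_; _:-_; :-_; con)

  :0 :1 : ∀ {n} → Polynomial n
  :0 = con (+ 0)
  :1 = con (+ 1)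

-- Finite sums.

module Sums {c ℓ} (K : CommutativeRing c ℓ) where

  open RingTools K using (solve; _:=_; _:+_)

  open CommutativeRing K
  open import Relation.Binary.Reasoning.Setoid setoid

  -- The bound is included, as in `sumTo` and `sumPS`, so a sum is never empty; half-open ranges are
  -- left to `∑<`.
  ∑ : ℕ → (ℕ → Carrier) → Carrier
  ∑ zero    f = f 0
  ∑ (suc n) f = ∑ n f + f (suc n)

  ∑-cong : ∀ n {f g} → (∀ i → i ≤ n → f i ≈ g i) → ∑ n f ≈ ∑ n g
  ∑-cong zero    e = e 0 z≤n
  ∑-cong (suc n) e = +-cong (∑-cong n (λ i i≤n → e i (ℕP.m≤n⇒m≤1+n i≤n))) (e (suc n) ℕP.≤-refl)

  ∑-cong′ : ∀ n {f g} → (∀ i → f i ≈ g i) → ∑ n f ≈ ∑ n g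
  ∑-cong′ n e = ∑-cong n (λ i _ → e i)

  ∑-0 : ∀ n {f} → (∀ i → i ≤ n → f i ≈ 0#) → ∑ n f ≈ 0#
  ∑-0 zero    e = e 0 z≤n
  ∑-0 (suc n) e =
    trans (+-cong (∑-0 n (λ i i≤n → e i (ℕP.m≤n⇒m≤1+n i≤n))) (e (suc n) ℕP.≤-refl)) (+-identityˡ 0#)

  ∑-+ : ∀ n f g → ∑ n (λ i → f i + g i) ≈ ∑ n f + ∑ n g
  ∑-+ zero    f g = refl
  ∑-+ (suc n) f g = trans (+-congʳ (∑-+ n f g))
    (solve 4 (λ a b c d → (a :+ b) :+ (c :+ d) := (a :+ c) :+ (b :+ d)) refl _ _ _ _)

  *-∑ : ∀ n k f → k * ∑ n f ≈ ∑ n (λ i → k * f i)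
  *-∑ zero    k f = refl
  *-∑ (suc n) k f = trans (distribˡ k _ _) (+-congʳ (*-∑ n k f))

  ∑-first : ∀ n f → ∑ (suc n) f ≈ f 0 + ∑ n (λ i → f (suc i))
  ∑-first zero    f = refl
  ∑-first (suc n) f = trans (+-congʳ (∑-first n f)) (+-assoc _ _ _)

  ∑-rev : ∀ n f → ∑ n f ≈ ∑ n (λ i → f (n ℕ.∸ i))
  ∑-rev zero    f = refl
  ∑-rev (suc n) f = begin
    ∑ (suc n) f                                     ≈⟨ ∑-first n f ⟩
    f 0 + ∑ n (λ i → f (suc i))                     ≈⟨ +-comm _ _ ⟩
    ∑ n (λ i → f (suc i)) + f 0                     ≈⟨ +-cong (∑-rev n (λ i → f (suc i))) (reflexive (≡.cong f (≡.sym (ℕP.n∸n≡0 n)))) ⟩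
    ∑ n (λ i → f (suc (n ℕ.∸ i))) + f (n ℕ.∸ n)     ≈⟨ +-congʳ (∑-cong n (λ i i≤n → reflexive (≡.cong f (≡.sym (ℕP.+-∸-assoc 1 i≤n))))) ⟩
    ∑ n (λ i → f (suc n ℕ.∸ i)) + f (n ℕ.∸ n)       ∎

  ∑-swap : ∀ m n (f : ℕ → ℕ → Carrier) → ∑ m (λ i → ∑ n (f i)) ≈ ∑ n (λ j → ∑ m (λ i → f i j))
  ∑-swap zero    n f = refl
  ∑-swap (suc m) n f = trans (+-congʳ (∑-swap m n f)) (sym (∑-+ n _ _))

-- Power series in one variable.

module PowerSeries {c ℓ} (K : CommutativeRing c ℓ) where

  open RingTools K using (solve; _:=_; _:+_; _:*_)
  open Sums K

  open CommutativeRing K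
  open import Relation.Binary.Reasoning.Setoid setoid

  Series : Set c
  Series = ℕ → Carrier

  infix 4 _≋_
  _≋_ : Series → Series → Set ℓ
  f ≋ g = ∀ n → f n ≈ g n

  _∗_ : Series → Series → Series
  (f ∗ g) n = ∑ n (λ a → f a * g (n ℕ.∸ a))

  constant : Carrier → Series
  constant k zero    = k
  constant k (suc _) = 0#

  shift : Series → Series
  shift f n = f (suc n)

  ∗-suc : ∀ f g n → (f ∗ g) (suc n) ≈ f 0 * g (suc n) + (shift f ∗ g) n
  ∗-suc f g n = ∑-first n _

  ∗-cong : ∀ {f f′ g g′} → f ≋ f′ → g ≋ g′ → (f ∗ g) ≋ (f′ ∗ g′)
  ∗-cong ef eg n = ∑-cong′ n (λ a → *-cong (ef a) (eg (n ℕ.∸ a)))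

  ∗-comm : ∀ f g → (f ∗ g) ≋ (g ∗ f)
  ∗-comm f g n = trans (∑-rev n _) (∑-cong n (λ a a≤n →
    trans (*-comm _ _) (*-congʳ (reflexive (≡.cong g (ℕP.m∸[m∸n]≡n a≤n))))))

  ∗-distribʳ : ∀ h f g → ((λ n → f n + g n) ∗ h) ≋ (λ n → (f ∗ h) n + (g ∗ h) n)
  ∗-distribʳ h f g n = trans (∑-cong′ n (λ a → distribʳ _ _ _)) (∑-+ n _ _)

  scale-∗ : ∀ k f g → ((λ n → k * f n) ∗ g) ≋ (λ n → k * (f ∗ g) n)
  scale-∗ k f g n = trans (∑-cong′ n (λ a → *-assoc _ _ _)) (sym (*-∑ n k _))

  -- Writing f = f(0) + z f₁ with f₁ = `shift f`, the coefficient of index n + 1 splits into a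
  -- multiple of f(0) and the coefficient of index n of a product whose first factor is f₁. Hence
  -- the induction on the index, for all series at once.
  ∗-assoc : ∀ f g h → ((f ∗ g) ∗ h) ≋ (f ∗ (g ∗ h))
  ∗-assoc f g h zero    = *-assoc _ _ _
  ∗-assoc f g h (suc n) = begin
    ((f ∗ g) ∗ h) (suc n)
      ≈⟨ ∗-suc (f ∗ g) h n ⟩
    f 0 * g 0 * h (suc n) + (shift (f ∗ g) ∗ h) n
      ≈⟨ +-congˡ (∗-cong {g = h} (∗-suc f g) (λ _ → refl) n) ⟩
    f 0 * g 0 * h (suc n) + ((λ m → f 0 * shift g m + (shift f ∗ g) m) ∗ h) n
      ≈⟨ +-congˡ (∗-distribʳ h (λ m → f 0 * shift g m) (shift f ∗ g) n) ⟩
    f 0 * g 0 * h (suc n) + (((λ m → f 0 * shift g m) ∗ h) n + ((shift f ∗ g) ∗ h) n)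
      ≈⟨ +-congˡ (+-cong (scale-∗ (f 0) (shift g) h n) (∗-assoc (shift f) g h n)) ⟩
    f 0 * g 0 * h (suc n) + (f 0 * (shift g ∗ h) n + (shift f ∗ (g ∗ h)) n)
      ≈⟨ solve 5 (λ a b c d e → a :* b :* c :+ (a :* d :+ e) := a :* (b :* c :+ d) :+ e) refl _ _ _ _ _ ⟩
    f 0 * (g 0 * h (suc n) + (shift g ∗ h) n) + (shift f ∗ (g ∗ h)) n
      ≈⟨ +-congʳ (*-congˡ (∗-suc g h n)) ⟨
    f 0 * (g ∗ h) (suc n) + (shift f ∗ (g ∗ h)) n
      ≈⟨ ∗-suc f (g ∗ h) n ⟨
    (f ∗ (g ∗ h)) (suc n) ∎

  constant-∗ : ∀ k f → (constant k ∗ f) ≋ (λ n → k * f n)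
  constant-∗ k f zero    = refl
  constant-∗ k f (suc n) = trans (∗-suc (constant k) f n)
    (trans (+-congˡ (∑-0 n (λ a _ → zeroˡ _))) (+-identityʳ _))

  var : Series
  var 0             = 0#
  var 1             = 1#
  var (suc (suc _)) = 0#

  var-∗-zero : ∀ f → (var ∗ f) 0 ≈ 0#
  var-∗-zero f = zeroˡ _

  var-∗-suc : ∀ f n → (var ∗ f) (suc n) ≈ f n
  var-∗-suc f n = begin
    (var ∗ f) (suc n)                  ≈⟨ ∗-suc var f n ⟩
    0# * f (suc n) + (shift var ∗ f) n ≈⟨ +-cong (zeroˡ _) (∗-cong {g = f} shift-var (λ _ → refl) n) ⟩
    0# + (constant 1# ∗ f) n           ≈⟨ +-identityˡ _ ⟩
    (constant 1# ∗ f) n                ≈⟨ constant-∗ 1# f n ⟩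
    1# * f n                           ≈⟨ *-identityˡ _ ⟩
    f n                                ∎
    where
    shift-var : shift var ≋ constant 1#
    shift-var zero    = refl
    shift-var (suc _) = refl

  -- Applied four times, starting from ℚ, this supplies the ring laws of `PS`, with t as the
  -- outermost and q as the innermost variable.
  seriesRing : CommutativeRing c ℓ
  seriesRing = record
    { Carrier = Series
    ; _≈_ = _≋_
    ; _+_ = λ f g n → f n + g n
    ; _*_ = _∗_
    ; -_ = λ f n → - f n
    ; 0# = λ _ → 0#
    ; 1# = constant 1#
    ; isCommutativeRing = record
      { isRing = record
        { +-isAbelianGroup = record
          { isGroup = record
            { isMonoid = record
              { isSemigroup = record
                { isMagma = record
                  { isEquivalence = record
                    { refl = λ _ → refl ; sym = λ e n → sym (e n) ; trans = λ e e′ n → trans (e n) (e′ n) }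
                  ; ∙-cong = λ e e′ n → +-cong (e n) (e′ n) }
                ; assoc = λ f g h n → +-assoc _ _ _ }
              ; identity = (λ f n → +-identityˡ _) , (λ f n → +-identityʳ _) }
            ; inverse = (λ f n → -‿inverseˡ _) , (λ f n → -‿inverseʳ _)
            ; ⁻¹-cong = λ e n → -‿cong (e n) }
          ; comm = λ f g n → +-comm _ _ }
        ; *-cong = ∗-cong
        ; *-assoc = ∗-assoc
        ; *-identity = oneˡ , (λ f n → trans (∗-comm f (constant 1#) n) (oneˡ f n))
        ; distrib = (λ h f g n → trans (∗-comm h _ n)
                       (trans (∗-distribʳ h f g n) (+-cong (∗-comm f h n) (∗-comm g h n))))
                  , ∗-distribʳ
        }
      ; *-comm = ∗-comm
      }
    }
    where
    oneˡ : ∀ f → (constant 1# ∗ f) ≋ f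
    oneˡ f n = trans (constant-∗ 1# f n) (*-identityˡ _)

  open Sums seriesRing using () renaming (∑ to ∑ˢ)

  ∑ˢ-at : ∀ n (F : ℕ → Series) m → ∑ˢ n F m ≈ ∑ n (λ a → F a m)
  ∑ˢ-at zero    F m = refl
  ∑ˢ-at (suc n) F m = +-congʳ (∑ˢ-at n F m)

-- Inverses and square roots by evaluation at a nilpotent element.

module PolyEval {c ℓ} (K : CommutativeRing c ℓ) where

  open RingTools K using (solve; _:=_; _:+_; _:*_; _:-_; :0; :1)
  open Sums K
  open PowerSeries K using (Series; _≋_; _∗_; shift; ∗-suc)

  open CommutativeRing K
  open import Algebra.Properties.Semiring.Exp semiring using (_^_)
  open import Relation.Binary.Reasoning.Setoid setoid

  geometric-sum : ∀ e n → (1# - e) * ∑ n (e ^_) ≈ 1# - e ^ suc n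
  geometric-sum e zero    = solve 1 (λ e → (:1 :- e) :* :1 := :1 :- e :* :1) refl e
  geometric-sum e (suc n) = begin
    (1# - e) * (∑ n (e ^_) + e ^ suc n)
      ≈⟨ distribˡ _ _ _ ⟩
    (1# - e) * ∑ n (e ^_) + (1# - e) * e ^ suc n
      ≈⟨ +-congʳ (geometric-sum e n) ⟩
    (1# - e ^ suc n) + (1# - e) * e ^ suc n
      ≈⟨ solve 2 (λ e p → (:1 :- p) :+ (:1 :- e) :* p := :1 :- e :* p) refl e (e ^ suc n) ⟩
    1# - e ^ suc (suc n) ∎

  -- With e = 1 - f the geometric sum telescopes to 1 - e^(n+1), and nilpotency removes the power of
  -- e.
  geometric-inverse : ∀ n f g → (1# - f) ^ suc n ≈ 0# → g ≈ ∑ n ((1# - f) ^_) → f * g ≈ 1#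
  geometric-inverse n f g nil eq = begin
    f * g                           ≈⟨ *-cong (solve 1 (λ x → x := :1 :- (:1 :- x)) refl f) eq ⟩
    (1# - e) * ∑ n (e ^_)           ≈⟨ geometric-sum e n ⟩
    1# - e ^ suc n                  ≈⟨ +-congˡ (-‿cong nil) ⟩
    1# - 0#                         ≈⟨ solve 0 (:1 :- :0 := :1) refl ⟩
    1#                              ∎
    where
    e = 1# - f

  scale-inverse : ∀ r f g rf rg → rf ≈ r * f → rg ≈ r * g → rf * g ≈ 1# → f * rg ≈ 1#
  scale-inverse r f g rf rg ef eg eq = begin
    f * rg       ≈⟨ *-congˡ eg ⟩
    f * (r * g)  ≈⟨ solve 3 (λ r f g → f :* (r :* g) := r :* f :* g) refl r f g ⟩
    r * f * g    ≈⟨ *-congʳ ef ⟨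
    rf * g       ≈⟨ eq ⟩
    1#           ∎

  module _ (e : Carrier) where

    eval : ℕ → Series → Carrier
    eval n f = ∑ n (λ a → f a * e ^ a)

    eval-cong : ∀ n {f g} → f ≋ g → eval n f ≈ eval n g
    eval-cong n eq = ∑-cong′ n (λ a → *-congʳ (eq a))

    eval-first : ∀ n f → eval (suc n) f ≈ f 0 + e * eval n (shift f)
    eval-first n f = begin
      eval (suc n) f
        ≈⟨ ∑-first n _ ⟩
      f 0 * 1# + ∑ n (λ a → f (suc a) * (e * e ^ a))
        ≈⟨ +-cong (*-identityʳ _) (∑-cong′ n (λ a →
             solve 3 (λ x y z → x :* (y :* z) := y :* (x :* z)) refl (f (suc a)) e (e ^ a))) ⟩
      f 0 + ∑ n (λ a → e * (f (suc a) * e ^ a))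
        ≈⟨ +-congˡ (*-∑ n e _) ⟨
      f 0 + e * eval n (shift f) ∎

    eval-∗-first : ∀ n f g → eval (suc n) (f ∗ g) ≈ f 0 * eval (suc n) g + e * eval n (shift f ∗ g)
    eval-∗-first n f g = begin
      eval (suc n) (f ∗ g)
        ≈⟨ eval-first n (f ∗ g) ⟩
      f 0 * g 0 + e * eval n (shift (f ∗ g))
        ≈⟨ +-congˡ (*-congˡ (eval-cong n (∗-suc f g))) ⟩
      f 0 * g 0 + e * eval n (λ m → f 0 * shift g m + (shift f ∗ g) m)
        ≈⟨ +-congˡ (*-congˡ (trans (∑-cong′ n (λ a → trans (distribʳ _ _ _) (+-congʳ (*-assoc _ _ _)))) (∑-+ n _ _))) ⟩
      f 0 * g 0 + e * (∑ n (λ a → f 0 * (shift g a * e ^ a)) + eval n (shift f ∗ g))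
        ≈⟨ +-congˡ (*-congˡ (+-congʳ (*-∑ n (f 0) _))) ⟨
      f 0 * g 0 + e * (f 0 * eval n (shift g) + eval n (shift f ∗ g))
        ≈⟨ solve 5 (λ x y e s t → x :* y :+ e :* (x :* s :+ t) := x :* (y :+ e :* s) :+ e :* t) refl _ _ _ _ _ ⟩
      f 0 * (g 0 + e * eval n (shift g)) + e * eval n (shift f ∗ g)
        ≈⟨ +-congʳ (*-congˡ (eval-first n g)) ⟨
      f 0 * eval (suc n) g + e * eval n (shift f ∗ g) ∎

    -- The product of two polynomials of degree n differs from its truncation by terms of degree
    -- above n, all divisible by e^(n+1); `r` collects them. The induction splits the constant term
    -- off `f` and the top term off `g`.
    eval-* : ∀ n f g → ∃ λ r → eval n f * eval n g ≈ eval n (f ∗ g) + e ^ suc n * r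
    eval-* zero    f g = 0# , solve 3 (λ x y e → x :* :1 :* (y :* :1) := x :* y :* :1 :+ e :* :1 :* :0) refl (f 0) (g 0) e
    eval-* (suc n) f g with eval-* n (shift f) g
    ... | r , eq = r + eval n (shift f) * g (suc n) , (begin
      eval (suc n) f * eval (suc n) g
        ≈⟨ *-congʳ (eval-first n f) ⟩
      (f 0 + e * eval n (shift f)) * (eval n g + g (suc n) * e ^ suc n)
        ≈⟨ solve 6 (λ x e s t y p → (x :+ e :* s) :* (t :+ y :* p) := x :* (t :+ y :* p) :+ e :* (s :* t) :+ e :* p :* (s :* y)) refl _ _ _ _ _ _ ⟩
      f 0 * eval (suc n) g + e * (eval n (shift f) * eval n g) + e * e ^ suc n * (eval n (shift f) * g (suc n))
        ≈⟨ +-congʳ (+-congˡ (*-congˡ eq)) ⟩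
      f 0 * eval (suc n) g + e * (eval n (shift f ∗ g) + e ^ suc n * r) + e * e ^ suc n * (eval n (shift f) * g (suc n))
        ≈⟨ solve 6 (λ a e b p r d → a :+ e :* (b :+ p :* r) :+ e :* p :* d := (a :+ e :* b) :+ e :* p :* (r :+ d)) refl _ _ _ _ _ _ ⟩
      (f 0 * eval (suc n) g + e * eval n (shift f ∗ g)) + e * e ^ suc n * (r + eval n (shift f) * g (suc n))
        ≈⟨ +-congʳ (eval-∗-first n f g) ⟨
      eval (suc n) (f ∗ g) + e ^ suc (suc n) * (r + eval n (shift f) * g (suc n)) ∎)

  one-plus-var : Series
  one-plus-var 0             = 1#
  one-plus-var 1             = 1#
  one-plus-var (suc (suc _)) = 0#

  -- The degree is a successor because truncation at degree 0 would lose the linear term.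
  eval-one-plus-var : ∀ e n → eval e (suc n) one-plus-var ≈ 1# + e
  eval-one-plus-var e n = trans (eval-first e n _) (+-congˡ (trans (*-congˡ (eval-one n)) (*-identityʳ e)))
    where
    eval-one : ∀ n → eval e n (shift one-plus-var) ≈ 1#
    eval-one zero    = *-identityʳ 1#
    eval-one (suc n) = trans (eval-first e n _)
      (trans (+-congˡ (trans (*-congˡ (∑-0 n (λ i _ → zeroˡ _))) (zeroʳ e))) (+-identityʳ 1#))

  -- Evaluation at the nilpotent e = f - 1 is multiplicative up to a multiple of a vanishing power
  -- of e, so the identity h² = 1 + z of formal series specialises to f = 1 + e.
  series-square-root : ∀ n h f s → (h ∗ h) ≋ one-plus-var → (f - 1#) ^ suc (suc n) ≈ 0# →
                       s ≈ eval (f - 1#) (suc n) h → s * s ≈ f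
  series-square-root n h f s hh nil eq = begin
    s * s                                                ≈⟨ *-cong eq eq ⟩
    eval e (suc n) h * eval e (suc n) h                  ≈⟨ proj₂ (eval-* e (suc n) h h) ⟩
    eval e (suc n) (h ∗ h) + e ^ suc (suc n) * r         ≈⟨ +-cong (eval-cong e (suc n) hh) (*-congʳ nil) ⟩
    eval e (suc n) one-plus-var + 0# * r                 ≈⟨ +-congʳ (eval-one-plus-var e n) ⟩
    1# + (f - 1#) + 0# * r                               ≈⟨ solve 2 (λ f r → :1 :+ (f :- :1) :+ :0 :* r := f) refl f r ⟩
    f                                                    ∎
    where
    e = f - 1#
    r = proj₁ (eval-* e (suc n) h h)

-- The discriminant over an abstract ring.

module RootAlgebra {c ℓ} (K : CommutativeRing c ℓ) where

  open CommutativeRing K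
  open RingTools K using (solve; _:=_; _:+_; _:*_; :1)

  -- The squares are spelled out in the form to which `^^ 2` unfolds. The factor t² is what makes
  -- `divT 2` exact on the discriminant.
  discriminant-t² : ∀ t x d x₄ → x ≈ t * t → x₄ ≈ (x + x) + (x + x) →
    (d * (d * 1#)) * (x * (x * 1#)) + x₄ ≈ t * (t * ((d * d) * x + ((1# + 1#) + (1# + 1#))))
  discriminant-t² t x d x₄ e e₄ = trans (+-congˡ e₄)
    (trans (solve 2 (λ x d → (d :* (d :* :1)) :* (x :* (x :* :1)) :+ ((x :+ x) :+ (x :+ x)) :=
        x :* ((d :* d) :* x :+ ((:1 :+ :1) :+ (:1 :+ :1)))) refl x d)
      (trans (*-congʳ e) (*-assoc t t _)))

  four-cong : ∀ a b → a ≈ b → (a + a) + (a + a) ≈ (b + b) + (b + b)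
  four-cong a b e = +-cong (+-cong e e) (+-cong e e)

  inverse-congˡ : ∀ a b i → a ≈ b → a * i ≈ 1# → b * i ≈ 1#
  inverse-congˡ a b i e e′ = trans (*-congʳ (sym e)) e′

-- Convexity as a condition on adjacent columns.

module Columns where

  open ≡ using (refl; sym; trans; subst₂)

  ≡-from-⇔ : ∀ {a b} → (a ≡ true → b ≡ true) → (b ≡ true → a ≡ true) → a ≡ b
  ≡-from-⇔ {true}          f g = sym (f refl)
  ≡-from-⇔ {false} {false} f g = refl
  ≡-from-⇔ {false} {true}  f g = g refl

  false≢true : false ≡ true → ⊥
  false≢true ()

  ∧-intro : ∀ {a b} → a ≡ true → b ≡ true → a ∧ b ≡ true
  ∧-intro refl refl = refl

  ∧-elimˡ : ∀ {a b} → a ∧ b ≡ true → a ≡ true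
  ∧-elimˡ {true} _ = refl

  ∧-elimʳ : ∀ {a b} → a ∧ b ≡ true → b ≡ true
  ∧-elimʳ {true} e = e

  ∨-introˡ : ∀ {a b} → a ≡ true → a ∨ b ≡ true
  ∨-introˡ refl = refl

  ∨-introʳ : ∀ {a b} → b ≡ true → a ∨ b ≡ true
  ∨-introʳ {true}  refl = refl
  ∨-introʳ {false} refl = refl

  ∨-elim : ∀ {a b} → a ∨ b ≡ true → a ≡ true ⊎ b ≡ true
  ∨-elim {true}  e = inj₁ refl
  ∨-elim {false} e = inj₂ e

  ⌊⌋-true : {P : Set} (P? : Dec P) → P → ⌊ P? ⌋ ≡ true
  ⌊⌋-true (yes _) p = refl
  ⌊⌋-true (no ¬p) p = contradiction p ¬p

  ⌊⌋-false : {P : Set} (P? : Dec P) → ¬ P → ⌊ P? ⌋ ≡ false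
  ⌊⌋-false (yes p) ¬p = contradiction p ¬p
  ⌊⌋-false (no _)  ¬p = refl

  ⌊⌋-holds : {P : Set} (P? : Dec P) → ⌊ P? ⌋ ≡ true → P
  ⌊⌋-holds (yes p) e = p

  ≤b-true : ∀ {a b} → a ≤ b → (a ≤b b) ≡ true
  ≤b-true {a} {b} = ⌊⌋-true (a ℕ.≤? b)

  ≤b-holds : ∀ {a b} → (a ≤b b) ≡ true → a ≤ b
  ≤b-holds {a} {b} = ⌊⌋-holds (a ℕ.≤? b)

  ≤b-false : ∀ {a b} → b < a → (a ≤b b) ≡ false
  ≤b-false {a} {b} lt = ⌊⌋-false (a ℕ.≤? b) (ℕP.<⇒≱ lt)

  <b-true : ∀ {a b} → a < b → (a <b b) ≡ true
  <b-true {a} {b} = ⌊⌋-true (suc a ℕ.≤? b)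

  <b-holds : ∀ {a b} → (a <b b) ≡ true → a < b
  <b-holds {a} {b} = ⌊⌋-holds (suc a ℕ.≤? b)

  <b-false : ∀ {a b} → b ≤ a → (a <b b) ≡ false
  <b-false {a} {b} le = ⌊⌋-false (suc a ℕ.≤? b) (ℕP.≤⇒≯ le)

  ==-true : ∀ {a b} → a ≡ b → (a == b) ≡ true
  ==-true {a} {b} = ⌊⌋-true (a ℕ.≟ b)

  ==-holds : ∀ {a b} → (a == b) ≡ true → a ≡ b
  ==-holds {a} {b} = ⌊⌋-holds (a ℕ.≟ b)

  ==-false : ∀ {a b} → ¬ (a ≡ b) → (a == b) ≡ false
  ==-false {a} {b} = ⌊⌋-false (a ℕ.≟ b)

  Fits : ℕ → Col → Set
  Fits n (b , u) = b < u × u ≤ n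

  Valid : ℕ → List Col → Set
  Valid n = All (Fits n)

  topsDecrease : List Col → Bool
  topsDecrease []           = true
  topsDecrease (_ ∷ [])     = true
  topsDecrease (c ∷ c′ ∷ cs) = (proj₂ c′ ≤b proj₂ c) ∧ topsDecrease (c′ ∷ cs)

  bottomsIncrease : List Col → Bool
  bottomsIncrease []           = true
  bottomsIncrease (_ ∷ [])     = true
  bottomsIncrease (c ∷ c′ ∷ cs) = (proj₁ c ≤b proj₁ c′) ∧ bottomsIncrease (c′ ∷ cs)

  overlaps : Col → Col → Bool
  overlaps (b , u) (b′ , u′) = (b ⊔ b′) <b (u ⊓ u′)

  -- A row that leaves the polyomino between two adjacent columns cannot come back.
  good : List Col → Bool
  good []            = true
  good (_ ∷ [])      = true
  good (c ∷ c′ ∷ cs) = overlaps c c′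
    ∧ ((proj₂ c ≤b proj₂ c′) ∨ topsDecrease (c′ ∷ cs))
    ∧ ((proj₁ c′ ≤b proj₁ c) ∨ bottomsIncrease (c′ ∷ cs))
    ∧ good (c′ ∷ cs)

  conv : ℕ → List Col → Bool
  conv n cs = hasBottom0 cs ∧ hasTop n cs ∧ good cs

  scan : (Col → Col → Bool) → List Col → List Col → Bool
  scan R prev []       = true
  scan R prev (c ∷ cs) = all (R c) prev ∧ scan R (c ∷ prev) cs

  -- The `with` turns the argument of forallEarlier's local function into a variable,
  -- so that unification can fill that function in for the underscore.
  mutual
    forallEarlier≡scan : ∀ R cs → forallEarlier R cs ≡ scan R [] cs
    forallEarlier≡scan R []       = refl
    forallEarlier≡scan R (c ∷ cs) with c List.∷ List.[]
    ... | prev = local≡scan R prev cs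

    local≡scan : ∀ R prev cs → _ ≡ scan R prev cs
    local≡scan R prev []       = refl
    local≡scan R prev (c ∷ cs) = cong (all (R c) prev ∧_) (local≡scan R (c ∷ prev) cs)

  module Adjacent (R : Col → Col → Bool) (R-trans : ∀ {a b c} → R b a ≡ true → R c b ≡ true → R c a ≡ true) where

    adjacent : List Col → Bool
    adjacent []            = true
    adjacent (_ ∷ [])      = true
    adjacent (c ∷ c′ ∷ cs) = R c′ c ∧ adjacent (c′ ∷ cs)

    all-trans : ∀ c′ c prev → all (R c) prev ≡ true → R c′ c ≡ true → all (R c′) prev ≡ true
    all-trans c′ c []       _ _ = refl
    all-trans c′ c (d ∷ ds) e r = ∧-intro (R-trans (∧-elimˡ {R c d} e) r) (all-trans c′ c ds (∧-elimʳ {R c d} e) r)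

    -- By transitivity a relation to the predecessor `c` extends to everything before `c`; the
    -- hypothesis on `prev` is the invariant that the induction carries along.
    scan-adjacent : ∀ c prev cs → all (R c) prev ≡ true → scan R (c ∷ prev) cs ≡ adjacent (c ∷ cs)
    scan-adjacent c prev []        e = refl
    scan-adjacent c prev (c′ ∷ cs) e = ≡-from-⇔ to from
      where
      to : (R c′ c ∧ all (R c′) prev) ∧ scan R (c′ ∷ c ∷ prev) cs ≡ true → R c′ c ∧ adjacent (c′ ∷ cs) ≡ true
      to h = ∧-intro (∧-elimˡ (∧-elimˡ {R c′ c ∧ all (R c′) prev} h))
        (trans (sym (scan-adjacent c′ (c ∷ prev) cs (∧-elimˡ {R c′ c ∧ all (R c′) prev} h))) (∧-elimʳ {R c′ c ∧ all (R c′) prev} h))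
      from : R c′ c ∧ adjacent (c′ ∷ cs) ≡ true → (R c′ c ∧ all (R c′) prev) ∧ scan R (c′ ∷ c ∷ prev) cs ≡ true
      from h = ∧-intro earlier (trans (scan-adjacent c′ (c ∷ prev) cs earlier) (∧-elimʳ {R c′ c} h))
        where
        earlier : R c′ c ∧ all (R c′) prev ≡ true
        earlier = ∧-intro (∧-elimˡ h) (all-trans c′ c prev e (∧-elimˡ h))

    forallEarlier≡adjacent : ∀ cs → forallEarlier R cs ≡ adjacent cs
    forallEarlier≡adjacent []       = refl
    forallEarlier≡adjacent (c ∷ cs) = trans (forallEarlier≡scan R (c ∷ cs)) (scan-adjacent c [] cs refl)

  isT≡topsDecrease : ∀ cs → isT cs ≡ topsDecrease cs
  isT≡topsDecrease cs = trans (A.forallEarlier≡adjacent cs) (same cs)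
    where
    module A = Adjacent (λ c d → proj₂ c ≤b proj₂ d) (λ e e′ → ≤b-true (ℕP.≤-trans (≤b-holds e′) (≤b-holds e)))
    same : ∀ cs → A.adjacent cs ≡ topsDecrease cs
    same []            = refl
    same (_ ∷ [])      = refl
    same (c ∷ c′ ∷ cs) = cong (_ ∧_) (same (c′ ∷ cs))

  isB≡bottomsIncrease : ∀ cs → isB cs ≡ bottomsIncrease cs
  isB≡bottomsIncrease cs = trans (A.forallEarlier≡adjacent cs) (same cs)
    where
    module A = Adjacent (λ c d → proj₁ d ≤b proj₁ c) (λ e e′ → ≤b-true (ℕP.≤-trans (≤b-holds e) (≤b-holds e′)))
    same : ∀ cs → A.adjacent cs ≡ bottomsIncrease cs
    same []            = refl
    same (_ ∷ [])      = refl
    same (c ∷ c′ ∷ cs) = cong (_ ∧_) (same (c′ ∷ cs))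

  -- Rows and contiguity.

  none : List Bool → Set
  none = All (_≡ false)

  -- The prefix `true ∷ false` puts the local function of `contiguous` into the state in which a
  -- block has ended, from which only `false` is accepted. This prefix is the way to refer to that
  -- state from outside.
  ended⇒none : ∀ bs → contiguous (true ∷ false ∷ bs) ≡ true → none bs
  ended⇒none []           e = []
  ended⇒none (false ∷ bs) e = refl ∷ ended⇒none bs e

  none⇒ended : ∀ {bs} → none bs → contiguous (true ∷ false ∷ bs) ≡ true
  none⇒ended []             = refl
  none⇒ended (refl ∷ ns)    = none⇒ended ns

  none⇒contiguous : ∀ {bs} → none bs → contiguous bs ≡ true
  none⇒contiguous []          = refl
  none⇒contiguous (refl ∷ ns) = none⇒contiguous ns

  contiguous-tail : ∀ x bs → contiguous (x ∷ bs) ≡ true → contiguous bs ≡ true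
  contiguous-tail false bs           e = e
  contiguous-tail true  []           e = refl
  contiguous-tail true  (true ∷ bs)  e = e
  contiguous-tail true  (false ∷ bs) e = none⇒contiguous (ended⇒none bs e)

  all-applyUpTo⇒ : ∀ (P : ℕ → Bool) f n → all P (applyUpTo f n) ≡ true → ∀ i → i < n → P (f i) ≡ true
  all-applyUpTo⇒ P f (suc n) e zero    lt       = ∧-elimˡ {P (f 0)} e
  all-applyUpTo⇒ P f (suc n) e (suc i) (s≤s lt) = all-applyUpTo⇒ P (λ i → f (suc i)) n (∧-elimʳ {P (f 0)} e) i lt

  all-applyUpTo⇐ : ∀ (P : ℕ → Bool) f n → (∀ i → i < n → P (f i) ≡ true) → all P (applyUpTo f n) ≡ true
  all-applyUpTo⇐ P f zero    e = refl
  all-applyUpTo⇐ P f (suc n) e = ∧-intro (e 0 (s≤s z≤n)) (all-applyUpTo⇐ P (λ i → f (suc i)) n (λ i lt → e (suc i) (s≤s lt)))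

  row : ℕ → List Col → List Bool
  row r = map (inRow r)

  inRow-true : ∀ {r b u} → b ≤ r → r < u → inRow r (b , u) ≡ true
  inRow-true b≤r r<u = ∧-intro (≤b-true b≤r) (<b-true r<u)

  above-not-inRow : ∀ {r} b u → u ≤ r → inRow r (b , u) ≡ false
  above-not-inRow {r} b u u≤r rewrite <b-false u≤r = ∧-zeroʳ (b ≤b r)

  below-not-inRow : ∀ {r} b u → r < b → inRow r (b , u) ≡ false
  below-not-inRow b u r<b rewrite ≤b-false r<b = refl

  not-inRow : ∀ {r} b u → inRow r (b , u) ≡ false → u ≤ r ⊎ r < b
  not-inRow {r} b u e with ℕP.<-≤-connex r u | ℕP.<-≤-connex r b
  ... | inj₂ u≤r | _        = inj₁ u≤r
  ... | inj₁ _   | inj₁ r<b = inj₂ r<b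
  ... | inj₁ r<u | inj₂ b≤r = ⊥-elim (false≢true (trans (sym e) (inRow-true b≤r r<u)))

  overlaps⇒<ʳ : ∀ {b u b′ u′} → overlaps (b , u) (b′ , u′) ≡ true → b < u′
  overlaps⇒<ʳ e = ℕP.≤-<-trans (ℕP.m≤m⊔n _ _) (ℕP.<-≤-trans (<b-holds e) (ℕP.m⊓n≤n _ _))

  overlaps⇒<ˡ : ∀ {b u b′ u′} → overlaps (b , u) (b′ , u′) ≡ true → b′ < u
  overlaps⇒<ˡ e = ℕP.≤-<-trans (ℕP.m≤n⊔m _ _) (ℕP.<-≤-trans (<b-holds e) (ℕP.m⊓n≤m _ _))

  overlaps-intro : ∀ {b u b′ u′} → b < u → b < u′ → b′ < u → b′ < u′ → overlaps (b , u) (b′ , u′) ≡ true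
  overlaps-intro p q r s = <b-true (ℕP.⊔-lub (ℕP.⊓-glb p q) (ℕP.⊓-glb r s))

  good-overlaps : ∀ c c′ cs → good (c ∷ c′ ∷ cs) ≡ true → overlaps c c′ ≡ true
  good-overlaps c c′ cs g = ∧-elimˡ {overlaps c c′} g

  good-tops : ∀ c c′ cs → good (c ∷ c′ ∷ cs) ≡ true →
              proj₂ c ≤ proj₂ c′ ⊎ topsDecrease (c′ ∷ cs) ≡ true
  good-tops c c′ cs g with ∨-elim {proj₂ c ≤b proj₂ c′} (∧-elimˡ (∧-elimʳ {overlaps c c′} g))
  ... | inj₁ e = inj₁ (≤b-holds e)
  ... | inj₂ e = inj₂ e

  good-bottoms : ∀ c c′ cs → good (c ∷ c′ ∷ cs) ≡ true →
                 proj₁ c′ ≤ proj₁ c ⊎ bottomsIncrease (c′ ∷ cs) ≡ true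
  good-bottoms c c′ cs g with ∨-elim {proj₁ c′ ≤b proj₁ c}
    (∧-elimˡ (∧-elimʳ {(proj₂ c ≤b proj₂ c′) ∨ topsDecrease (c′ ∷ cs)} (∧-elimʳ {overlaps c c′} g)))
  ... | inj₁ e = inj₁ (≤b-holds e)
  ... | inj₂ e = inj₂ e

  good-tail : ∀ c c′ cs → good (c ∷ c′ ∷ cs) ≡ true → good (c′ ∷ cs) ≡ true
  good-tail c c′ cs g = ∧-elimʳ {(proj₁ c′ ≤b proj₁ c) ∨ bottomsIncrease (c′ ∷ cs)}
    (∧-elimʳ {(proj₂ c ≤b proj₂ c′) ∨ topsDecrease (c′ ∷ cs)} (∧-elimʳ {overlaps c c′} g))

  good-intro : ∀ c c′ cs → overlaps c c′ ≡ true →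
               proj₂ c ≤ proj₂ c′ ⊎ topsDecrease (c′ ∷ cs) ≡ true →
               proj₁ c′ ≤ proj₁ c ⊎ bottomsIncrease (c′ ∷ cs) ≡ true →
               good (c′ ∷ cs) ≡ true → good (c ∷ c′ ∷ cs) ≡ true
  good-intro c c′ cs o t b g = ∧-intro o (∧-intro (tops t) (∧-intro (bottoms b) g))
    where
    tops : proj₂ c ≤ proj₂ c′ ⊎ topsDecrease (c′ ∷ cs) ≡ true → (proj₂ c ≤b proj₂ c′) ∨ topsDecrease (c′ ∷ cs) ≡ true
    tops (inj₁ le) = ∨-introˡ (≤b-true le)
    tops (inj₂ e)  = ∨-introʳ {proj₂ c ≤b proj₂ c′} e
    bottoms : proj₁ c′ ≤ proj₁ c ⊎ bottomsIncrease (c′ ∷ cs) ≡ true → (proj₁ c′ ≤b proj₁ c) ∨ bottomsIncrease (c′ ∷ cs) ≡ true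
    bottoms (inj₁ le) = ∨-introˡ (≤b-true le)
    bottoms (inj₂ e)  = ∨-introʳ {proj₁ c′ ≤b proj₁ c} e

  tops≤ : ∀ c cs → topsDecrease (c ∷ cs) ≡ true → All (λ d → proj₂ d ≤ proj₂ c) cs
  tops≤ c []        t = []
  tops≤ c (c′ ∷ cs) t = u′≤u ∷ All.map (λ le → ℕP.≤-trans le u′≤u) (tops≤ c′ cs (∧-elimʳ {proj₂ c′ ≤b proj₂ c} t))
    where
    u′≤u : proj₂ c′ ≤ proj₂ c
    u′≤u = ≤b-holds (∧-elimˡ t)

  bottoms≥ : ∀ c cs → bottomsIncrease (c ∷ cs) ≡ true → All (λ d → proj₁ c ≤ proj₁ d) cs
  bottoms≥ c []        t = []
  bottoms≥ c (c′ ∷ cs) t = b≤b′ ∷ All.map (λ le → ℕP.≤-trans b≤b′ le) (bottoms≥ c′ cs (∧-elimʳ {proj₁ c ≤b proj₁ c′} t))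
    where
    b≤b′ : proj₁ c ≤ proj₁ c′
    b≤b′ = ≤b-holds (∧-elimˡ t)

  -- The row in question lies directly on top of `c`. The next column overlaps `c`, so it cannot lie
  -- wholly above this row and must end at or below it. If it ends strictly lower, `good` already
  -- forces the later tops to decrease; if it ends at the same height, the same row serves for the
  -- induction.
  no-row-above : ∀ c cs → good (c ∷ cs) ≡ true → none (row (proj₂ c) cs) → topsDecrease (c ∷ cs) ≡ true
  no-row-above c []        g ns       = refl
  no-row-above c@(b , u) (c′@(b′ , u′) ∷ cs) g (n ∷ ns) with not-inRow {u} b′ u′ n
  ... | inj₂ u<b′ = contradiction (overlaps⇒<ˡ {b} {u} {b′} {u′} (good-overlaps c c′ cs g)) (ℕP.<-asym u<b′)
  ... | inj₁ u′≤u with good-tops c c′ cs g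
  ...   | inj₂ t    = ∧-intro (≤b-true u′≤u) t
  ...   | inj₁ u≤u′ = ∧-intro (≤b-true u′≤u)
            (no-row-above c′ cs (good-tail c c′ cs g) (subst (λ r → none (row r cs)) (ℕP.≤-antisym u≤u′ u′≤u) ns))

  -- The mirror image, with the row directly under `c`; writing the bottom edge as `suc r` ensures
  -- that there is such a row.
  no-row-below : ∀ r c cs → proj₁ c ≡ suc r → good (c ∷ cs) ≡ true → none (row r cs) → bottomsIncrease (c ∷ cs) ≡ true
  no-row-below r c []        eq g ns       = refl
  no-row-below r c@(.(suc r) , u) (c′@(b′ , u′) ∷ cs) refl g (n ∷ ns) with not-inRow {r} b′ u′ n
  ... | inj₁ u′≤r = contradiction (overlaps⇒<ʳ {suc r} {u} {b′} {u′} (good-overlaps c c′ cs g)) (ℕP.≤⇒≯ (ℕP.m≤n⇒m≤1+n u′≤r))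
  ... | inj₂ b≤b′ with good-bottoms c c′ cs g
  ...   | inj₂ t    = ∧-intro (≤b-true b≤b′) t
  ...   | inj₁ b′≤b = ∧-intro (≤b-true b≤b′)
            (no-row-below r c′ cs (ℕP.≤-antisym b′≤b b≤b′) (good-tail c c′ cs g) ns)

  -- Where the top drops from `u` to `u′`, row `u′` meets the first column but not the second, so
  -- contiguity keeps it away from all later ones, and `no-row-above` applies. Where the bottom
  -- rises, the row just under `b′` plays this role.
  contiguous⇒good : ∀ n cs → Valid n cs → connected cs ≡ true →
                    (∀ r → r < n → contiguous (row r cs) ≡ true) → good cs ≡ true
  contiguous⇒good n []       v conn rows = refl
  contiguous⇒good n (c ∷ []) v conn rows = refl
  contiguous⇒good n (c@(b , u) ∷ c′@(b′ , u′) ∷ cs) ((b<u , u≤n) ∷ v) conn rows =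
    good-intro c c′ cs o tops bottoms g
    where
    o : overlaps c c′ ≡ true
    o = ∧-elimˡ {overlaps c c′} conn
    g : good (c′ ∷ cs) ≡ true
    g = contiguous⇒good n (c′ ∷ cs) v (∧-elimʳ {overlaps c c′} conn)
          (λ r r<n → contiguous-tail (inRow r c) (row r (c′ ∷ cs)) (rows r r<n))
    leaves : ∀ r → inRow r c ≡ true → inRow r c′ ≡ false → r < n → none (row r cs)
    leaves r e e′ r<n = ended⇒none (row r cs)
      (subst₂ (λ x y → contiguous (x ∷ y ∷ row r cs) ≡ true) e e′ (rows r r<n))
    tops : u ≤ u′ ⊎ topsDecrease (c′ ∷ cs) ≡ true
    tops with ℕP.<-≤-connex u′ u
    ... | inj₂ u≤u′ = inj₁ u≤u′
    ... | inj₁ u′<u = inj₂ (no-row-above c′ cs g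
            (leaves u′ (inRow-true (ℕP.<⇒≤ (overlaps⇒<ʳ {b} {u} {b′} {u′} o)) u′<u) (above-not-inRow b′ u′ ℕP.≤-refl) (ℕP.<-≤-trans u′<u u≤n)))
    bottoms : b′ ≤ b ⊎ bottomsIncrease (c′ ∷ cs) ≡ true
    bottoms with ℕP.<-≤-connex b b′
    ... | inj₂ b′≤b = inj₁ b′≤b
    ... | inj₁ b<b′ = inj₂ (no-row-below r c′ cs eq g
            (leaves r (inRow-true (ℕP.≤-pred (subst (b <_) eq b<b′)) r<u) (below-not-inRow b′ u′ (ℕP.≤-reflexive (sym eq)))
              (ℕP.<-≤-trans r<u u≤n)))
      where
      -- Since b < b′, the edge `b′` is positive and the row just under it still meets `c`.
      r : ℕ
      r = ℕ.pred b′
      eq : b′ ≡ suc r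
      eq = sym (ℕP.suc-pred b′ {{ℕ.>-nonZero (ℕP.≤-<-trans z≤n b<b′)}})
      r<u : r < u
      r<u = ℕP.<-trans (ℕP.≤-reflexive (sym eq)) (overlaps⇒<ˡ {b} {u} {b′} {u′} o)

  good⇒connected : ∀ cs → good cs ≡ true → connected cs ≡ true
  good⇒connected []            g = refl
  good⇒connected (c ∷ [])      g = refl
  good⇒connected (c ∷ c′ ∷ cs) g = ∧-intro (good-overlaps c c′ cs g) (good⇒connected (c′ ∷ cs) (good-tail c c′ cs g))

  -- Contiguity can only be lost if the row meets `c` and misses `c′`. It then lies above `c′`,
  -- where the tops decrease from `c′` on, or below `c′`, where the bottoms increase; either way no
  -- later column reaches it.
  good⇒contiguous-∷ : ∀ c c′ cs r → good (c ∷ c′ ∷ cs) ≡ true →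
    contiguous (row r (c′ ∷ cs)) ≡ true → contiguous (row r (c ∷ c′ ∷ cs)) ≡ true
  good⇒contiguous-∷ c c′ cs r g tail = extend (inRow r c) (inRow r c′) refl refl
    where
    b  = proj₁ c
    b′ = proj₁ c′
    u′ = proj₂ c′
    row-none : ∀ {P : Col → Set} → (∀ b u → P (b , u) → inRow r (b , u) ≡ false) → ∀ cs → All P cs → none (row r cs)
    row-none f []       []       = []
    row-none f (c ∷ cs) (p ∷ ps) = f (proj₁ c) (proj₂ c) p ∷ row-none f cs ps
    gone : inRow r c ≡ true → inRow r c′ ≡ false → none (row r cs)
    gone e e′ with not-inRow {r} b′ u′ e′
    ... | inj₁ u′≤r with good-tops c c′ cs g
    ...   | inj₁ u≤u′ = contradiction (<b-holds (∧-elimʳ {b ≤b r} e)) (ℕP.≤⇒≯ (ℕP.≤-trans u≤u′ u′≤r))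
    ...   | inj₂ t    = row-none (λ b u le → above-not-inRow b u (ℕP.≤-trans le u′≤r)) cs (tops≤ c′ cs t)
    gone e e′ | inj₂ r<b′ with good-bottoms c c′ cs g
    ...   | inj₁ b′≤b = contradiction (≤b-holds (∧-elimˡ {b ≤b r} e)) (ℕP.<⇒≱ (ℕP.<-≤-trans r<b′ b′≤b))
    ...   | inj₂ t    = row-none (λ b u le → below-not-inRow b u (ℕP.<-≤-trans r<b′ le)) cs (bottoms≥ c′ cs t)
    extend : ∀ x x′ → inRow r c ≡ x → inRow r c′ ≡ x′ → contiguous (inRow r c ∷ inRow r c′ ∷ row r cs) ≡ true
    extend false x′    e e′ rewrite e = tail
    extend true  true  e e′ = subst₂ (λ x y → contiguous (x ∷ y ∷ row r cs) ≡ true) (sym e) (sym e′)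
                                (subst (λ y → contiguous (y ∷ row r cs) ≡ true) e′ tail)
    extend true  false e e′ = subst₂ (λ x y → contiguous (x ∷ y ∷ row r cs) ≡ true) (sym e) (sym e′)
                                (none⇒ended (gone e e′))

  good⇒contiguous : ∀ cs → good cs ≡ true → ∀ r → contiguous (row r cs) ≡ true
  good⇒contiguous []            g r = refl
  good⇒contiguous (c ∷ []) g r with inRow r c
  ... | true  = refl
  ... | false = refl
  good⇒contiguous (c ∷ c′ ∷ cs) g r =
    good⇒contiguous-∷ c c′ cs r g (good⇒contiguous (c′ ∷ cs) (good-tail c c′ cs g) r)

  connected∧rowConvex≡good : ∀ n cs → Valid n cs → connected cs ∧ rowConvex n cs ≡ good cs
  connected∧rowConvex≡good n cs v = ≡-from-⇔
    (λ h → contiguous⇒good n cs v (∧-elimˡ {connected cs} h)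
             (all-applyUpTo⇒ (λ r → contiguous (row r cs)) (λ r → r) n (∧-elimʳ {connected cs} h)))
    (λ g → ∧-intro (good⇒connected cs g)
             (all-applyUpTo⇐ (λ r → contiguous (row r cs)) (λ r → r) n (λ r _ → good⇒contiguous cs g r)))

  -- Reflection in a horizontal line, within the strip 0 ≤ height ≤ n.
  flip : ℕ → Col → Col
  flip n (b , u) = n ∸ u , n ∸ b

  ∸-cancel-≤ : ∀ {a b n} → b ≤ n → n ∸ a ≤ n ∸ b → b ≤ a
  ∸-cancel-≤ {a} {b} {n} b≤n le with ℕP.<-≤-connex a b
  ... | inj₂ b≤a = b≤a
  ... | inj₁ a<b = contradiction le (ℕP.<⇒≱ (ℕP.∸-monoʳ-< a<b b≤n))

  ∸-≤b : ∀ {a b n} → b ≤ n → ((n ∸ a) ≤b (n ∸ b)) ≡ (b ≤b a)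
  ∸-≤b {a} {b} {n} b≤n = ≡-from-⇔
    (λ e → ≤b-true (∸-cancel-≤ b≤n (≤b-holds e)))
    (λ e → ≤b-true (ℕP.∸-monoʳ-≤ n (≤b-holds e)))

  ∸-== : ∀ {a b n} → a ≤ n → b ≤ n → ((n ∸ a) == (n ∸ b)) ≡ (a == b)
  ∸-== {a} {b} {n} a≤n b≤n = ≡-from-⇔
    (λ e → ==-true (ℕP.∸-cancelˡ-≡ a≤n b≤n (==-holds e)))
    (λ e → ==-true (cong (n ∸_) (==-holds e)))

  fits-bottom : ∀ {n} c → Fits n c → proj₁ c ≤ n
  fits-bottom (b , u) (b<u , u≤n) = ℕP.<⇒≤ (ℕP.<-≤-trans b<u u≤n)

  flip-topsDecrease : ∀ {n cs} → Valid n cs → topsDecrease (map (flip n) cs) ≡ bottomsIncrease cs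
  flip-topsDecrease []           = refl
  flip-topsDecrease (_ ∷ [])     = refl
  flip-topsDecrease {n} (_∷_ {x = c} f (f′ ∷ v)) = cong₂ _∧_ (∸-≤b (fits-bottom c f)) (flip-topsDecrease (f′ ∷ v))

  flip-bottomsIncrease : ∀ {n cs} → Valid n cs → bottomsIncrease (map (flip n) cs) ≡ topsDecrease cs
  flip-bottomsIncrease []           = refl
  flip-bottomsIncrease (_ ∷ [])     = refl
  flip-bottomsIncrease {n} (f ∷ (f′ ∷ v)) = cong₂ _∧_ (∸-≤b (proj₂ f′)) (flip-bottomsIncrease (f′ ∷ v))

  flip-overlaps : ∀ {n} c c′ → Fits n c → Fits n c′ → overlaps (flip n c) (flip n c′) ≡ overlaps c c′
  flip-overlaps {n} (b , u) (b′ , u′) (p , q) (p′ , q′) = ≡-from-⇔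
    (λ e → <b-true (∸-cancel-< (subst₂ _<_ (sym (ℕP.∸-distribˡ-⊓-⊔ n u u′)) (sym (ℕP.∸-distribˡ-⊔-⊓ n b b′)) (<b-holds e))))
    (λ e → <b-true (subst₂ _<_ (ℕP.∸-distribˡ-⊓-⊔ n u u′) (ℕP.∸-distribˡ-⊔-⊓ n b b′) (ℕP.∸-monoʳ-< (<b-holds e) (ℕP.≤-trans (ℕP.m⊓n≤m u u′) q))))
    where
    ∸-cancel-< : ∀ {x y} → n ∸ x < n ∸ y → y < x
    ∸-cancel-< {x} {y} lt with ℕP.<-≤-connex y x
    ... | inj₁ y<x = y<x
    ... | inj₂ x≤y = contradiction (ℕP.∸-monoʳ-≤ n x≤y) (ℕP.<⇒≱ lt)

  ∧-swap : ∀ x y z → x ∧ y ∧ z ≡ y ∧ x ∧ z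
  ∧-swap true  y     z = refl
  ∧-swap false true  z = refl
  ∧-swap false false z = refl

  flip-good : ∀ {n cs} → Valid n cs → good (map (flip n) cs) ≡ good cs
  flip-good []       = refl
  flip-good (_ ∷ []) = refl
  flip-good {n} (_∷_ {x = c} f (_∷_ {x = c′} {xs = cs} f′ v)) = trans
    (cong₂ _∧_ (flip-overlaps c c′ f f′)
      (cong₂ _∧_ (cong₂ _∨_ (∸-≤b {proj₁ c} {proj₁ c′} (fits-bottom c′ f′)) (flip-topsDecrease (f′ ∷ v)))
        (cong₂ _∧_ (cong₂ _∨_ (∸-≤b {proj₂ c′} {proj₂ c} (proj₂ f)) (flip-bottomsIncrease (f′ ∷ v))) (flip-good (f′ ∷ v)))))
    (cong (overlaps c c′ ∧_)
      (∧-swap ((proj₁ c′ ≤b proj₁ c) ∨ bottomsIncrease (c′ ∷ cs)) ((proj₂ c ≤b proj₂ c′) ∨ topsDecrease (c′ ∷ cs)) (good (c′ ∷ cs))))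

  flip-hasBottom0 : ∀ {n cs} → Valid n cs → hasBottom0 (map (flip n) cs) ≡ hasTop n cs
  flip-hasBottom0 [] = refl
  flip-hasBottom0 {n} (_∷_ {x = c} f v) = cong₂ _∨_
    (trans (cong ((n ∸ proj₂ c) ==_) (sym (ℕP.n∸n≡0 n))) (∸-== (proj₂ f) ℕP.≤-refl)) (flip-hasBottom0 v)

  flip-hasTop : ∀ {n cs} → Valid n cs → hasTop n (map (flip n) cs) ≡ hasBottom0 cs
  flip-hasTop [] = refl
  flip-hasTop {n} (_∷_ {x = c} f v) = cong₂ _∨_ (∸-== {proj₁ c} {0} (fits-bottom c f) z≤n) (flip-hasTop v)

  flip-conv : ∀ {n cs} → Valid n cs → conv n (map (flip n) cs) ≡ conv n cs
  flip-conv {n} {cs} v = trans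
    (cong₂ _∧_ (flip-hasBottom0 v) (cong₂ _∧_ (flip-hasTop v) (flip-good v)))
    (∧-swap (hasTop n cs) (hasBottom0 cs) (good cs))

  flip-countB : ∀ {n cs} → Valid n cs → countB (map (flip n) cs) ≡ countU cs
  flip-countB []       = refl
  flip-countB (_ ∷ []) = refl
  flip-countB (f ∷ (f′ ∷ v)) = cong₂ ℕ._+_ (cong (if_then 1 else 0) (∸-== (proj₂ f) (proj₂ f′))) (flip-countB (f′ ∷ v))

  flip-countU : ∀ {n cs} → Valid n cs → countU (map (flip n) cs) ≡ countB cs
  flip-countU []       = refl
  flip-countU (_ ∷ []) = refl
  flip-countU (_∷_ {x = c} f (_∷_ {x = c′} f′ v)) =
    cong₂ ℕ._+_ (cong (if_then 1 else 0) (∸-== (fits-bottom c f) (fits-bottom c′ f′))) (flip-countU (f′ ∷ v))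

  flip-leftHeight : ∀ {n cs} → Valid n cs → leftHeight (map (flip n) cs) ≡ leftHeight cs
  flip-leftHeight [] = refl
  flip-leftHeight {n} (_∷_ {x = b , u} (b<u , u≤n) _) = trans (ℕP.∸-+-assoc n b (n ∸ u))
    (trans (cong (n ∸_) (ℕP.+-comm b (n ∸ u))) (trans (sym (ℕP.∸-+-assoc n (n ∸ u) b)) (cong (_∸ b) (ℕP.m∸[m∸n]≡n u≤n))))

  flip-flip : ∀ {n cs} → Valid n cs → map (flip n) (map (flip n) cs) ≡ cs
  flip-flip [] = refl
  flip-flip {n} (_∷_ {x = c} f v) =
    cong₂ _∷_ (cong₂ _,_ (ℕP.m∸[m∸n]≡n (fits-bottom c f)) (ℕP.m∸[m∸n]≡n (proj₂ f))) (flip-flip v)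

  -- The first column and the bounding box.

  hasTop-bound : ∀ {n m} cs → All (λ d → proj₂ d ≤ m) cs → hasTop n cs ≡ true → n ≤ m
  hasTop-bound {n} (d ∷ cs) (le ∷ les) e with ∨-elim {proj₂ d == n} e
  ... | inj₁ e′ = ℕP.≤-trans (ℕP.≤-reflexive (sym (==-holds e′))) le
  ... | inj₂ e′ = hasTop-bound cs les e′

  hasBottom0-bound : ∀ {m} cs → All (λ d → m ≤ proj₁ d) cs → hasBottom0 cs ≡ true → m ≡ 0
  hasBottom0-bound (d ∷ cs) (le ∷ les) e with ∨-elim {proj₁ d == 0} e
  ... | inj₁ e′ = ℕP.n≤0⇒n≡0 (ℕP.≤-trans le (ℕP.≤-reflexive (==-holds e′)))
  ... | inj₂ e′ = hasBottom0-bound cs les e′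

  -- The first top bounds all the others, so it alone decides into which strip the list fits. This
  -- is how strips get smaller in the later recursions.
  topsDecrease⇒valid : ∀ {n m} c cs → Valid n (c ∷ cs) → topsDecrease (c ∷ cs) ≡ true → proj₂ c ≤ m → Valid m (c ∷ cs)
  topsDecrease⇒valid {n} {m} c cs (f ∷ v) t le = (proj₁ f , le) ∷ go cs v (tops≤ c cs t)
    where
    go : ∀ cs → Valid n cs → All (λ d → proj₂ d ≤ proj₂ c) cs → Valid m cs
    go []       []      []        = []
    go (d ∷ cs) (f ∷ v) (l ∷ ls) = (proj₁ f , ℕP.≤-trans l le) ∷ go cs v ls

  hasTop-topsDecrease : ∀ {n} c cs → proj₂ c ≤ n → topsDecrease (c ∷ cs) ≡ true → hasTop n (c ∷ cs) ≡ true → proj₂ c ≡ n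
  hasTop-topsDecrease c cs le t e = ℕP.≤-antisym le (hasTop-bound (c ∷ cs) (ℕP.≤-refl ∷ tops≤ c cs t) e)

  hasBottom0-bottomsIncrease : ∀ c cs → bottomsIncrease (c ∷ cs) ≡ true → hasBottom0 (c ∷ cs) ≡ true → proj₁ c ≡ 0
  hasBottom0-bottomsIncrease c cs t e = hasBottom0-bound (c ∷ cs) (ℕP.≤-refl ∷ bottoms≥ c cs t) e

  -- The first column has the greatest top, so touching the upper edge of the box becomes a
  -- condition on that column alone.
  conv-topsDecrease : ∀ {n} c cs → proj₂ c ≤ n →
    conv n (c ∷ cs) ∧ topsDecrease (c ∷ cs) ≡
    (proj₂ c == n) ∧ hasBottom0 (c ∷ cs) ∧ topsDecrease (c ∷ cs) ∧ good (c ∷ cs)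
  conv-topsDecrease {n} c cs le = ≡-from-⇔
    (λ h → let k = ∧-elimˡ {conv n (c ∷ cs)} h ; t = ∧-elimʳ {conv n (c ∷ cs)} h
               k′ = ∧-elimʳ {hasBottom0 (c ∷ cs)} k in
       ∧-intro (==-true (hasTop-topsDecrease c cs le t (∧-elimˡ {hasTop n (c ∷ cs)} k′)))
         (∧-intro (∧-elimˡ {hasBottom0 (c ∷ cs)} k) (∧-intro t (∧-elimʳ {hasTop n (c ∷ cs)} k′))))
    (λ h → let h′ = ∧-elimʳ {proj₂ c == n} h ; h″ = ∧-elimʳ {hasBottom0 (c ∷ cs)} h′ in
       ∧-intro (∧-intro (∧-elimˡ {hasBottom0 (c ∷ cs)} h′)
         (∧-intro (∨-introˡ (∧-elimˡ {proj₂ c == n} h)) (∧-elimʳ {topsDecrease (c ∷ cs)} h″)))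
         (∧-elimˡ {topsDecrease (c ∷ cs)} h″))

  -- The class behind G^bt without the normalisation of heights: such a list may float anywhere in a
  -- strip, as it does next to a column that sticks out on both sides.
  pyramid : List Col → Bool
  pyramid cs = topsDecrease cs ∧ bottomsIncrease cs ∧ good cs

  conv-pyramid : ∀ {n} c cs → proj₂ c ≤ n →
    conv n (c ∷ cs) ∧ topsDecrease (c ∷ cs) ∧ bottomsIncrease (c ∷ cs) ≡
    (proj₂ c == n) ∧ (proj₁ c == 0) ∧ pyramid (c ∷ cs)
  conv-pyramid {n} c cs le = ≡-from-⇔
    (λ h → let k = ∧-elimˡ {conv n (c ∷ cs)} h ; tb = ∧-elimʳ {conv n (c ∷ cs)} h
               k′ = ∧-elimʳ {hasBottom0 (c ∷ cs)} k
               t = ∧-elimˡ {topsDecrease (c ∷ cs)} tb ; b = ∧-elimʳ {topsDecrease (c ∷ cs)} tb in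
       ∧-intro (==-true (hasTop-topsDecrease c cs le t (∧-elimˡ {hasTop n (c ∷ cs)} k′)))
         (∧-intro (==-true (hasBottom0-bottomsIncrease c cs b (∧-elimˡ {hasBottom0 (c ∷ cs)} k)))
           (∧-intro t (∧-intro b (∧-elimʳ {hasTop n (c ∷ cs)} k′)))))
    (λ h → let h′ = ∧-elimʳ {proj₂ c == n} h ; y = ∧-elimʳ {proj₁ c == 0} h′
               t = ∧-elimˡ {topsDecrease (c ∷ cs)} y ; y′ = ∧-elimʳ {topsDecrease (c ∷ cs)} y in
       ∧-intro (∧-intro (∨-introˡ (∧-elimˡ {proj₁ c == 0} h′))
         (∧-intro (∨-introˡ (∧-elimˡ {proj₂ c == n} h)) (∧-elimʳ {bottomsIncrease (c ∷ cs)} y′)))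
         (∧-intro t (∧-elimˡ {bottomsIncrease (c ∷ cs)} y′)))

  -- A column within the vertical range of its neighbour touches an edge of the box only where the
  -- neighbour does, and its position satisfies the first alternative in both monotonicity
  -- conditions of `good`.
  conv-inside : ∀ {n} b u b′ u′ cs → b < u → Valid n ((b′ , u′) ∷ cs) → b′ ≤ b → u ≤ u′ →
    conv n ((b , u) ∷ (b′ , u′) ∷ cs) ≡ conv n ((b′ , u′) ∷ cs)
  conv-inside {n} b u b′ u′ cs b<u ((b′<u′ , u′≤n) ∷ v) b′≤b u≤u′ =
    cong₂ _∧_ bottom (cong₂ _∧_ top good≡)
    where
    r = (b′ , u′) ∷ cs
    bottom : (b == 0) ∨ hasBottom0 r ≡ hasBottom0 r
    bottom = ≡-from-⇔
      (λ h → bottom′ (∨-elim {b == 0} h))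
      (λ h → ∨-introʳ {b == 0} h)
      where
      bottom′ : (b == 0) ≡ true ⊎ hasBottom0 r ≡ true → hasBottom0 r ≡ true
      bottom′ (inj₁ e) = ∨-introˡ (==-true (ℕP.n≤0⇒n≡0 (subst (b′ ≤_) (==-holds e) b′≤b)))
      bottom′ (inj₂ e) = e
    top : (u == n) ∨ hasTop n r ≡ hasTop n r
    top = ≡-from-⇔
      (λ h → top′ (∨-elim {u == n} h))
      (λ h → ∨-introʳ {u == n} h)
      where
      top′ : (u == n) ≡ true ⊎ hasTop n r ≡ true → hasTop n r ≡ true
      top′ (inj₁ e) = ∨-introˡ (==-true (ℕP.≤-antisym u′≤n (subst (_≤ u′) (==-holds e) u≤u′)))
      top′ (inj₂ e) = e
    good≡ : good ((b , u) ∷ r) ≡ good r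
    good≡ = ≡-from-⇔ (good-tail (b , u) (b′ , u′) cs)
      (good-intro (b , u) (b′ , u′) cs
        (overlaps-intro b<u (ℕP.<-≤-trans b<u u≤u′) (ℕP.≤-<-trans b′≤b b<u) b′<u′) (inj₁ u≤u′) (inj₁ b′≤b))

  -- All later tops are at most u′ < u, so the new column alone reaches the upper edge. The rest
  -- must still reach the lower edge, since the new column does not go below its neighbour, but it
  -- is free of any condition at the top.
  conv-above : ∀ {n} b u b′ u′ cs → b < u → u ≤ n → Valid n ((b′ , u′) ∷ cs) → b′ ≤ b → u′ < u →
    conv n ((b , u) ∷ (b′ , u′) ∷ cs) ≡
    (u == n) ∧ (b <b u′) ∧ hasBottom0 ((b′ , u′) ∷ cs) ∧ topsDecrease ((b′ , u′) ∷ cs) ∧ good ((b′ , u′) ∷ cs)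
  conv-above {n} b u b′ u′ cs b<u u≤n ((b′<u′ , u′≤n) ∷ v) b′≤b u′<u = ≡-from-⇔ to from
    where
    c = (b , u)
    c′ = (b′ , u′)
    r = c′ ∷ cs
    to : conv n (c ∷ r) ≡ true → (u == n) ∧ (b <b u′) ∧ hasBottom0 r ∧ topsDecrease r ∧ good r ≡ true
    to h = ∧-intro (top (∨-elim {u == n} (∧-elimˡ {hasTop n (c ∷ r)} h′)))
      (∧-intro (<b-true (overlaps⇒<ʳ {b} {u} {b′} {u′} (good-overlaps c c′ cs g)))
      (∧-intro (bottom (∨-elim {b == 0} (∧-elimˡ {hasBottom0 (c ∷ r)} h))) (∧-intro t (good-tail c c′ cs g))))
      where
      h′ = ∧-elimʳ {hasBottom0 (c ∷ r)} h
      g : good (c ∷ r) ≡ true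
      g = ∧-elimʳ {hasTop n (c ∷ r)} h′
      t : topsDecrease r ≡ true
      t with good-tops c c′ cs g
      ... | inj₁ u≤u′ = contradiction u≤u′ (ℕP.<⇒≱ u′<u)
      ... | inj₂ t    = t
      top : (u == n) ≡ true ⊎ hasTop n r ≡ true → (u == n) ≡ true
      top (inj₁ e) = e
      top (inj₂ e) = contradiction (hasTop-bound r (ℕP.≤-refl ∷ tops≤ c′ cs t) e) (ℕP.<⇒≱ (ℕP.<-≤-trans u′<u u≤n))
      bottom : (b == 0) ≡ true ⊎ hasBottom0 r ≡ true → hasBottom0 r ≡ true
      bottom (inj₁ e) = ∨-introˡ (==-true (ℕP.n≤0⇒n≡0 (subst (b′ ≤_) (==-holds e) b′≤b)))
      bottom (inj₂ e) = e
    from : (u == n) ∧ (b <b u′) ∧ hasBottom0 r ∧ topsDecrease r ∧ good r ≡ true → conv n (c ∷ r) ≡ true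
    from h = ∧-intro (∨-introʳ {b == 0} (∧-elimˡ {hasBottom0 r} h₂)) (∧-intro (∨-introˡ (∧-elimˡ {u == n} h))
      (good-intro c c′ cs (overlaps-intro b<u (<b-holds (∧-elimˡ {b <b u′} h₁)) (ℕP.<-trans b′<u′ u′<u) b′<u′)
        (inj₂ (∧-elimˡ {topsDecrease r} h₃)) (inj₁ b′≤b) (∧-elimʳ {topsDecrease r} h₃)))
      where
      h₁ = ∧-elimʳ {u == n} h
      h₂ = ∧-elimʳ {b <b u′} h₁
      h₃ = ∧-elimʳ {hasBottom0 r} h₂

  -- The new column is strictly longer at both ends than everything after it, so it must span the
  -- whole box; the rest keeps only its shape.
  conv-outside : ∀ {n} b u b′ u′ cs → b < u → u ≤ n → Valid n ((b′ , u′) ∷ cs) → b < b′ → u′ < u →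
    conv n ((b , u) ∷ (b′ , u′) ∷ cs) ≡ (u == n) ∧ (b == 0) ∧ pyramid ((b′ , u′) ∷ cs)
  conv-outside {n} b u b′ u′ cs b<u u≤n ((b′<u′ , u′≤n) ∷ v) b<b′ u′<u = ≡-from-⇔ to from
    where
    c = (b , u)
    c′ = (b′ , u′)
    r = c′ ∷ cs
    to : conv n (c ∷ r) ≡ true → (u == n) ∧ (b == 0) ∧ pyramid r ≡ true
    to h = ∧-intro (top (∨-elim {u == n} (∧-elimˡ {hasTop n (c ∷ r)} h′)))
      (∧-intro (bottom (∨-elim {b == 0} (∧-elimˡ {hasBottom0 (c ∷ r)} h))) (∧-intro t (∧-intro i (good-tail c c′ cs g))))
      where
      h′ = ∧-elimʳ {hasBottom0 (c ∷ r)} h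
      g : good (c ∷ r) ≡ true
      g = ∧-elimʳ {hasTop n (c ∷ r)} h′
      t : topsDecrease r ≡ true
      t with good-tops c c′ cs g
      ... | inj₁ u≤u′ = contradiction u≤u′ (ℕP.<⇒≱ u′<u)
      ... | inj₂ t    = t
      i : bottomsIncrease r ≡ true
      i with good-bottoms c c′ cs g
      ... | inj₁ b′≤b = contradiction b′≤b (ℕP.<⇒≱ b<b′)
      ... | inj₂ i    = i
      top : (u == n) ≡ true ⊎ hasTop n r ≡ true → (u == n) ≡ true
      top (inj₁ e) = e
      top (inj₂ e) = contradiction (hasTop-bound r (ℕP.≤-refl ∷ tops≤ c′ cs t) e) (ℕP.<⇒≱ (ℕP.<-≤-trans u′<u u≤n))
      bottom : (b == 0) ≡ true ⊎ hasBottom0 r ≡ true → (b == 0) ≡ true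
      bottom (inj₁ e) = e
      bottom (inj₂ e) = contradiction (subst (b <_) (hasBottom0-bottomsIncrease c′ cs i e) b<b′) ℕP.n≮0
    from : (u == n) ∧ (b == 0) ∧ pyramid r ≡ true → conv n (c ∷ r) ≡ true
    from h = ∧-intro (∨-introˡ (∧-elimˡ {b == 0} h₁)) (∧-intro (∨-introˡ (∧-elimˡ {u == n} h))
      (good-intro c c′ cs (overlaps-intro b<u (ℕP.<-trans b<b′ b′<u′) (ℕP.<-trans b′<u′ u′<u) b′<u′)
        (inj₂ (∧-elimˡ {topsDecrease r} h₂)) (inj₂ (∧-elimˡ {bottomsIncrease r} h₃)) (∧-elimʳ {bottomsIncrease r} h₃)))
      where
      h₁ = ∧-elimʳ {u == n} h
      h₂ = ∧-elimʳ {b == 0} h₁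
      h₃ = ∧-elimʳ {topsDecrease r} h₂

open Columns

-- Sums over columns and over lists of columns.

module ColSums {c ℓ} (K : CommutativeRing c ℓ) where

  open RingTools K using (solve; _:=_; _:+_)
  open Sums K

  open CommutativeRing K
  open import Relation.Binary.Reasoning.Setoid setoid

  when : Bool → Carrier → Carrier
  when b x = if b then x else 0#

  when-cong : ∀ b {x y} → (b ≡ true → x ≈ y) → when b x ≈ when b y
  when-cong true  e = e ≡.refl
  when-cong false e = refl

  when-true : ∀ {b} x → b ≡ true → when b x ≈ x
  when-true x ≡.refl = refl

  when-false : ∀ {b} x → b ≡ false → when b x ≈ 0#
  when-false x ≡.refl = refl

  when-0 : ∀ b {x} → (b ≡ true → x ≈ 0#) → when b x ≈ 0#
  when-0 true  e = e ≡.refl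
  when-0 false e = refl

  when-+ : ∀ b x y → when b (x + y) ≈ when b x + when b y
  when-+ true  x y = refl
  when-+ false x y = sym (+-identityˡ 0#)

  *-when : ∀ b k x → k * when b x ≈ when b (k * x)
  *-when true  k x = refl
  *-when false k x = zeroʳ k

  when-∧ : ∀ a b x → when (a ∧ b) x ≡ when a (when b x)
  when-∧ true  b x = ≡.refl
  when-∧ false b x = ≡.refl

  when-swap : ∀ a b x → when a (when b x) ≡ when b (when a x)
  when-swap true  b     x = ≡.refl
  when-swap false true  x = ≡.refl
  when-swap false false x = ≡.refl

  -- The sum over a first column has to be moved past a sum over columns and past a sum over lists;
  -- the three laws are what the interchange needs of either.
  record Additive {A : Set} (L : (A → Carrier) → Carrier) : Set (c Level.⊔ ℓ) where
    field
      L-cong : ∀ {f g} → (∀ a → f a ≈ g a) → L f ≈ L g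
      L-+    : ∀ f g → L (λ a → f a + g a) ≈ L f + L g
      L-0    : L (λ _ → 0#) ≈ 0#

    L-∑ : ∀ n (f : A → ℕ → Carrier) → L (λ a → ∑ n (f a)) ≈ ∑ n (λ i → L (λ a → f a i))
    L-∑ zero    f = refl
    L-∑ (suc n) f = trans (L-+ _ _) (+-congʳ (L-∑ n f))

    L-when : ∀ b (f : A → Carrier) → L (λ a → when b (f a)) ≈ when b (L f)
    L-when true  f = refl
    L-when false f = L-0

  open Additive

  -- Both edges range over the full interval, and `when` removes the pairs that are not columns.
  -- With constant bounds, interchanging and reversing the two sums creates no dependent ranges.
  ∑col : ℕ → (Col → Carrier) → Carrier
  ∑col n f = ∑ n λ b → ∑ n λ u → when (b <b u) (f (b , u))

  ∑col-cong : ∀ n {f g} → (∀ c → Fits n c → f c ≈ g c) → ∑col n f ≈ ∑col n g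
  ∑col-cong n e = ∑-cong′ n λ b → ∑-cong n λ u u≤n → when-cong (b <b u) λ b<u → e (b , u) (<b-holds b<u , u≤n)

  ∑col-+ : ∀ n f g → ∑col n (λ c → f c + g c) ≈ ∑col n f + ∑col n g
  ∑col-+ n f g = trans
    (∑-cong′ n λ b → trans (∑-cong′ n λ u → when-+ (b <b u) _ _) (∑-+ n _ _)) (∑-+ n _ _)

  ∑col-0 : ∀ n {f} → (∀ c → Fits n c → f c ≈ 0#) → ∑col n f ≈ 0#
  ∑col-0 n e = ∑-0 n λ b _ → ∑-0 n λ u u≤n → when-0 (b <b u) λ b<u → e (b , u) (<b-holds b<u , u≤n)

  *-∑col : ∀ n k f → k * ∑col n f ≈ ∑col n (λ c → k * f c)
  *-∑col n k f = trans (*-∑ n k _) (∑-cong′ n λ b → trans (*-∑ n k _) (∑-cong′ n λ u → *-when (b <b u) k _))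

  ∑col-additive : ∀ n → Additive (∑col n)
  ∑col-additive n = record
    { L-cong = λ e → ∑col-cong n (λ c _ → e c) ; L-+ = ∑col-+ n ; L-0 = ∑col-0 n (λ _ _ → refl) }

  ∑L : ℕ → ℕ → (List Col → Carrier) → Carrier
  ∑L zero    n f = f []
  ∑L (suc m) n f = ∑col n λ c → ∑L m n λ cs → f (c ∷ cs)

  ∑L-cong : ∀ m n {f g} → (∀ cs → Valid n cs → f cs ≈ g cs) → ∑L m n f ≈ ∑L m n g
  ∑L-cong zero    n e = e [] []
  ∑L-cong (suc m) n e = ∑col-cong n λ c fc → ∑L-cong m n λ cs v → e (c ∷ cs) (fc ∷ v)

  ∑L-cong-∷ : ∀ m n {f g} → (∀ c cs → Valid n (c ∷ cs) → f (c ∷ cs) ≈ g (c ∷ cs)) → ∑L (suc m) n f ≈ ∑L (suc m) n g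
  ∑L-cong-∷ m n e = ∑col-cong n λ c fc → ∑L-cong m n λ cs v → e c cs (fc ∷ v)

  ∑L-+ : ∀ m n f g → ∑L m n (λ cs → f cs + g cs) ≈ ∑L m n f + ∑L m n g
  ∑L-+ zero    n f g = refl
  ∑L-+ (suc m) n f g = trans (∑col-cong n λ c _ → ∑L-+ m n _ _) (∑col-+ n _ _)

  ∑L-0 : ∀ m n {f} → (∀ cs → Valid n cs → f cs ≈ 0#) → ∑L m n f ≈ 0#
  ∑L-0 zero    n e = e [] []
  ∑L-0 (suc m) n e = ∑col-0 n λ c fc → ∑L-0 m n λ cs v → e (c ∷ cs) (fc ∷ v)

  *-∑L : ∀ m n k f → k * ∑L m n f ≈ ∑L m n (λ cs → k * f cs)
  *-∑L zero    n k f = refl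
  *-∑L (suc m) n k f = trans (*-∑col n k _) (∑col-cong n λ c _ → *-∑L m n k _)

  ∑L-additive : ∀ m n → Additive (∑L m n)
  ∑L-additive m n = record
    { L-cong = λ e → ∑L-cong m n (λ c _ → e c) ; L-+ = ∑L-+ m n ; L-0 = ∑L-0 m n (λ _ _ → refl) }

  ∑col-swap : ∀ {A : Set} {L : (A → Carrier) → Carrier} → Additive L → ∀ n (f : Col → A → Carrier) →
              ∑col n (λ c → L (f c)) ≈ L (λ a → ∑col n (λ c → f c a))
  ∑col-swap {L = L} add n f = sym (begin
    L (λ a → ∑ n λ b → ∑ n λ u → when (b <b u) (f (b , u) a))
      ≈⟨ L-∑ add n _ ⟩
    ∑ n (λ b → L (λ a → ∑ n λ u → when (b <b u) (f (b , u) a)))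
      ≈⟨ ∑-cong′ n (λ b → L-∑ add n _) ⟩
    ∑ n (λ b → ∑ n λ u → L (λ a → when (b <b u) (f (b , u) a)))
      ≈⟨ ∑-cong′ n (λ b → ∑-cong′ n λ u → L-when add (b <b u) (f (b , u))) ⟩
    ∑col n (λ c → L (f c)) ∎)

  -- With the sum over the first column innermost, its neighbour is fixed while all ways of
  -- attaching it are added up.
  ∑L-second-first : ∀ m n f → ∑L (suc (suc m)) n f ≈
                    ∑col n (λ c′ → ∑L m n (λ cs → ∑col n (λ c → f (c ∷ c′ ∷ cs))))
  ∑L-second-first m n f = trans (∑col-swap (∑col-additive n) n _)
    (∑col-cong n λ c′ _ → ∑col-swap (∑L-additive m n) n _)

  -- Reflection exchanges the roles of the two edges and reverses their order, hence one interchange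
  -- of sums and two reversals.
  ∑col-flip : ∀ n f → ∑col n f ≈ ∑col n (λ c → f (flip n c))
  ∑col-flip n f = begin
    ∑ n (λ b → ∑ n λ u → when (b <b u) (f (b , u)))
      ≈⟨ ∑-swap n n _ ⟩
    ∑ n (λ u → ∑ n λ b → when (b <b u) (f (b , u)))
      ≈⟨ ∑-rev n _ ⟩
    ∑ n (λ u → ∑ n λ b → when (b <b (n ∸ u)) (f (b , n ∸ u)))
      ≈⟨ ∑-cong′ n (λ u → ∑-rev n _) ⟩
    ∑ n (λ u → ∑ n λ b → when ((n ∸ b) <b (n ∸ u)) (f (n ∸ b , n ∸ u)))
      ≈⟨ ∑-cong n (λ u u≤n → ∑-cong n λ b b≤n → reflexive (≡.cong (λ t → when t (f (n ∸ b , n ∸ u))) (less u b b≤n))) ⟩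
    ∑ n (λ u → ∑ n λ b → when (u <b b) (f (n ∸ b , n ∸ u))) ∎
    where
    less : ∀ u b → b ≤ n → ((n ∸ b) <b (n ∸ u)) ≡ (u <b b)
    less u b b≤n = ≡-from-⇔ (λ e → <b-true (cancel (<b-holds e))) (λ e → <b-true (ℕP.∸-monoʳ-< (<b-holds e) b≤n))
      where
      cancel : n ∸ b < n ∸ u → u < b
      cancel lt with ℕP.<-≤-connex u b
      ... | inj₁ u<b = u<b
      ... | inj₂ b≤u = contradiction (ℕP.∸-monoʳ-≤ n b≤u) (ℕP.<⇒≱ lt)

  ∑L-flip : ∀ m n f → ∑L m n f ≈ ∑L m n (λ cs → f (map (flip n) cs))
  ∑L-flip zero    n f = refl
  ∑L-flip (suc m) n f = trans (∑col-cong n λ c _ → ∑L-flip m n _) (∑col-flip n _)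

  -- The lists lost are those with a column whose top is `suc n`; the additional bottom edge `suc n`
  -- admits no column at all.
  ∑L-restrict : ∀ m n f → (∀ cs → Valid (suc n) cs → ¬ Valid n cs → f cs ≈ 0#) → ∑L m (suc n) f ≈ ∑L m n f
  ∑L-restrict zero    n f e = refl
  ∑L-restrict (suc m) n f e = begin
    ∑ (suc n) (λ b → ∑ (suc n) λ u → when (b <b u) (F (b , u)))
      ≈⟨ +-cong (∑-cong′ n (λ b → trans (+-congˡ (last b)) (+-identityʳ _))) last-bottom ⟩
    ∑ n (λ b → ∑ n λ u → when (b <b u) (F (b , u))) + 0#
      ≈⟨ +-identityʳ _ ⟩
    ∑col n F
      ≈⟨ ∑col-cong n (λ c fc → ∑L-restrict m n _ (λ cs v ¬v →
           e (c ∷ cs) ((proj₁ fc , ℕP.m≤n⇒m≤1+n (proj₂ fc)) ∷ v) (λ { (_ ∷ w) → ¬v w }))) ⟩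
    ∑L (suc m) n f ∎
    where
    F : Col → Carrier
    F c = ∑L m (suc n) (λ cs → f (c ∷ cs))
    last : ∀ b → when (b <b suc n) (F (b , suc n)) ≈ 0#
    last b = when-0 (b <b suc n) λ lt → ∑L-0 m (suc n) λ cs v →
      e _ ((<b-holds lt , ℕP.≤-refl) ∷ v) (λ { ((_ , le) ∷ _) → ℕP.<-irrefl ≡.refl le })
    last-bottom : ∑ (suc n) (λ u → when (suc n <b u) (F (suc n , u))) ≈ 0#
    last-bottom = ∑-0 (suc n) λ u u≤ → when-false (F (suc n , u)) (<b-false u≤)

  ∑-pick : ∀ n k (f : ℕ → Carrier) → k ≤ n → ∑ n (λ i → when (i == k) (f i)) ≈ f k
  ∑-pick zero    zero    f le = refl
  ∑-pick (suc n) k       f le with ℕP.m≤n⇒m<n∨m≡n le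
  ... | inj₁ (s≤s k≤n) = trans (+-cong (∑-pick n k f k≤n)
          (when-false _ (==-false (λ e → ℕP.<-irrefl (≡.sym e) (s≤s k≤n))))) (+-identityʳ _)
  ... | inj₂ ≡.refl = trans (+-cong
          (∑-0 n (λ i i≤n → when-false _ (==-false (λ e → ℕP.<-irrefl e (s≤s i≤n)))))
          (when-true _ (==-true {suc n} ≡.refl))) (+-identityˡ _)

  -- Half-open, because empty sums do occur: no column is shorter than a single cell.
  ∑< : ℕ → (ℕ → Carrier) → Carrier
  ∑< zero    f = 0#
  ∑< (suc n) f = ∑< n f + f n

  *-∑< : ∀ n k f → k * ∑< n f ≈ ∑< n (λ i → k * f i)
  *-∑< zero    k f = zeroʳ k
  *-∑< (suc n) k f = trans (distribˡ k _ _) (+-congʳ (*-∑< n k f))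

  ∑<-+ : ∀ n f g → ∑< n (λ i → f i + g i) ≈ ∑< n f + ∑< n g
  ∑<-+ zero    f g = sym (+-identityˡ 0#)
  ∑<-+ (suc n) f g = trans (+-congʳ (∑<-+ n f g))
    (solve 4 (λ a b c d → (a :+ b) :+ (c :+ d) := (a :+ c) :+ (b :+ d)) refl _ _ _ _)

  within : ℕ → ℕ → ℕ → Bool
  within s e i = (s ≤b i) ∧ (i <b e)

  within-true : ∀ {s e i} → s ≤ i → i < e → within s e i ≡ true
  within-true p q = ∧-intro (≤b-true p) (<b-true q)

  within-below : ∀ {s e i} → i < s → within s e i ≡ false
  within-below p rewrite ≤b-false p = ≡.refl

  within-above : ∀ {s e i} → e ≤ i → within s e i ≡ false
  within-above {s} {e} {i} p with s ≤b i
  ... | true  = <b-false p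
  ... | false = ≡.refl

  within-last : ∀ s k i x → when (within s (s ℕ.+ suc k) i) x ≈ when (within s (s ℕ.+ k) i) x + when (i == (s ℕ.+ k)) x
  within-last s k i x with ℕP.<-cmp i (s ℕ.+ k)
  ... | tri> _ ≢ gt = trans (when-false x (within-above {s} (ℕP.≤-trans (ℕP.≤-reflexive (ℕP.+-suc s k)) gt)))
        (sym (trans (+-cong (when-false x (within-above {s} (ℕP.<⇒≤ gt))) (when-false x (==-false ≢))) (+-identityʳ 0#)))
  ... | tri≈ _ ≡.refl _ = trans (when-true x (within-true (ℕP.m≤m+n s k) (ℕP.≤-reflexive (≡.sym (ℕP.+-suc s k)))))
        (sym (trans (+-cong (when-false x (within-above {s} ℕP.≤-refl)) (when-true x (==-true {s ℕ.+ k} ≡.refl))) (+-identityˡ x)))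
  ... | tri< lt ≢ _ with ℕP.<-≤-connex i s
  ...   | inj₁ i<s = trans (when-false x (within-below i<s))
        (sym (trans (+-cong (when-false x (within-below i<s)) (when-false x (==-false ≢))) (+-identityʳ 0#)))
  ...   | inj₂ s≤i = trans (when-true x (within-true s≤i (ℕP.<-trans lt (ℕP.≤-reflexive (≡.sym (ℕP.+-suc s k))))))
        (sym (trans (+-cong (when-true x (within-true s≤i lt)) (when-false x (==-false ≢))) (+-identityʳ x)))

  within-first : ∀ s k i x → when (within s (s ℕ.+ suc k) i) x ≈ when (i == s) x + when (within (suc s) (suc s ℕ.+ k) i) x
  within-first s k i x with ℕP.<-cmp i s
  ... | tri< lt ≢ _ = trans (when-false x (within-below lt))
        (sym (trans (+-cong (when-false x (==-false ≢)) (when-false x (within-below (ℕP.m≤n⇒m≤1+n lt)))) (+-identityʳ 0#)))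
  ... | tri≈ _ ≡.refl _ = trans (when-true x (within-true {s} ℕP.≤-refl (ℕP.m<m+n s (s≤s z≤n))))
        (sym (trans (+-cong (when-true x (==-true {s} ≡.refl)) (when-false x (within-below {suc s} {suc s ℕ.+ k} ℕP.≤-refl))) (+-identityʳ x)))
  ... | tri> _ ≢ gt = trans (reflexive (≡.cong (λ t → when t x) same))
        (sym (trans (+-congʳ (when-false x (==-false ≢))) (+-identityˡ _)))
    where
    same : within s (s ℕ.+ suc k) i ≡ within (suc s) (suc s ℕ.+ k) i
    same rewrite ≤b-true (ℕP.<⇒≤ gt) | ≤b-true gt | ℕP.+-suc s k = ≡.refl

  ∑-ascending : ∀ n s k ξ → s ℕ.+ k ≤ suc n → ∑ n (λ i → when (within s (s ℕ.+ k) i) (ξ (i ∸ s))) ≈ ∑< k ξ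
  ∑-ascending n s zero    ξ le = ∑-0 n λ i _ → when-0 _ λ e → contradiction
    (ℕP.<-≤-trans (<b-holds (∧-elimʳ {s ≤b i} e)) (ℕP.≤-reflexive (ℕP.+-identityʳ s))) (ℕP.≤⇒≯ (≤b-holds (∧-elimˡ {s ≤b i} e)))
  ∑-ascending n s (suc k) ξ le = begin
    ∑ n (λ i → when (within s (s ℕ.+ suc k) i) (ξ (i ∸ s)))
      ≈⟨ ∑-cong′ n (λ i → within-last s k i _) ⟩
    ∑ n (λ i → when (within s (s ℕ.+ k) i) (ξ (i ∸ s)) + when (i == (s ℕ.+ k)) (ξ (i ∸ s)))
      ≈⟨ ∑-+ n _ _ ⟩
    ∑ n (λ i → when (within s (s ℕ.+ k) i) (ξ (i ∸ s))) + ∑ n (λ i → when (i == (s ℕ.+ k)) (ξ (i ∸ s)))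
      ≈⟨ +-cong (∑-ascending n s k ξ (ℕP.m≤n⇒m≤1+n s+k≤n)) (∑-pick n (s ℕ.+ k) (λ i → ξ (i ∸ s)) s+k≤n) ⟩
    ∑< k ξ + ξ (s ℕ.+ k ∸ s)
      ≈⟨ +-congˡ (reflexive (≡.cong ξ (ℕP.m+n∸m≡n s k))) ⟩
    ∑< (suc k) ξ ∎
    where
    s+k≤n : s ℕ.+ k ≤ n
    s+k≤n = ℕP.≤-pred (ℕP.≤-trans (ℕP.≤-reflexive (≡.sym (ℕP.+-suc s k))) le)

  -- The argument of `χ` is the distance to the upper end, so the interval is shortened at its lower
  -- end; shortening the other end, as in `∑-ascending`, would shift every argument.
  ∑-descending : ∀ n s k χ → s ℕ.+ k ≤ suc n → ∑ n (λ i → when (within s (s ℕ.+ k) i) (χ (s ℕ.+ k ∸ suc i))) ≈ ∑< k χ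
  ∑-descending n s zero    χ le = ∑-0 n λ i _ → when-0 _ λ e → contradiction
    (ℕP.<-≤-trans (<b-holds (∧-elimʳ {s ≤b i} e)) (ℕP.≤-reflexive (ℕP.+-identityʳ s))) (ℕP.≤⇒≯ (≤b-holds (∧-elimˡ {s ≤b i} e)))
  ∑-descending n s (suc k) χ le = begin
    ∑ n (λ i → when (within s (s ℕ.+ suc k) i) (χ (s ℕ.+ suc k ∸ suc i)))
      ≈⟨ ∑-cong′ n (λ i → within-first s k i _) ⟩
    ∑ n (λ i → when (i == s) (χ (s ℕ.+ suc k ∸ suc i)) + when (within (suc s) (suc s ℕ.+ k) i) (χ (s ℕ.+ suc k ∸ suc i)))
      ≈⟨ ∑-+ n _ _ ⟩
    ∑ n (λ i → when (i == s) (χ (s ℕ.+ suc k ∸ suc i))) + ∑ n (λ i → when (within (suc s) (suc s ℕ.+ k) i) (χ (s ℕ.+ suc k ∸ suc i)))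
      ≈⟨ +-cong (∑-pick n s (λ i → χ (s ℕ.+ suc k ∸ suc i)) s≤n)
           (∑-cong′ n (λ i → reflexive (≡.cong (λ t → when (within (suc s) (suc s ℕ.+ k) i) (χ (t ∸ suc i))) (ℕP.+-suc s k)))) ⟩
    χ (s ℕ.+ suc k ∸ suc s) + ∑ n (λ i → when (within (suc s) (suc s ℕ.+ k) i) (χ (suc s ℕ.+ k ∸ suc i)))
      ≈⟨ +-cong (reflexive (≡.cong χ (≡.trans (≡.cong (_∸ suc s) (ℕP.+-suc s k)) (ℕP.m+n∸m≡n (suc s) k))))
           (∑-descending n (suc s) k χ (ℕP.≤-trans (ℕP.≤-reflexive (≡.sym (ℕP.+-suc s k))) le)) ⟩
    χ k + ∑< k χ
      ≈⟨ +-comm _ _ ⟩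
    ∑< (suc k) χ ∎
    where
    s≤n : s ≤ n
    s≤n = ℕP.≤-pred (ℕP.≤-trans (ℕP.m<m+n s (s≤s z≤n)) le)

  -- The contribution of one pair of adjacent columns to p^B or to q^U.
  touch : Carrier → Bool → Carrier
  touch p b = if b then p else 1#

  -- When the bottom edge is fixed and the top edge rises to that of the neighbour, the two tops
  -- align only at the last index, so `q` attaches to a single term. In `∑-descending-touch` it is
  -- the first index, where the bottoms align.
  ∑-ascending-touch : ∀ n q s k ξ → s ℕ.+ k ≤ n →
    ∑ n (λ i → when (within s (s ℕ.+ suc k) i) (touch q (i == (s ℕ.+ k)) * ξ (i ∸ s))) ≈ q * ξ k + ∑< k ξ
  ∑-ascending-touch n q s k ξ le = begin
    ∑ n (λ i → when (within s (s ℕ.+ suc k) i) (touch q (i == (s ℕ.+ k)) * ξ (i ∸ s)))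
      ≈⟨ ∑-cong′ n (λ i → trans (within-last s k i _) (+-cong
           (when-cong (within s (s ℕ.+ k) i) (λ e → trans (*-congʳ (reflexive (≡.cong (touch q)
              (==-false (ℕP.<⇒≢ (<b-holds (∧-elimʳ {s ≤b i} e))))))) (*-identityˡ _)))
           (when-cong (i == (s ℕ.+ k)) (λ e → *-congʳ (reflexive (≡.cong (touch q) e)))))) ⟩
    ∑ n (λ i → when (within s (s ℕ.+ k) i) (ξ (i ∸ s)) + when (i == (s ℕ.+ k)) (q * ξ (i ∸ s)))
      ≈⟨ ∑-+ n _ _ ⟩
    ∑ n (λ i → when (within s (s ℕ.+ k) i) (ξ (i ∸ s))) + ∑ n (λ i → when (i == (s ℕ.+ k)) (q * ξ (i ∸ s)))
      ≈⟨ +-cong (∑-ascending n s k ξ (ℕP.m≤n⇒m≤1+n le)) (∑-pick n (s ℕ.+ k) (λ i → q * ξ (i ∸ s)) le) ⟩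
    ∑< k ξ + q * ξ (s ℕ.+ k ∸ s)
      ≈⟨ +-congˡ (*-congˡ (reflexive (≡.cong ξ (ℕP.m+n∸m≡n s k)))) ⟩
    ∑< k ξ + q * ξ k
      ≈⟨ +-comm _ _ ⟩
    q * ξ k + ∑< k ξ ∎

  ∑-descending-touch : ∀ n p s k χ → s ℕ.+ k ≤ n →
    ∑ n (λ i → when (within s (s ℕ.+ suc k) i) (touch p (i == s) * χ (s ℕ.+ suc k ∸ suc i))) ≈ p * χ k + ∑< k χ
  ∑-descending-touch n p s k χ le = begin
    ∑ n (λ i → when (within s (s ℕ.+ suc k) i) (touch p (i == s) * χ (s ℕ.+ suc k ∸ suc i)))
      ≈⟨ ∑-cong′ n (λ i → trans (within-first s k i _) (+-cong
           (when-cong (i == s) (λ e → *-congʳ (reflexive (≡.cong (touch p) e))))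
           (when-cong (within (suc s) (suc s ℕ.+ k) i) (λ e → trans (*-cong
              (reflexive (≡.cong (touch p) (==-false (λ eq → ℕP.<-irrefl (≡.sym eq) (≤b-holds (∧-elimˡ {suc s ≤b i} e))))))
              (reflexive (≡.cong (λ t → χ (t ∸ suc i)) (ℕP.+-suc s k)))) (*-identityˡ _))))) ⟩
    ∑ n (λ i → when (i == s) (p * χ (s ℕ.+ suc k ∸ suc i)) + when (within (suc s) (suc s ℕ.+ k) i) (χ (suc s ℕ.+ k ∸ suc i)))
      ≈⟨ ∑-+ n _ _ ⟩
    ∑ n (λ i → when (i == s) (p * χ (s ℕ.+ suc k ∸ suc i))) + ∑ n (λ i → when (within (suc s) (suc s ℕ.+ k) i) (χ (suc s ℕ.+ k ∸ suc i)))
      ≈⟨ +-cong (∑-pick n s (λ i → p * χ (s ℕ.+ suc k ∸ suc i)) (ℕP.≤-trans (ℕP.m≤m+n s k) le))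
           (∑-descending n (suc s) k χ (s≤s le)) ⟩
    p * χ (s ℕ.+ suc k ∸ suc s) + ∑< k χ
      ≈⟨ +-congʳ (*-congˡ (reflexive (≡.cong χ (≡.trans (≡.cong (_∸ suc s) (ℕP.+-suc s k)) (ℕP.m+n∸m≡n (suc s) k))))) ⟩
    p * χ k + ∑< k χ ∎

-- Attaching a first column to a fixed neighbour.

module Recurrence {c ℓ} (K : CommutativeRing c ℓ) where

  open RingTools K using (solve; _:=_; _:+_; _:*_; :0)
  open Sums K
  open ColSums K

  open CommutativeRing K
  open import Algebra.Properties.Semiring.Exp semiring using (_^_; ^-homo-*)
  open import Relation.Binary.Reasoning.Setoid setoid

  mass : Carrier → Carrier → List Col → Carrier
  mass p q cs = p ^ countB cs * q ^ countU cs

  gap : List Col → ℕ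
  gap cs = leftHeight cs ∸ 1

  -- φ n takes the place of u ^ n: U ^_ gives the generating function at u = U, and
  -- `number` (defined later) gives its u-derivative at u = 1.
  polyTerm : (List Col → Bool) → Carrier → Carrier → (ℕ → Carrier) → ℕ → List Col → Carrier
  polyTerm S p q φ n cs = when (conv n cs ∧ S cs) (mass p q cs * φ (gap cs))

  polySum : (List Col → Bool) → Carrier → Carrier → (ℕ → Carrier) → ℕ → ℕ → Carrier
  polySum S p q φ v n = ∑L v n (polyTerm S p q φ n)

  -- For a neighbour with k + 1 cells, `rep U k` counts the shorter columns flush with one given
  -- edge of it, and `rep₂ U k` those flush with neither edge: U^j occurs k - 1 - j times, once for
  -- each position.
  rep rep₂ : Carrier → ℕ → Carrier
  rep  U n = ∑< n (U ^_)
  rep₂ U n = ∑< n (rep U)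

  everything stack : List Col → Bool
  everything _ = true
  stack cs = topsDecrease cs ∧ bottomsIncrease cs

  firstTop firstBottom : List Col → ℕ
  firstTop []      = 0
  firstTop (c ∷ _) = proj₂ c
  firstBottom []      = 0
  firstBottom (c ∷ _) = proj₁ c

  mass-∷ : ∀ p q b u b′ u′ cs → mass p q ((b , u) ∷ (b′ , u′) ∷ cs) ≈
           (touch p (b == b′) * touch q (u == u′)) * mass p q ((b′ , u′) ∷ cs)
  mass-∷ p q b u b′ u′ cs = trans (*-cong (power p (b == b′) _) (power q (u == u′) _))
    (solve 4 (λ a b c d → (a :* b) :* (c :* d) := (a :* c) :* (b :* d)) refl _ _ _ _)
    where
    power : ∀ p t k → p ^ ((if t then 1 else 0) ℕ.+ k) ≈ touch p t * p ^ k
    power p true  k = refl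
    power p false k = sym (*-identityˡ _)

  mass-flip : ∀ p q {n cs} → Valid n cs → mass p q (map (flip n) cs) ≈ mass q p cs
  mass-flip p q v = trans (reflexive (cong₂ (λ i j → p ^ i * q ^ j) (flip-countB v) (flip-countU v))) (*-comm _ _)

  width : ∀ {b u} → b < u → u ≡ b ℕ.+ suc (u ∸ b ∸ 1)
  width {b} {u} b<u = ≡.trans (≡.sym (ℕP.m+[n∸m]≡n (ℕP.<⇒≤ b<u)))
    (cong (b ℕ.+_) (≡.sym (ℕP.m+[n∸m]≡n (ℕP.m<n⇒0<n∸m b<u))))

  ∸-∸-1 : ∀ u b → u ∸ b ∸ 1 ≡ u ∸ suc b
  ∸-∸-1 u b = ≡.trans (ℕP.∸-+-assoc u b 1) (cong (u ∸_) (ℕP.+-comm b 1))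

  ≤b-<b-suc : ∀ a b → (a ≤b b) ≡ (a <b suc b)
  ≤b-<b-suc a b = ≡-from-⇔ (λ e → <b-true (s≤s (≤b-holds e))) (λ e → ≤b-true (ℕP.≤-pred (<b-holds e)))

  module Inside (p q U : Carrier) (n b′ k : ℕ) (fits : b′ ℕ.+ suc k ≤ n) where

    u′ : ℕ
    u′ = b′ ℕ.+ suc k

    -- The sum over the top edges when the bottom edge leaves room for j + 1 cells below `u′`: the
    -- full column aligns with the neighbour's top and carries `q`, the shorter ones do not.
    χ : ℕ → Carrier
    χ j = q * U ^ j + rep U j

    weight : ℕ → ℕ → Carrier
    weight b u = (touch p (b == b′) * touch q (u == u′)) * U ^ (u ∸ b ∸ 1)

    over-tops : ∀ b → ∑ n (λ u → when (b <b u) (when ((b′ ≤b b) ∧ (u ≤b u′)) (weight b u))) ≈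
                when (within b′ u′ b) (touch p (b == b′) * χ (u′ ∸ suc b))
    over-tops b with ℕP.<-≤-connex b b′ | ℕP.<-≤-connex b u′
    ... | inj₁ b<b′ | _ = trans
      (∑-0 n λ u _ → when-0 (b <b u) λ _ → when-false _ (cong (_∧ (u ≤b u′)) (≤b-false b<b′)))
      (sym (when-false _ (within-below b<b′)))
    ... | inj₂ b′≤b | inj₂ u′≤b = trans
      (∑-0 n λ u _ → when-0 (b <b u) λ e → when-0 ((b′ ≤b b) ∧ (u ≤b u′)) λ e′ →
        contradiction (ℕP.≤-trans (≤b-holds (∧-elimʳ {b′ ≤b b} e′)) u′≤b) (ℕP.<⇒≱ (<b-holds e)))
      (sym (when-false _ (within-above {b′} u′≤b)))
    ... | inj₂ b′≤b | inj₁ b<u′ = begin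
      ∑ n (λ u → when (b <b u) (when ((b′ ≤b b) ∧ (u ≤b u′)) (weight b u)))
        ≈⟨ ∑-cong′ n term ⟩
      ∑ n (λ u → touch p (b == b′) * when (within (suc b) (suc b ℕ.+ suc j) u) (touch q (u == (suc b ℕ.+ j)) * U ^ (u ∸ suc b)))
        ≈⟨ *-∑ n _ _ ⟨
      touch p (b == b′) * ∑ n (λ u → when (within (suc b) (suc b ℕ.+ suc j) u) (touch q (u == (suc b ℕ.+ j)) * U ^ (u ∸ suc b)))
        ≈⟨ *-congˡ (∑-ascending-touch n q (suc b) j (U ^_) (ℕP.≤-trans (ℕP.≤-reflexive (≡.sym eq)) fits)) ⟩
      touch p (b == b′) * χ j
        ≈⟨ when-true _ (within-true b′≤b b<u′) ⟨
      when (within b′ u′ b) (touch p (b == b′) * χ j) ∎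
      where
      j = u′ ∸ suc b
      eq : u′ ≡ suc b ℕ.+ j
      eq = ≡.sym (ℕP.m+[n∸m]≡n b<u′)
      range : ∀ u → (u ≤b u′) ≡ (u <b (suc b ℕ.+ suc j))
      range u = ≡.trans (≤b-<b-suc u u′) (cong (u <b_) (≡.trans (cong suc eq) (≡.sym (ℕP.+-suc (suc b) j))))
      term : ∀ u → when (b <b u) (when ((b′ ≤b b) ∧ (u ≤b u′)) (weight b u)) ≈
        touch p (b == b′) * when (within (suc b) (suc b ℕ.+ suc j) u) (touch q (u == (suc b ℕ.+ j)) * U ^ (u ∸ suc b))
      term u = begin
        when (b <b u) (when ((b′ ≤b b) ∧ (u ≤b u′)) (weight b u))
          ≡⟨ cong (λ t → when (b <b u) (when (t ∧ (u ≤b u′)) (weight b u))) (≤b-true b′≤b) ⟩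
        when (b <b u) (when (u ≤b u′) (weight b u))
          ≡⟨ when-∧ (b <b u) (u ≤b u′) _ ⟨
        when ((b <b u) ∧ (u ≤b u′)) (weight b u)
          ≡⟨ cong (λ t → when ((b <b u) ∧ t) (weight b u)) (range u) ⟩
        when (within (suc b) (suc b ℕ.+ suc j) u) (weight b u)
          ≈⟨ when-cong (within (suc b) (suc b ℕ.+ suc j) u) (λ _ → trans (*-assoc _ _ _)
               (*-congˡ (reflexive (cong₂ (λ x y → touch q (u == x) * U ^ y) eq (∸-∸-1 u b))))) ⟩
        when (within (suc b) (suc b ℕ.+ suc j) u) (touch p (b == b′) * (touch q (u == (suc b ℕ.+ j)) * U ^ (u ∸ suc b)))
          ≈⟨ *-when (within (suc b) (suc b ℕ.+ suc j) u) _ _ ⟨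
        touch p (b == b′) * when (within (suc b) (suc b ℕ.+ suc j) u) (touch q (u == (suc b ℕ.+ j)) * U ^ (u ∸ suc b)) ∎

    -- Only the lowest bottom edge aligns and carries `p`. So a column flush at both ends gets pq,
    -- one flush at exactly one end p or q, and the others 1, which explains the coefficients pq, p
    -- + q and 1 of the functional equation.
    total : ∑col n (λ c → when ((b′ ≤b proj₁ c) ∧ (proj₂ c ≤b u′)) (weight (proj₁ c) (proj₂ c))) ≈
            p * q * U ^ k + (p + q) * rep U k + rep₂ U k
    total = begin
      ∑ n (λ b → ∑ n (λ u → when (b <b u) (when ((b′ ≤b b) ∧ (u ≤b u′)) (weight b u))))
        ≈⟨ ∑-cong′ n over-tops ⟩
      ∑ n (λ b → when (within b′ u′ b) (touch p (b == b′) * χ (u′ ∸ suc b)))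
        ≈⟨ ∑-descending-touch n p b′ k χ (ℕP.≤-trans (ℕP.+-monoʳ-≤ b′ (ℕP.n≤1+n k)) fits) ⟩
      p * χ k + ∑< k χ
        ≈⟨ +-congˡ (trans (∑<-+ k _ _) (+-congʳ (sym (*-∑< k q _)))) ⟩
      p * χ k + (q * rep U k + rep₂ U k)
        ≈⟨ solve 5 (λ p q x r s → p :* (q :* x :+ r) :+ (q :* r :+ s) := p :* q :* x :+ (p :+ q) :* r :+ s) refl p q (U ^ k) (rep U k) (rep₂ U k) ⟩
      p * q * U ^ k + (p + q) * rep U k + rep₂ U k ∎

  -- The names say where the first column leaves the vertical range of the second. Alignment of
  -- edges counts as not leaving it, so p and q both occur only in `inside`.
  inside above below outside : List Col → Bool
  inside  (c ∷ c′ ∷ _) = (proj₁ c′ ≤b proj₁ c) ∧ (proj₂ c ≤b proj₂ c′)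
  inside  _            = false
  above   (c ∷ c′ ∷ _) = (proj₁ c′ ≤b proj₁ c) ∧ not (proj₂ c ≤b proj₂ c′)
  above   _            = false
  below   (c ∷ c′ ∷ _) = not (proj₁ c′ ≤b proj₁ c) ∧ (proj₂ c ≤b proj₂ c′)
  below   _            = false
  outside (c ∷ c′ ∷ _) = not (proj₁ c′ ≤b proj₁ c) ∧ not (proj₂ c ≤b proj₂ c′)
  outside _            = false

  partTerm : (List Col → Bool) → Carrier → Carrier → Carrier → ℕ → List Col → Carrier
  partTerm part p q U n cs = when (part cs) (when (conv n cs) (mass p q cs * U ^ gap cs))

  partSum : (List Col → Bool) → Carrier → Carrier → Carrier → ℕ → ℕ → Carrier
  partSum part p q U v n = ∑L v n (partTerm part p q U n)

  four-parts : ∀ p q U v n → polySum everything p q (U ^_) (suc (suc v)) n ≈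
    partSum inside p q U (suc (suc v)) n + partSum above p q U (suc (suc v)) n
    + partSum below p q U (suc (suc v)) n + partSum outside p q U (suc (suc v)) n
  four-parts p q U v n = begin
    polySum everything p q (U ^_) v₂ n
      ≈⟨ ∑col-cong n (λ c _ → ∑L-cong-∷ v n {λ cs → polyTerm everything p q (U ^_) n (c ∷ cs)} {λ cs → parts (c ∷ cs)} (λ c′ cs _ → split c c′ cs)) ⟩
    ∑L v₂ n parts
      ≈⟨ ∑L-+ v₂ n (λ cs → part inside cs + part above cs + part below cs) (part outside) ⟩
    ∑L v₂ n (λ cs → part inside cs + part above cs + part below cs) + partSum outside p q U v₂ n
      ≈⟨ +-congʳ (∑L-+ v₂ n (λ cs → part inside cs + part above cs) (part below)) ⟩
    ∑L v₂ n (λ cs → part inside cs + part above cs) + partSum below p q U v₂ n + partSum outside p q U v₂ n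
      ≈⟨ +-congʳ (+-congʳ (∑L-+ v₂ n (part inside) (part above))) ⟩
    partSum inside p q U v₂ n + partSum above p q U v₂ n + partSum below p q U v₂ n + partSum outside p q U v₂ n ∎
    where
    v₂ = suc (suc v)
    part : (List Col → Bool) → List Col → Carrier
    part P = partTerm P p q U n
    parts : List Col → Carrier
    parts cs = part inside cs + part above cs + part below cs + part outside cs
    four : ∀ a b x → x ≈ when (a ∧ b) x + when (a ∧ not b) x + when (not a ∧ b) x + when (not a ∧ not b) x
    four true  true  x = solve 1 (λ x → x := x :+ :0 :+ :0 :+ :0) refl x
    four true  false x = solve 1 (λ x → x := :0 :+ x :+ :0 :+ :0) refl x
    four false true  x = solve 1 (λ x → x := :0 :+ :0 :+ x :+ :0) refl x
    four false false x = solve 1 (λ x → x := :0 :+ :0 :+ :0 :+ x) refl x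
    split : ∀ c c′ cs → polyTerm everything p q (U ^_) n (c ∷ c′ ∷ cs) ≈ parts (c ∷ c′ ∷ cs)
    split c c′ cs rewrite ∧-identityʳ (conv n (c ∷ c′ ∷ cs)) = four (proj₁ c′ ≤b proj₁ c) (proj₂ c ≤b proj₂ c′) _

  below-flip : ∀ p q U v n → partSum below p q U v n ≈ partSum above q p U v n
  below-flip p q U v n = trans (∑L-flip v n _) (∑L-cong v n λ cs val →
    trans (reflexive (cong₂ (λ s t → when s (when t (mass p q (map (flip n) cs) * U ^ gap (map (flip n) cs))))
             (below-above val) (flip-conv val)))
    (when-cong (above cs) λ _ → when-cong (conv n cs) λ _ →
      *-cong (mass-flip p q val) (reflexive (cong (λ h → U ^ (h ∸ 1)) (flip-leftHeight val)))))
    where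
    below-above : ∀ {cs} → Valid n cs → below (map (flip n) cs) ≡ above cs
    below-above []       = ≡.refl
    below-above (_ ∷ []) = ≡.refl
    below-above (_∷_ {x = c} f (_∷_ {x = c′} f′ _)) = ≡.trans
      (cong₂ (λ s t → not s ∧ t) (∸-≤b {proj₂ c′} {proj₂ c} (proj₂ f)) (∸-≤b {proj₁ c} {proj₁ c′} (fits-bottom c′ f′)))
      (∧-comm (not (proj₂ c ≤b proj₂ c′)) (proj₁ c′ ≤b proj₁ c))

  inside-sum : ∀ p q U v n → partSum inside p q U (suc (suc v)) n ≈
    polySum everything p q (λ k → p * q * U ^ k + (p + q) * rep U k + rep₂ U k) (suc v) n
  inside-sum p q U v n = trans (∑L-second-first v n (partTerm inside p q U n))
    (∑col-cong n λ { (b′ , u′) f → ∑L-cong v n λ cs val → term b′ u′ cs (f ∷ val) })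
    where
    φ : ℕ → Carrier
    φ k = p * q * U ^ k + (p + q) * rep U k + rep₂ U k
    term : ∀ b′ u′ cs → Valid n ((b′ , u′) ∷ cs) →
      ∑col n (λ c → partTerm inside p q U n (c ∷ (b′ , u′) ∷ cs)) ≈ polyTerm everything p q φ n ((b′ , u′) ∷ cs)
    term b′ u′ cs val@((b′<u′ , u′≤n) ∷ _) = begin
      ∑col n (λ c → partTerm inside p q U n (c ∷ r))
        ≈⟨ ∑col-cong n (λ { (b , u) (b<u , u≤n) → pointwise b u b<u }) ⟩
      ∑col n (λ c → M * when (inside (c ∷ r)) (weight c))
        ≈⟨ *-∑col n M _ ⟨
      M * ∑col n (λ c → when (inside (c ∷ r)) (weight c))
        -- `Inside` takes the neighbour's top in the form `b′ + suc k`, so `u′` is rewritten in the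
        -- summand before it is used.
        ≈⟨ *-congˡ (∑col-cong n (λ c _ → reflexive (cong (λ x → when ((b′ ≤b proj₁ c) ∧ (proj₂ c ≤b x))
              ((touch p (proj₁ c == b′) * touch q (proj₂ c == x)) * U ^ (proj₂ c ∸ proj₁ c ∸ 1))) (width b′<u′)))) ⟩
      M * ∑col n (λ c → when ((b′ ≤b proj₁ c) ∧ (proj₂ c ≤b u″)) ((touch p (proj₁ c == b′) * touch q (proj₂ c == u″)) * U ^ (proj₂ c ∸ proj₁ c ∸ 1)))
        ≈⟨ *-congˡ (Inside.total p q U n b′ (u′ ∸ b′ ∸ 1) (subst (_≤ n) (width b′<u′) u′≤n)) ⟩
      M * φ (u′ ∸ b′ ∸ 1)
        ≈⟨ trans (*-comm _ _) (*-when (conv n r) _ _) ⟩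
      when (conv n r) (φ (u′ ∸ b′ ∸ 1) * mass p q r)
        ≈⟨ when-cong (conv n r) (λ _ → *-comm _ _) ⟩
      when (conv n r) (mass p q r * φ (u′ ∸ b′ ∸ 1))
        ≡⟨ cong (λ t → when t (mass p q r * φ (u′ ∸ b′ ∸ 1))) (∧-identityʳ (conv n r)) ⟨
      when (conv n r ∧ true) (mass p q r * φ (gap r)) ∎
      where
      r = (b′ , u′) ∷ cs
      u″ = b′ ℕ.+ suc (u′ ∸ b′ ∸ 1)
      M : Carrier
      M = when (conv n r) (mass p q r)
      weight : Col → Carrier
      weight (b , u) = (touch p (b == b′) * touch q (u == u′)) * U ^ (u ∸ b ∸ 1)
      pointwise : ∀ b u → b < u → when (inside ((b , u) ∷ r)) (when (conv n ((b , u) ∷ r)) (mass p q ((b , u) ∷ r) * U ^ (u ∸ b ∸ 1))) ≈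
                  M * when (inside ((b , u) ∷ r)) (weight (b , u))
      pointwise b u b<u = begin
        when (inside ((b , u) ∷ r)) (when (conv n ((b , u) ∷ r)) (mass p q ((b , u) ∷ r) * U ^ (u ∸ b ∸ 1)))
          ≈⟨ when-cong (inside ((b , u) ∷ r)) (λ e → trans
               (reflexive (cong (λ t → when t (mass p q ((b , u) ∷ r) * U ^ (u ∸ b ∸ 1)))
                 (conv-inside b u b′ u′ cs b<u val (≤b-holds (∧-elimˡ e)) (≤b-holds (∧-elimʳ {b′ ≤b b} e)))))
               (when-cong (conv n r) (λ _ → *-congʳ (mass-∷ p q b u b′ u′ cs)))) ⟩
        when (inside ((b , u) ∷ r)) (when (conv n r) (((touch p (b == b′) * touch q (u == u′)) * mass p q r) * U ^ (u ∸ b ∸ 1)))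
          ≈⟨ when-cong (inside ((b , u) ∷ r)) (λ _ → trans (when-cong (conv n r) (λ _ →
               solve 3 (λ t m x → (t :* m) :* x := (t :* x) :* m) refl _ _ _)) (trans (sym (*-when (conv n r) _ _)) (*-comm _ _))) ⟩
        when (inside ((b , u) ∷ r)) (M * weight (b , u))
          ≈⟨ *-when (inside ((b , u) ∷ r)) M _ ⟨
        M * when (inside ((b , u) ∷ r)) (weight (b , u)) ∎

  not-≤b : ∀ a b → not (a ≤b b) ≡ (b <b a)
  not-≤b a b with ℕP.<-≤-connex b a
  ... | inj₁ b<a = ≡.trans (cong not (≤b-false b<a)) (≡.sym (<b-true b<a))
  ... | inj₂ a≤b = ≡.trans (cong not (≤b-true a≤b)) (≡.sym (<b-false a≤b))

  when-∧₂ : ∀ a b x {t} → t ≡ a ∧ b → when t x ≡ when a (when b x)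
  when-∧₂ a b x ≡.refl = when-∧ a b x

  -- What remains of `conv` when the deleted column was the only one to reach the upper edge: the
  -- condition at the bottom stays, the one at the top is gone.
  descending : List Col → Bool
  descending cs = hasBottom0 cs ∧ topsDecrease cs ∧ good cs

  -- The part of the new column below the neighbour's top is either flush with the neighbour's
  -- bottom, which gives `p`, or ends strictly above it.
  ψ : Carrier → Carrier → ℕ → Carrier
  ψ p U k = p * U ^ k + rep U k

  -- The exponent `n ∸ firstTop cs` is the number of rows by which the deleted column rose above its
  -- neighbour; the outer guard says that it is positive.
  aboveTerm : Carrier → Carrier → Carrier → ℕ → List Col → Carrier
  aboveTerm p q U n cs = when (firstTop cs <b n) (when (descending cs) (mass p q cs * (U ^ (n ∸ firstTop cs) * ψ p U (gap cs))))

  above-condition : ∀ {n} b u b′ u′ cs → b < u → u ≤ n → Valid n ((b′ , u′) ∷ cs) →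
    above ((b , u) ∷ (b′ , u′) ∷ cs) ∧ conv n ((b , u) ∷ (b′ , u′) ∷ cs) ≡
    (u == n) ∧ (u′ <b u) ∧ within b′ u′ b ∧ descending ((b′ , u′) ∷ cs)
  above-condition {n} b u b′ u′ cs b<u u≤n val = ≡.trans (cong (λ t → ((b′ ≤b b) ∧ t) ∧ conv n ((b , u) ∷ (b′ , u′) ∷ cs)) (not-≤b u u′))
    (≡-from-⇔ to from)
    where
    r = (b′ , u′) ∷ cs
    to : ((b′ ≤b b) ∧ (u′ <b u)) ∧ conv n ((b , u) ∷ r) ≡ true → (u == n) ∧ (u′ <b u) ∧ within b′ u′ b ∧ descending r ≡ true
    to h = ∧-intro (∧-elimˡ {u == n} k) (∧-intro s (∧-intro (∧-intro a (∧-elimˡ {b <b u′} k′)) (∧-elimʳ {b <b u′} k′)))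
      where
      as = ∧-elimˡ {(b′ ≤b b) ∧ (u′ <b u)} h
      a = ∧-elimˡ {b′ ≤b b} as
      s = ∧-elimʳ {b′ ≤b b} as
      k = ≡.trans (≡.sym (conv-above b u b′ u′ cs b<u u≤n val (≤b-holds a) (<b-holds s))) (∧-elimʳ {(b′ ≤b b) ∧ (u′ <b u)} h)
      k′ = ∧-elimʳ {u == n} k
    from : (u == n) ∧ (u′ <b u) ∧ within b′ u′ b ∧ descending r ≡ true → ((b′ ≤b b) ∧ (u′ <b u)) ∧ conv n ((b , u) ∷ r) ≡ true
    from h = ∧-intro (∧-intro a s) (≡.trans (conv-above b u b′ u′ cs b<u u≤n val (≤b-holds a) (<b-holds s))
      (∧-intro (∧-elimˡ {u == n} h) (∧-intro (∧-elimʳ {b′ ≤b b} w) (∧-elimʳ {within b′ u′ b} h₂))))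
      where
      h₁ = ∧-elimʳ {u == n} h
      s = ∧-elimˡ {u′ <b u} h₁
      h₂ = ∧-elimʳ {u′ <b u} h₁
      w = ∧-elimˡ {within b′ u′ b} h₂
      a = ∧-elimˡ {b′ ≤b b} w

  above-sum : ∀ p q U v n → partSum above p q U (suc (suc v)) n ≈ ∑L (suc v) n (aboveTerm p q U n)
  above-sum p q U v n = trans (∑L-second-first v n (partTerm above p q U n))
    (∑col-cong n λ { (b′ , u′) f → ∑L-cong v n λ cs val → term b′ u′ cs (f ∷ val) })
    where
    term : ∀ b′ u′ cs → Valid n ((b′ , u′) ∷ cs) →
      ∑col n (λ c → partTerm above p q U n (c ∷ (b′ , u′) ∷ cs)) ≈ aboveTerm p q U n ((b′ , u′) ∷ cs)
    term b′ u′ cs val@((b′<u′ , u′≤n) ∷ _) = begin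
      ∑ n (λ b → ∑ n λ u → when (b <b u) (partTerm above p q U n ((b , u) ∷ r)))
        ≈⟨ ∑-cong′ n (λ b → ∑-cong n (λ u u≤n → pointwise b u u≤n)) ⟩
      ∑ n (λ b → ∑ n λ u → when (u == n) (W b u))
        ≈⟨ ∑-cong′ n (λ b → ∑-pick n n (W b) ℕP.≤-refl) ⟩
      ∑ n (λ b → W b n)
        ≈⟨ ∑-cong′ n rearrange ⟩
      ∑ n (λ b → C * when (within b′ u′ b) (touch p (b == b′) * U ^ (u′ ∸ suc b)))
        ≈⟨ *-∑ n C _ ⟨
      C * ∑ n (λ b → when (within b′ u′ b) (touch p (b == b′) * U ^ (u′ ∸ suc b)))
        ≈⟨ *-congˡ (∑-cong′ n (λ b → reflexive (cong (λ x → when (within b′ x b) (touch p (b == b′) * U ^ (x ∸ suc b))) (width b′<u′)))) ⟩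
      C * ∑ n (λ b → when (within b′ (b′ ℕ.+ suc k) b) (touch p (b == b′) * U ^ (b′ ℕ.+ suc k ∸ suc b)))
        ≈⟨ *-congˡ (∑-descending-touch n p b′ k (U ^_) (ℕP.≤-trans (ℕP.+-monoʳ-≤ b′ (ℕP.n≤1+n k)) (subst (_≤ n) (width b′<u′) u′≤n))) ⟩
      C * ψ p U k
        ≈⟨ trans (*-comm _ _) (*-when (u′ <b n) _ _) ⟩
      when (u′ <b n) (ψ p U k * when (descending r) (mass p q r * U ^ (n ∸ u′)))
        ≈⟨ when-cong (u′ <b n) (λ _ → trans (*-when (descending r) _ _) (when-cong (descending r) (λ _ →
             solve 3 (λ a b c → a :* (b :* c) := b :* (c :* a)) refl _ _ _))) ⟩
      aboveTerm p q U n r ∎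
      where
      r = (b′ , u′) ∷ cs
      k = u′ ∸ b′ ∸ 1
      C : Carrier
      C = when (u′ <b n) (when (descending r) (mass p q r * U ^ (n ∸ u′)))
      W : ℕ → ℕ → Carrier
      W b u = when (u′ <b u) (when (within b′ u′ b) (when (descending r) ((touch p (b == b′) * mass p q r) * U ^ (u ∸ b ∸ 1))))
      X : ℕ → ℕ → Carrier
      X b u = mass p q ((b , u) ∷ r) * U ^ (u ∸ b ∸ 1)
      mass-above : ∀ b u → u′ < u → mass p q ((b , u) ∷ r) ≈ touch p (b == b′) * mass p q r
      mass-above b u lt = trans (mass-∷ p q b u b′ u′ cs) (*-congʳ (trans
        (*-congˡ (reflexive (cong (touch q) (==-false (λ e → ℕP.<-irrefl (≡.sym e) lt))))) (*-identityʳ _)))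
      holds : ∀ b u → b < u → u ≤ n → partTerm above p q U n ((b , u) ∷ r) ≈ when (u == n) (W b u)
      holds b u b<u u≤n = begin
        when (above ((b , u) ∷ r)) (when (conv n ((b , u) ∷ r)) (X b u))
          ≡⟨ when-∧ (above ((b , u) ∷ r)) (conv n ((b , u) ∷ r)) (X b u) ⟨
        when (above ((b , u) ∷ r) ∧ conv n ((b , u) ∷ r)) (X b u)
          ≡⟨ when-∧₂ (u == n) _ (X b u) (above-condition b u b′ u′ cs b<u u≤n val) ⟩
        when (u == n) (when ((u′ <b u) ∧ within b′ u′ b ∧ descending r) (X b u))
          ≡⟨ cong (when (u == n)) (≡.trans (when-∧ (u′ <b u) _ _) (cong (when (u′ <b u)) (when-∧ (within b′ u′ b) (descending r) _))) ⟩
        when (u == n) (when (u′ <b u) (when (within b′ u′ b) (when (descending r) (X b u))))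
          ≈⟨ when-cong (u == n) (λ _ → when-cong (u′ <b u) (λ e → when-cong (within b′ u′ b) (λ _ →
               when-cong (descending r) (λ _ → *-congʳ (mass-above b u (<b-holds e)))))) ⟩
        when (u == n) (W b u) ∎
      pointwise : ∀ b u → u ≤ n → when (b <b u) (partTerm above p q U n ((b , u) ∷ r)) ≈ when (u == n) (W b u)
      pointwise b u u≤n with ℕP.<-≤-connex b u
      ... | inj₁ b<u = trans (when-true _ (<b-true b<u)) (holds b u b<u u≤n)
      ... | inj₂ u≤b = trans (when-false _ (<b-false u≤b)) (sym (when-0 (u == n) λ _ → when-0 (u′ <b u) λ e →
            when-false _ (within-above {b′} (ℕP.≤-trans (ℕP.<⇒≤ (<b-holds e)) u≤b))))
      -- The column from `b` to `n` is cut at the neighbour's top: n - u′ cells lie above it and u′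
      -- - b below, and the lower part absorbs the 1 that is subtracted from the height.
      exponent : ∀ b → b < u′ → n ∸ b ∸ 1 ≡ (n ∸ u′) ℕ.+ (u′ ∸ suc b)
      exponent b b<u′ = ≡.trans (∸-∸-1 n b) (≡.sym (≡.trans (≡.sym (ℕP.+-∸-assoc (n ∸ u′) b<u′)) (cong (_∸ suc b) (ℕP.m∸n+n≡m u′≤n))))
      rearrange : ∀ b → W b n ≈ C * when (within b′ u′ b) (touch p (b == b′) * U ^ (u′ ∸ suc b))
      rearrange b = begin
        when (u′ <b n) (when (within b′ u′ b) (when (descending r) ((t * M) * U ^ (n ∸ b ∸ 1))))
          ≈⟨ when-cong (u′ <b n) (λ _ → when-cong (within b′ u′ b) (λ w → when-cong (descending r) (λ _ → trans
               (*-congˡ (trans (reflexive (cong (U ^_) (exponent b (<b-holds (∧-elimʳ {b′ ≤b b} w))))) (^-homo-* U (n ∸ u′) (u′ ∸ suc b))))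
               (solve 4 (λ t m x y → (t :* m) :* (x :* y) := (t :* y) :* (m :* x)) refl t M _ _)))) ⟩
        when (u′ <b n) (when (within b′ u′ b) (when (descending r) ((t * U ^ (u′ ∸ suc b)) * (M * U ^ (n ∸ u′)))))
          ≈⟨ when-cong (u′ <b n) (λ _ → when-cong (within b′ u′ b) (λ _ → sym (*-when (descending r) _ _))) ⟩
        when (u′ <b n) (when (within b′ u′ b) ((t * U ^ (u′ ∸ suc b)) * when (descending r) (M * U ^ (n ∸ u′))))
          ≈⟨ when-cong (u′ <b n) (λ _ → trans (when-cong (within b′ u′ b) (λ _ → *-comm _ _)) (sym (*-when (within b′ u′ b) _ _))) ⟩
        when (u′ <b n) (when (descending r) (M * U ^ (n ∸ u′)) * when (within b′ u′ b) (t * U ^ (u′ ∸ suc b)))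
          ≈⟨ trans (when-cong (u′ <b n) (λ _ → *-comm _ _)) (trans (sym (*-when (u′ <b n) _ _)) (*-comm _ _)) ⟩
        C * when (within b′ u′ b) (t * U ^ (u′ ∸ suc b)) ∎
        where
        t = touch p (b == b′)
        M = mass p q r

  -- The sum over the number d ≥ 1 of rows by which the new column rises above its neighbour, each
  -- carrying U ^ d: as a power series in the height, multiplication by yU / (1 - yU).
  aboveRec : Carrier → Carrier → Carrier → ℕ → ℕ → Carrier
  aboveRec p q U v zero    = 0#
  aboveRec p q U v (suc n) = U * (polySum topsDecrease p q (ψ p U) v n + aboveRec p q U v n)

  ==-split : ∀ u n x → u ≤ n → x ≈ when (u == n) x + when (u <b n) x
  ==-split u n x u≤n with ℕP.m≤n⇒m<n∨m≡n u≤n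
  ... | inj₁ u<n = sym (trans (+-cong (when-false x (==-false (ℕP.<⇒≢ u<n))) (when-true x (<b-true u<n))) (+-identityˡ x))
  ... | inj₂ u≡n = sym (trans (+-cong (when-true x (==-true u≡n)) (when-false x (<b-false (ℕP.≤-reflexive (≡.sym u≡n))))) (+-identityʳ x))

  -- In a strip of height n + 1 the first top, hence every top, is at most n. It either equals n,
  -- which gives a normalised polyomino of height n, or is lower, which gives the same sum for the
  -- strip of height n. Both carry one more factor `U` for the additional row.
  aboveTerm-sum : ∀ p q U v n → ∑L (suc v) n (aboveTerm p q U n) ≈ aboveRec p q U (suc v) n
  aboveTerm-sum p q U v zero    = refl
  aboveTerm-sum p q U v (suc n) = begin
    ∑L (suc v) (suc n) (aboveTerm p q U (suc n))
      ≈⟨ ∑L-restrict (suc v) n (aboveTerm p q U (suc n)) escapes ⟩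
    ∑L (suc v) n (aboveTerm p q U (suc n))
      ≈⟨ ∑col-cong n (λ { c f → ∑L-cong v n λ cs val → pointwise c cs (f ∷ val) }) ⟩
    ∑L (suc v) n (λ cs → U * (polyTerm topsDecrease p q (ψ p U) n cs + aboveTerm p q U n cs))
      ≈⟨ *-∑L (suc v) n U (λ cs → polyTerm topsDecrease p q (ψ p U) n cs + aboveTerm p q U n cs) ⟨
    U * ∑L (suc v) n (λ cs → polyTerm topsDecrease p q (ψ p U) n cs + aboveTerm p q U n cs)
      ≈⟨ *-congˡ (∑L-+ (suc v) n (polyTerm topsDecrease p q (ψ p U) n) (aboveTerm p q U n)) ⟩
    U * (polySum topsDecrease p q (ψ p U) (suc v) n + ∑L (suc v) n (aboveTerm p q U n))
      ≈⟨ *-congˡ (+-congˡ (aboveTerm-sum p q U v n)) ⟩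
    aboveRec p q U (suc v) (suc n) ∎
    where
    escapes : ∀ cs → Valid (suc n) cs → ¬ Valid n cs → aboveTerm p q U (suc n) cs ≈ 0#
    escapes []       val ¬val = contradiction [] ¬val
    escapes (c ∷ cs) val ¬val = when-0 (proj₂ c <b suc n) λ e → when-0 (descending (c ∷ cs)) λ d →
      ⊥-elim (¬val (topsDecrease⇒valid c cs val (∧-elimˡ (∧-elimʳ {hasBottom0 (c ∷ cs)} d)) (ℕP.≤-pred (<b-holds e))))
    pointwise : ∀ c cs → Valid n (c ∷ cs) →
      aboveTerm p q U (suc n) (c ∷ cs) ≈ U * (polyTerm topsDecrease p q (ψ p U) n (c ∷ cs) + aboveTerm p q U n (c ∷ cs))
    pointwise c@(b , u) cs val@((b<u , u≤n) ∷ _) = begin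
      when (u <b suc n) (when (descending r) (M * (U ^ (suc n ∸ u) * ψ p U (gap r))))
        ≈⟨ when-true _ (<b-true (s≤s u≤n)) ⟩
      when (descending r) (M * (U ^ (suc n ∸ u) * ψ p U (gap r)))
        ≈⟨ when-cong (descending r) (λ _ → trans (*-congˡ (*-congʳ (reflexive (cong (U ^_) (ℕP.+-∸-assoc 1 u≤n)))))
             (solve 4 (λ m a x s → m :* ((a :* x) :* s) := a :* (m :* (x :* s))) refl M U (U ^ (n ∸ u)) (ψ p U (gap r)))) ⟩
      when (descending r) (U * (M * (U ^ (n ∸ u) * ψ p U (gap r))))
        ≈⟨ *-when (descending r) U _ ⟨
      U * when (descending r) (M * (U ^ (n ∸ u) * ψ p U (gap r)))
        ≈⟨ *-congˡ (==-split u n _ u≤n) ⟩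
      U * (when (u == n) (when (descending r) (M * (U ^ (n ∸ u) * ψ p U (gap r)))) + aboveTerm p q U n r)
        ≈⟨ *-congˡ (+-congʳ (trans (when-cong (u == n) (λ e → when-cong (descending r) (λ _ → *-congˡ (trans
             (*-congʳ (reflexive (cong (U ^_) (≡.trans (cong (n ∸_) (==-holds e)) (ℕP.n∸n≡0 n))))) (*-identityˡ _)))))
             (reflexive (≡.trans (≡.sym (when-∧ (u == n) (descending r) _)) (cong (λ t → when t (M * ψ p U (gap r))) (≡.sym (conv-topsDecrease c cs u≤n))))))) ⟩
      U * (polyTerm topsDecrease p q (ψ p U) n r + aboveTerm p q U n r) ∎
      where
      r = c ∷ cs
      M = mass p q r

  -- The deleted column spanned the whole strip, so its power of `U` is the same for every pyramid
  -- that lies strictly inside the strip.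
  outsideTerm : Carrier → Carrier → Carrier → ℕ → List Col → Carrier
  outsideTerm p q U n cs = when (0 <b firstBottom cs) (when (firstTop cs <b n) (when (pyramid cs) (mass p q cs * U ^ (n ∸ 1))))

  outside-condition : ∀ {n} b u b′ u′ cs → b < u → u ≤ n → Valid n ((b′ , u′) ∷ cs) →
    outside ((b , u) ∷ (b′ , u′) ∷ cs) ∧ conv n ((b , u) ∷ (b′ , u′) ∷ cs) ≡
    (u == n) ∧ (b == 0) ∧ ((b <b b′) ∧ (u′ <b u)) ∧ pyramid ((b′ , u′) ∷ cs)
  outside-condition {n} b u b′ u′ cs b<u u≤n val =
    ≡.trans (cong₂ (λ s t → (s ∧ t) ∧ conv n ((b , u) ∷ r)) (not-≤b b′ b) (not-≤b u u′)) (≡-from-⇔ to from)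
    where
    r = (b′ , u′) ∷ cs
    to : ((b <b b′) ∧ (u′ <b u)) ∧ conv n ((b , u) ∷ r) ≡ true → (u == n) ∧ (b == 0) ∧ ((b <b b′) ∧ (u′ <b u)) ∧ pyramid r ≡ true
    to h = ∧-intro (∧-elimˡ {u == n} k) (∧-intro (∧-elimˡ {b == 0} k′) (∧-intro as (∧-elimʳ {b == 0} k′)))
      where
      as = ∧-elimˡ {(b <b b′) ∧ (u′ <b u)} h
      k = ≡.trans (≡.sym (conv-outside b u b′ u′ cs b<u u≤n val (<b-holds (∧-elimˡ {b <b b′} as)) (<b-holds (∧-elimʳ {b <b b′} as))))
            (∧-elimʳ {(b <b b′) ∧ (u′ <b u)} h)
      k′ = ∧-elimʳ {u == n} k
    from : (u == n) ∧ (b == 0) ∧ ((b <b b′) ∧ (u′ <b u)) ∧ pyramid r ≡ true → ((b <b b′) ∧ (u′ <b u)) ∧ conv n ((b , u) ∷ r) ≡ true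
    from h = ∧-intro as (≡.trans (conv-outside b u b′ u′ cs b<u u≤n val (<b-holds (∧-elimˡ {b <b b′} as)) (<b-holds (∧-elimʳ {b <b b′} as)))
      (∧-intro (∧-elimˡ {u == n} h) (∧-intro (∧-elimˡ {b == 0} h₁) (∧-elimʳ {(b <b b′) ∧ (u′ <b u)} h₂))))
      where
      h₁ = ∧-elimʳ {u == n} h
      h₂ = ∧-elimʳ {b == 0} h₁
      as = ∧-elimˡ {(b <b b′) ∧ (u′ <b u)} h₂

  outside-sum : ∀ p q U v n → partSum outside p q U (suc (suc v)) n ≈ ∑L (suc v) n (outsideTerm p q U n)
  outside-sum p q U v n = trans (∑L-second-first v n (partTerm outside p q U n))
    (∑col-cong n λ { (b′ , u′) f → ∑L-cong v n λ cs val → term b′ u′ cs (f ∷ val) })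
    where
    term : ∀ b′ u′ cs → Valid n ((b′ , u′) ∷ cs) →
      ∑col n (λ c → partTerm outside p q U n (c ∷ (b′ , u′) ∷ cs)) ≈ outsideTerm p q U n ((b′ , u′) ∷ cs)
    term b′ u′ cs val@((b′<u′ , u′≤n) ∷ _) = begin
      ∑ n (λ b → ∑ n λ u → when (b <b u) (partTerm outside p q U n ((b , u) ∷ r)))
        ≈⟨ ∑-cong′ n (λ b → ∑-cong n (λ u u≤n → pointwise b u u≤n)) ⟩
      ∑ n (λ b → ∑ n λ u → when (u == n) (when (b == 0) (W b u)))
        ≈⟨ ∑-cong′ n (λ b → ∑-pick n n (λ u → when (b == 0) (W b u)) ℕP.≤-refl) ⟩
      ∑ n (λ b → when (b == 0) (W b n))
        ≈⟨ ∑-pick n 0 (λ b → W b n) z≤n ⟩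
      W 0 n ∎
      where
      r = (b′ , u′) ∷ cs
      W : ℕ → ℕ → Carrier
      W b u = when (b <b b′) (when (u′ <b u) (when (pyramid r) (mass p q r * U ^ (u ∸ b ∸ 1))))
      X : ℕ → ℕ → Carrier
      X b u = mass p q ((b , u) ∷ r) * U ^ (u ∸ b ∸ 1)
      mass-outside : ∀ b u → b < b′ → u′ < u → mass p q ((b , u) ∷ r) ≈ mass p q r
      mass-outside b u lt lt′ = trans (mass-∷ p q b u b′ u′ cs) (trans (*-congʳ (trans
        (*-cong (reflexive (cong (touch p) (==-false (ℕP.<⇒≢ lt)))) (reflexive (cong (touch q) (==-false (λ e → ℕP.<-irrefl (≡.sym e) lt′)))))
        (*-identityʳ _))) (*-identityˡ _))
      holds : ∀ b u → b < u → u ≤ n → partTerm outside p q U n ((b , u) ∷ r) ≈ when (u == n) (when (b == 0) (W b u))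
      holds b u b<u u≤n = begin
        when (outside ((b , u) ∷ r)) (when (conv n ((b , u) ∷ r)) (X b u))
          ≡⟨ when-∧ (outside ((b , u) ∷ r)) (conv n ((b , u) ∷ r)) (X b u) ⟨
        when (outside ((b , u) ∷ r) ∧ conv n ((b , u) ∷ r)) (X b u)
          ≡⟨ when-∧₂ (u == n) _ (X b u) (outside-condition b u b′ u′ cs b<u u≤n val) ⟩
        when (u == n) (when ((b == 0) ∧ ((b <b b′) ∧ (u′ <b u)) ∧ pyramid r) (X b u))
          ≡⟨ cong (when (u == n)) (≡.trans (when-∧ (b == 0) _ _) (cong (when (b == 0))
               (≡.trans (when-∧ ((b <b b′) ∧ (u′ <b u)) (pyramid r) _) (when-∧ (b <b b′) (u′ <b u) _)))) ⟩
        when (u == n) (when (b == 0) (when (b <b b′) (when (u′ <b u) (when (pyramid r) (X b u)))))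
          ≈⟨ when-cong (u == n) (λ _ → when-cong (b == 0) (λ _ → when-cong (b <b b′) (λ e → when-cong (u′ <b u) (λ e′ →
               when-cong (pyramid r) (λ _ → *-congʳ (mass-outside b u (<b-holds e) (<b-holds e′))))))) ⟩
        when (u == n) (when (b == 0) (W b u)) ∎
      pointwise : ∀ b u → u ≤ n → when (b <b u) (partTerm outside p q U n ((b , u) ∷ r)) ≈ when (u == n) (when (b == 0) (W b u))
      pointwise b u u≤n with ℕP.<-≤-connex b u
      ... | inj₁ b<u = trans (when-true _ (<b-true b<u)) (holds b u b<u u≤n)
      ... | inj₂ u≤b = trans (when-false _ (<b-false u≤b)) (sym (when-0 (u == n) λ _ → when-0 (b == 0) λ _ →
            when-0 (b <b b′) λ e → when-0 (u′ <b u) λ e′ → contradiction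
              (ℕP.<-trans (<b-holds e) (ℕP.<-trans b′<u′ (<b-holds e′))) (ℕP.≤⇒≯ u≤b)))

  module _ (p q U : Carrier) (v : ℕ) where

    -- Pyramids that stand on the lower edge of a strip of height n: those that reach its upper
    -- edge, and those already in the strip one row lower.
    bottomRec : ℕ → Carrier
    bottomRec zero    = polySum stack p q (U ^_) v 0
    bottomRec (suc n) = polySum stack p q (U ^_) v (suc n) + U * bottomRec n

    -- Pyramids anywhere in the strip: those standing on the lower edge, and the others, which move
    -- down by one row into a lower strip.
    anyRec : ℕ → Carrier
    anyRec zero    = bottomRec 0
    anyRec (suc n) = bottomRec (suc n) + U * anyRec n

    -- One free row above and one below give the two factors `U`. At height 1 the value is written
    -- `U * 0#` so that it unfolds to the coefficient shift by yU applied twice.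
    outsideRec : ℕ → Carrier
    outsideRec zero          = 0#
    outsideRec (suc zero)    = U * 0#
    outsideRec (suc (suc n)) = U * (U * anyRec n)

  pyramidTerm bottomTerm raisedTerm : Carrier → Carrier → Carrier → ℕ → List Col → Carrier
  pyramidTerm p q U e cs = when (pyramid cs) (mass p q cs * U ^ e)
  bottomTerm  p q U e cs = when (firstBottom cs == 0) (pyramidTerm p q U e cs)
  raisedTerm  p q U e cs = when (0 <b firstBottom cs) (pyramidTerm p q U e cs)

  pyramidTerm-suc : ∀ p q U e cs → pyramidTerm p q U (suc e) cs ≈ U * pyramidTerm p q U e cs
  pyramidTerm-suc p q U e cs = trans
    (when-cong (pyramid cs) λ _ → solve 3 (λ m a x → m :* (a :* x) := a :* (m :* x)) refl _ _ _)
    (sym (*-when (pyramid cs) U _))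

  -- U ^ n = U · U ^ (n ∸ 1) fails for n = 0, but then there are no columns.
  factor-U : ∀ p q U v n (b : List Col → Bool) →
    ∑L (suc v) n (λ cs → when (b cs) (pyramidTerm p q U n cs)) ≈ U * ∑L (suc v) n (λ cs → when (b cs) (pyramidTerm p q U (n ∸ 1) cs))
  factor-U p q U v zero    b = sym (zeroʳ U)
  factor-U p q U v (suc n) b = trans
    (∑L-cong (suc v) (suc n) λ cs _ → trans (when-cong (b cs) λ _ → pyramidTerm-suc p q U n cs) (sym (*-when (b cs) U _)))
    (sym (*-∑L (suc v) (suc n) U (λ cs → when (b cs) (pyramidTerm p q U n cs))))

  pyramid-tops : ∀ cs → pyramid cs ≡ true → topsDecrease cs ≡ true
  pyramid-tops cs = ∧-elimˡ {topsDecrease cs}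

  -- A pyramid whose first column stays below the top row stays below it entirely, so that row can
  -- be removed from the strip.
  lower-box : ∀ p q U v n e (b : List Col → Bool) →
    ∑L (suc v) (suc n) (λ cs → when (b cs) (when (firstTop cs <b suc n) (pyramidTerm p q U e cs))) ≈
    ∑L (suc v) n (λ cs → when (b cs) (pyramidTerm p q U e cs))
  lower-box p q U v n e b = trans
    (∑L-restrict (suc v) n (λ cs → when (b cs) (when (firstTop cs <b suc n) (pyramidTerm p q U e cs))) escapes)
    (∑col-cong n λ c f → ∑L-cong v n λ cs _ → when-cong (b (c ∷ cs)) λ _ → when-true _ (<b-true (s≤s (proj₂ f))))
    where
    escapes : ∀ cs → Valid (suc n) cs → ¬ Valid n cs → when (b cs) (when (firstTop cs <b suc n) (pyramidTerm p q U e cs)) ≈ 0#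
    escapes []       val ¬val = contradiction [] ¬val
    escapes (c ∷ cs) val ¬val = when-0 (b (c ∷ cs)) λ _ → when-0 (proj₂ c <b suc n) λ lt → when-0 (pyramid (c ∷ cs)) λ y →
      ⊥-elim (¬val (topsDecrease⇒valid c cs val (pyramid-tops (c ∷ cs) y) (ℕP.≤-pred (<b-holds lt))))

  pyramidTerm-flip : ∀ p q U e {n cs} → Valid n cs → pyramidTerm p q U e (map (flip n) cs) ≈ pyramidTerm q p U e cs
  pyramidTerm-flip p q U e {n} {cs} val = trans
    (reflexive (cong (λ t → when t (mass p q (map (flip n) cs) * U ^ e))
      (≡.trans (cong₂ (λ x y → x ∧ y) (flip-topsDecrease val) (cong₂ _∧_ (flip-bottomsIncrease val) (flip-good val)))
        (∧-swap (bottomsIncrease cs) (topsDecrease cs) (good cs)))))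
    (when-cong (pyramid cs) λ _ → *-congʳ (mass-flip p q val))

  pyramid-flip : ∀ p q U v n e → ∑L v n (pyramidTerm p q U e) ≈ ∑L v n (pyramidTerm q p U e)
  pyramid-flip p q U v n e = trans (∑L-flip v n (pyramidTerm p q U e)) (∑L-cong v n λ cs val → pyramidTerm-flip p q U e val)

  module _ (p q U : Carrier) (v : ℕ) where

    private
      stackTerm : ∀ n c cs → Valid n (c ∷ cs) →
        when (proj₂ c == n) (bottomTerm p q U (n ∸ 1) (c ∷ cs)) ≈ polyTerm stack p q (U ^_) n (c ∷ cs)
      stackTerm n c@(b , u) cs ((b<u , u≤n) ∷ _) = begin
        when (u == n) (when (b == 0) (when (pyramid r) (mass p q r * U ^ (n ∸ 1))))
          ≈⟨ when-cong (u == n) (λ e → when-cong (b == 0) (λ e′ → when-cong (pyramid r) (λ _ → *-congˡ (reflexive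
               (cong (λ h → U ^ (h ∸ 1)) (cong₂ _∸_ (≡.sym (==-holds e)) (≡.sym (==-holds e′)))))))) ⟩
        when (u == n) (when (b == 0) (when (pyramid r) (mass p q r * U ^ gap r)))
          ≡⟨ ≡.trans (when-∧ (u == n) _ _) (cong (when (u == n)) (when-∧ (b == 0) (pyramid r) _)) ⟨
        when ((u == n) ∧ (b == 0) ∧ pyramid r) (mass p q r * U ^ gap r)
          ≡⟨ cong (λ t → when t (mass p q r * U ^ gap r)) (conv-pyramid c cs u≤n) ⟨
        polyTerm stack p q (U ^_) n r ∎
        where r = c ∷ cs

    -- For a pyramid the first column is the longest, so one that touches both edges of the strip
    -- has first column of height n, and the fixed exponent n - 1 is its own left height minus 1.
    -- These form the `stack` term; the rest fits below the top row.
    bottom-sum : ∀ n → ∑L (suc v) n (bottomTerm p q U (n ∸ 1)) ≈ bottomRec p q U (suc v) n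
    bottom-sum zero    = refl
    bottom-sum (suc n) = begin
      ∑L (suc v) (suc n) (bottomTerm p q U n)
        ≈⟨ ∑col-cong (suc n) (λ c f → ∑L-cong v (suc n) λ cs val → trans (==-split (proj₂ c) (suc n) _ (proj₂ f))
             (+-cong (stackTerm (suc n) c cs (f ∷ val)) (reflexive (when-swap (proj₂ c <b suc n) (proj₁ c == 0) _)))) ⟩
      ∑L (suc v) (suc n) (λ cs → polyTerm stack p q (U ^_) (suc n) cs + lowTerm cs)
        ≈⟨ ∑L-+ (suc v) (suc n) (polyTerm stack p q (U ^_) (suc n)) lowTerm ⟩
      polySum stack p q (U ^_) (suc v) (suc n) + ∑L (suc v) (suc n) lowTerm
        ≈⟨ +-congˡ (lower-box p q U v n n (λ cs → firstBottom cs == 0)) ⟩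
      polySum stack p q (U ^_) (suc v) (suc n) + ∑L (suc v) n (bottomTerm p q U n)
        ≈⟨ +-congˡ (trans (factor-U p q U v n (λ cs → firstBottom cs == 0)) (*-congˡ (bottom-sum n))) ⟩
      bottomRec p q U (suc v) (suc n) ∎
      where
      lowTerm : List Col → Carrier
      lowTerm cs = when (firstBottom cs == 0) (when (firstTop cs <b suc n) (pyramidTerm p q U n cs))

    -- Translation by one row is a composite of reflections in strips of heights n + 1 and n.
    raised-sum : ∀ n → ∑L (suc v) (suc n) (raisedTerm p q U n) ≈ U * ∑L (suc v) n (pyramidTerm p q U (n ∸ 1))
    raised-sum n = begin
      ∑L (suc v) (suc n) (raisedTerm p q U n)
        ≈⟨ ∑L-flip (suc v) (suc n) (raisedTerm p q U n) ⟩
      ∑L (suc v) (suc n) (λ cs → raisedTerm p q U n (map (flip (suc n)) cs))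
        ≈⟨ ∑col-cong (suc n) (λ c f → ∑L-cong v (suc n) λ cs val → trans
             (reflexive (cong (λ t → when t (pyramidTerm p q U n (map (flip (suc n)) (c ∷ cs)))) (lifted (proj₂ c))))
             (when-cong (proj₂ c <b suc n) λ _ → pyramidTerm-flip p q U n (f ∷ val))) ⟩
      ∑L (suc v) (suc n) (λ cs → when true (when (firstTop cs <b suc n) (pyramidTerm q p U n cs)))
        ≈⟨ lower-box q p U v n n (λ _ → true) ⟩
      ∑L (suc v) n (pyramidTerm q p U n)
        ≈⟨ pyramid-flip q p U (suc v) n n ⟩
      ∑L (suc v) n (pyramidTerm p q U n)
        ≈⟨ factor-U p q U v n (λ _ → true) ⟩
      U * ∑L (suc v) n (pyramidTerm p q U (n ∸ 1)) ∎
      where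
      lifted : ∀ u → (0 <b (suc n ∸ u)) ≡ (u <b suc n)
      lifted u = ≡-from-⇔ (λ e → <b-true (ℕP.m∸n≢0⇒n<m λ e′ → ℕP.<-irrefl (≡.sym e′) (<b-holds e)))
                          (λ e → <b-true (ℕP.m<n⇒0<n∸m (<b-holds e)))

    any-split : ∀ n e → ∑L (suc v) n (pyramidTerm p q U e) ≈
                ∑L (suc v) n (bottomTerm p q U e) + ∑L (suc v) n (raisedTerm p q U e)
    any-split n e = trans
      (∑L-cong (suc v) n λ cs _ → split (firstBottom cs) (pyramidTerm p q U e cs))
      (∑L-+ (suc v) n (bottomTerm p q U e) (raisedTerm p q U e))
      where
      split : ∀ b x → x ≈ when (b == 0) x + when (0 <b b) x
      split zero    x = sym (+-identityʳ x)
      split (suc b) x = sym (+-identityˡ x)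

    any-sum : ∀ n → ∑L (suc v) n (pyramidTerm p q U (n ∸ 1)) ≈ anyRec p q U (suc v) n
    any-sum zero    = refl
    any-sum (suc n) = trans (any-split (suc n) n)
      (+-cong (bottom-sum (suc n)) (trans (raised-sum n) (*-congˡ (any-sum n))))

    -- The free row at the top is removed by `lower-box`, the one at the bottom by `raised-sum`; a
    -- strip with fewer than two rows leaves no room for a pyramid between them.
    outsideTerm-sum : ∀ n → ∑L (suc v) n (outsideTerm p q U n) ≈ outsideRec p q U (suc v) n
    outsideTerm-sum zero    = refl
    outsideTerm-sum (suc n) = trans (lower-box p q U v n n (λ cs → 0 <b firstBottom cs))
      (trans (factor-U p q U v n (λ cs → 0 <b firstBottom cs)) (step n))
      where
      step : ∀ n → U * ∑L (suc v) n (raisedTerm p q U (n ∸ 1)) ≈ outsideRec p q U (suc v) (suc n)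
      step zero    = refl
      step (suc n) = *-congˡ (trans (raised-sum n) (*-congˡ (any-sum n)))

  next-column : ∀ p q U v n → polySum everything p q (U ^_) (suc (suc v)) n ≈
    polySum everything p q (λ k → p * q * U ^ k + (p + q) * rep U k + rep₂ U k) (suc v) n
    + aboveRec p q U (suc v) n + aboveRec q p U (suc v) n + outsideRec p q U (suc v) n
  next-column p q U v n = trans (four-parts p q U v n)
    (+-cong (+-cong (+-cong (inside-sum p q U v n)
      (trans (above-sum p q U v n) (aboveTerm-sum p q U v n)))
      (trans (below-flip p q U (suc (suc v)) n) (trans (above-sum q p U v n) (aboveTerm-sum q p U v n))))
      (trans (outside-sum p q U v n) (outsideTerm-sum p q U v n)))

-- The functional equation of the generating function.

module FunEq {c ℓ} (K : CommutativeRing c ℓ) where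

  open RingTools K using (solve; _:=_; _:+_; _:*_; _:-_; :0; :1)
  open Sums K
  open ColSums K
  open Recurrence K

  open CommutativeRing K
  open import Algebra.Properties.Semiring.Exp semiring using (_^_)
  open import Relation.Binary.Reasoning.Setoid setoid

  polySum-cong : ∀ S p q {φ χ} v n → (∀ k → φ k ≈ χ k) → polySum S p q φ v n ≈ polySum S p q χ v n
  polySum-cong S p q v n e = ∑L-cong v n λ cs _ → when-cong (conv n cs ∧ S cs) λ _ → *-congˡ (e (gap cs))

  polySum-+ : ∀ S p q φ χ v n → polySum S p q (λ k → φ k + χ k) v n ≈ polySum S p q φ v n + polySum S p q χ v n
  polySum-+ S p q φ χ v n = trans
    (∑L-cong v n λ cs _ → trans (when-cong (conv n cs ∧ S cs) λ _ → distribˡ _ _ _) (when-+ (conv n cs ∧ S cs) _ _))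
    (∑L-+ v n (polyTerm S p q φ n) (polyTerm S p q χ n))

  *-polySum : ∀ S p q k φ v n → k * polySum S p q φ v n ≈ polySum S p q (λ i → k * φ i) v n
  *-polySum S p q k φ v n = trans (*-∑L v n k (polyTerm S p q φ n))
    (∑L-cong v n λ cs _ → trans (*-when (conv n cs ∧ S cs) k _) (when-cong (conv n cs ∧ S cs) λ _ →
      solve 3 (λ k m x → k :* (m :* x) := m :* (k :* x)) refl _ _ _))

  single-column : ∀ p q U n → polySum everything p q (U ^_) 1 (suc n) ≈ U ^ n
  single-column p q U n = begin
    ∑ (suc n) (λ b → ∑ (suc n) λ u → when (b <b u) (polyTerm everything p q (U ^_) (suc n) ((b , u) ∷ [])))
      ≈⟨ ∑-cong′ (suc n) (λ b → ∑-cong′ (suc n) λ u → pointwise b u) ⟩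
    ∑ (suc n) (λ b → ∑ (suc n) λ u → when (u == suc n) (when (b == 0) (U ^ (u ∸ b ∸ 1) * when (b <b u) 1#)))
      ≈⟨ ∑-cong′ (suc n) (λ b → ∑-pick (suc n) (suc n) (λ u → when (b == 0) (U ^ (u ∸ b ∸ 1) * when (b <b u) 1#)) ℕP.≤-refl) ⟩
    ∑ (suc n) (λ b → when (b == 0) (U ^ (suc n ∸ b ∸ 1) * when (b <b suc n) 1#))
      ≈⟨ ∑-pick (suc n) 0 (λ b → U ^ (suc n ∸ b ∸ 1) * when (b <b suc n) 1#) z≤n ⟩
    U ^ n * 1#
      ≈⟨ *-identityʳ _ ⟩
    U ^ n ∎
    where
    -- For one column, `conv` unfolds to disjunctions ending in `false` and conjunctions ending in
    -- `true`. The guards are reordered so that both edges can be picked out by `∑-pick`.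
    shuffle : ∀ a b s x → when s (when (((a Data.Bool.∨ false) ∧ (b Data.Bool.∨ false) ∧ true) ∧ true) (1# * 1# * x)) ≈ when b (when a (x * when s 1#))
    shuffle true  true  true  x = solve 1 (λ x → :1 :* :1 :* x := x :* :1) refl x
    shuffle true  true  false x = sym (zeroʳ x)
    shuffle true  false true  x = refl
    shuffle true  false false x = refl
    shuffle false true  true  x = refl
    shuffle false true  false x = refl
    shuffle false false true  x = refl
    shuffle false false false x = refl
    pointwise : ∀ b u → when (b <b u) (polyTerm everything p q (U ^_) (suc n) ((b , u) ∷ [])) ≈
                when (u == suc n) (when (b == 0) (U ^ (u ∸ b ∸ 1) * when (b <b u) 1#))
    pointwise b u = shuffle (b == 0) (u == suc n) (b <b u) (U ^ (u ∸ b ∸ 1))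

  -- The empty list touches neither edge of the box, so `conv` rejects it and every recursion starts
  -- from zero.
  aboveRec-0 : ∀ p q U n → aboveRec p q U 0 n ≈ 0#
  aboveRec-0 p q U zero    = refl
  aboveRec-0 p q U (suc n) = trans (*-congˡ (trans (+-congˡ (aboveRec-0 p q U n)) (+-identityʳ 0#))) (zeroʳ U)

  bottomRec-0 : ∀ p q U n → bottomRec p q U 0 n ≈ 0#
  bottomRec-0 p q U zero    = refl
  bottomRec-0 p q U (suc n) = trans (+-congˡ (trans (*-congˡ (bottomRec-0 p q U n)) (zeroʳ U))) (+-identityʳ 0#)

  anyRec-0 : ∀ p q U n → anyRec p q U 0 n ≈ 0#
  anyRec-0 p q U zero    = refl
  anyRec-0 p q U (suc n) = trans (+-cong (bottomRec-0 p q U (suc n)) (trans (*-congˡ (anyRec-0 p q U n)) (zeroʳ U))) (+-identityʳ 0#)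

  outsideRec-0 : ∀ p q U n → outsideRec p q U 0 n ≈ 0#
  outsideRec-0 p q U zero          = refl
  outsideRec-0 p q U (suc zero)    = zeroʳ U
  outsideRec-0 p q U (suc (suc n)) = trans (*-congˡ (trans (*-congˡ (anyRec-0 p q U n)) (zeroʳ U))) (zeroʳ U)

  -- The single columns, indexed by the number of further columns: the factor x of the column itself
  -- has been taken out.
  column : Carrier → ℕ → ℕ → Carrier
  column U zero    (suc n) = U ^ n
  column U zero    zero    = 0#
  column U (suc v) n       = 0#

  -- Including v = 0, where all series for the rest vanish and the single column is the only
  -- contribution, gives one formula for all coefficients, as the passage to generating functions
  -- requires.
  add-column : ∀ p q U v n → polySum everything p q (U ^_) (suc v) n ≈
    column U v n + (polySum everything p q (λ k → p * q * U ^ k + (p + q) * rep U k + rep₂ U k) v n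
    + aboveRec p q U v n + aboveRec q p U v n + outsideRec p q U v n)
  add-column p q U zero n = trans (base n) (sym (trans (+-congˡ rest) (+-identityʳ _)))
    where
    base : ∀ n → polySum everything p q (U ^_) 1 n ≈ column U 0 n
    base zero    = refl
    base (suc n) = single-column p q U n
    rest : 0# + aboveRec p q U 0 n + aboveRec q p U 0 n + outsideRec p q U 0 n ≈ 0#
    rest = trans (+-cong (+-cong (+-congˡ (aboveRec-0 p q U n)) (aboveRec-0 q p U n)) (outsideRec-0 p q U n))
      (solve 0 (:0 :+ :0 :+ :0 :+ :0 := :0) refl)
  add-column p q U (suc v) n = trans (next-column p q U v n) (sym (+-identityˡ _))

  -- Generating functions with nilpotent x and y.

  module Truncated (N : ℕ) (x y : Carrier) (x-nil : x ^ suc N ≈ 0#) (y-nil : y ^ suc N ≈ 0#) where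

    σ : Carrier → (ℕ → Carrier) → Carrier
    σ z f = ∑ N λ i → z ^ i * f i

    σ-cong : ∀ z {f g} → (∀ i → f i ≈ g i) → σ z f ≈ σ z g
    σ-cong z e = ∑-cong′ N λ i → *-congˡ (e i)

    σ-+ : ∀ z f g → σ z (λ i → f i + g i) ≈ σ z f + σ z g
    σ-+ z f g = trans (∑-cong′ N λ i → distribˡ _ _ _) (∑-+ N _ _)

    *-σ : ∀ z k f → k * σ z f ≈ σ z (λ i → k * f i)
    *-σ z k f = trans (*-∑ N k _) (∑-cong′ N λ i → solve 3 (λ k a b → k :* (a :* b) := a :* (k :* b)) refl _ _ _)

    -- Shifting the coefficients by one is multiplication by z: the term of index N + 1 that is
    -- missing from the finite sum vanishes by nilpotency.
    σ-shift : ∀ z f → z ^ suc N ≈ 0# → f 0 ≈ 0# → σ z f ≈ z * σ z (λ i → f (suc i))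
    σ-shift z f nil f₀ = begin
      ∑ N (λ i → z ^ i * f i)
        ≈⟨ +-identityʳ _ ⟨
      ∑ N (λ i → z ^ i * f i) + 0#
        ≈⟨ +-congˡ (trans (*-congʳ nil) (zeroˡ _)) ⟨
      ∑ (suc N) (λ i → z ^ i * f i)
        ≈⟨ ∑-first N _ ⟩
      1# * f 0 + ∑ N (λ i → z * z ^ i * f (suc i))
        ≈⟨ +-cong (trans (*-congˡ f₀) (zeroʳ 1#)) (trans (∑-cong′ N λ i → *-assoc _ _ _) (sym (*-∑ N z _))) ⟩
      0# + z * σ z (λ i → f (suc i))
        ≈⟨ +-identityˡ _ ⟩
      z * σ z (λ i → f (suc i)) ∎

    Γ : (ℕ → ℕ → Carrier) → Carrier
    Γ F = σ x λ v → σ y (F v)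

    Γ-cong : ∀ {F G} → (∀ v h → F v h ≈ G v h) → Γ F ≈ Γ G
    Γ-cong e = σ-cong x λ v → σ-cong y (e v)

    Γ-+ : ∀ F G → Γ (λ v h → F v h + G v h) ≈ Γ F + Γ G
    Γ-+ F G = trans (σ-cong x λ v → σ-+ y (F v) (G v)) (σ-+ x _ _)

    *-Γ : ∀ k F → k * Γ F ≈ Γ (λ v h → k * F v h)
    *-Γ k F = trans (*-σ x k _) (σ-cong x λ v → *-σ y k _)

    Γ-shift-x : ∀ F → (∀ h → F 0 h ≈ 0#) → Γ F ≈ x * Γ (λ v h → F (suc v) h)
    Γ-shift-x F F₀ = σ-shift x (λ v → σ y (F v)) x-nil (∑-0 N λ i _ → trans (*-congˡ (F₀ i)) (zeroʳ _))

    Γ-shift-y : ∀ F → (∀ v → F v 0 ≈ 0#) → Γ F ≈ y * Γ (λ v h → F v (suc h))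
    Γ-shift-y F F₀ = trans (σ-cong x λ v → σ-shift y (F v) y-nil (F₀ v)) (sym (*-σ x y _))

    gf : (List Col → Bool) → Carrier → Carrier → (ℕ → Carrier) → Carrier
    gf S p q φ = Γ (polySum S p q φ)

    gf-cong : ∀ S p q {φ χ} → (∀ k → φ k ≈ χ k) → gf S p q φ ≈ gf S p q χ
    gf-cong S p q e = Γ-cong λ v h → polySum-cong S p q v h e

    gf-+ : ∀ S p q φ χ → gf S p q (λ k → φ k + χ k) ≈ gf S p q φ + gf S p q χ
    gf-+ S p q φ χ = trans (Γ-cong λ v h → polySum-+ S p q φ χ v h) (Γ-+ _ _)

    *-gf : ∀ S p q k φ → k * gf S p q φ ≈ gf S p q (λ i → k * φ i)
    *-gf S p q k φ = trans (*-Γ k _) (Γ-cong λ v h → *-polySum S p q k φ v h)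

    number : ℕ → Carrier
    number zero    = 0#
    number (suc n) = number n + 1#

    -- rep and rep₂ are the first and second divided differences of U ^ k at the points 1 and U.
    rep-quotient : ∀ U k → (1# - U) * rep U k + U ^ k ≈ 1# ^ k
    rep-quotient U zero    = solve 1 (λ U → (:1 :- U) :* :0 :+ :1 := :1) refl U
    rep-quotient U (suc k) = trans
      (solve 3 (λ U r z → (:1 :- U) :* (r :+ z) :+ U :* z := (:1 :- U) :* r :+ z) refl U (rep U k) (U ^ k))
      (trans (rep-quotient U k) (sym (*-identityˡ _)))

    one-power : ∀ k → 1# ^ k ≈ 1#
    one-power zero    = refl
    one-power (suc k) = trans (*-identityˡ _) (one-power k)

    rep₂-quotient : ∀ U k → (1# - U) * rep₂ U k + rep U k ≈ number k
    rep₂-quotient U zero    = solve 1 (λ U → (:1 :- U) :* :0 :+ :0 := :0) refl U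
    rep₂-quotient U (suc k) = trans
      (solve 4 (λ U s r z → (:1 :- U) :* (s :+ r) :+ (r :+ z) := ((:1 :- U) :* s :+ r) :+ ((:1 :- U) :* r :+ z)) refl U (rep₂ U k) (rep U k) (U ^ k))
      (+-cong (rep₂-quotient U k) (trans (rep-quotient U k) (one-power k)))

    gf-quotient : ∀ S p q k {φ χ ω} → (∀ i → k * φ i + χ i ≈ ω i) → k * gf S p q φ + gf S p q χ ≈ gf S p q ω
    gf-quotient S p q k {φ} {χ} {ω} e = begin
      k * gf S p q φ + gf S p q χ                     ≈⟨ +-congʳ (*-gf S p q k φ) ⟩
      gf S p q (λ i → k * φ i) + gf S p q χ           ≈⟨ gf-+ S p q (λ i → k * φ i) χ ⟨
      gf S p q (λ i → k * φ i + χ i)                  ≈⟨ gf-cong S p q e ⟩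
      gf S p q ω                                      ∎

    columns : Carrier → Carrier
    columns U = Γ (column U)

    columns-equation : ∀ U → columns U ≈ y * (1# + U * columns U)
    columns-equation U = begin
      Γ (column U)                                     ≈⟨ Γ-shift-y (column U) (λ { zero → refl ; (suc v) → refl }) ⟩
      y * Γ (λ v h → column U v (suc h))               ≈⟨ *-congˡ (Γ-cong peel) ⟩
      y * Γ (λ v h → unit v h + U * column U v h)      ≈⟨ *-congˡ (Γ-+ unit (λ v h → U * column U v h)) ⟩
      y * (Γ unit + Γ (λ v h → U * column U v h))      ≈⟨ *-congˡ (+-cong Γ-unit (sym (*-Γ U (column U)))) ⟩
      y * (1# + U * columns U)                         ∎
      where
      unit : ℕ → ℕ → Carrier
      unit zero    zero    = 1#
      unit zero    (suc _) = 0#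
      unit (suc _) _       = 0#
      peel : ∀ v h → column U v (suc h) ≈ unit v h + U * column U v h
      peel zero    zero    = sym (trans (+-congˡ (zeroʳ U)) (+-identityʳ 1#))
      peel zero    (suc h) = sym (+-identityˡ _)
      peel (suc v) h       = sym (trans (+-identityˡ _) (zeroʳ U))
      first-only : ∀ n z f → (∀ i → f (suc i) ≈ 0#) → ∑ n (λ i → z ^ i * f i) ≈ f 0
      first-only zero    z f e = *-identityˡ _
      first-only (suc n) z f e = trans (+-cong (first-only n z f e) (trans (*-congˡ (e n)) (zeroʳ _))) (+-identityʳ _)
      Γ-unit : Γ unit ≈ 1#
      Γ-unit = trans (first-only N x (λ v → σ y (unit v)) (λ i → ∑-0 N λ j _ → zeroʳ _)) (first-only N y (unit 0) (λ _ → refl))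

    aboves : Carrier → Carrier → Carrier → Carrier
    aboves p q U = Γ (aboveRec p q U)

    aboves-equation : ∀ p q U → aboves p q U ≈ y * (U * (gf topsDecrease p q (ψ p U) + aboves p q U))
    aboves-equation p q U = begin
      Γ (aboveRec p q U)
        ≈⟨ Γ-shift-y (aboveRec p q U) (λ v → refl) ⟩
      y * Γ (λ v h → U * (polySum topsDecrease p q (ψ p U) v h + aboveRec p q U v h))
        ≈⟨ *-congˡ (*-Γ U (λ v h → polySum topsDecrease p q (ψ p U) v h + aboveRec p q U v h)) ⟨
      y * (U * Γ (λ v h → polySum topsDecrease p q (ψ p U) v h + aboveRec p q U v h))
        ≈⟨ *-congˡ (*-congˡ (Γ-+ (polySum topsDecrease p q (ψ p U)) (aboveRec p q U))) ⟩
      y * (U * (gf topsDecrease p q (ψ p U) + aboves p q U)) ∎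

    -- On coefficients, multiplication by yU.
    after : Carrier → (ℕ → ℕ → Carrier) → ℕ → ℕ → Carrier
    after U F v zero    = 0#
    after U F v (suc h) = U * F v h

    Γ-after : ∀ U F → Γ (after U F) ≈ y * (U * Γ F)
    Γ-after U F = trans (Γ-shift-y (after U F) (λ _ → refl)) (*-congˡ (sym (*-Γ U F)))

    bottoms-equation : ∀ p q U → Γ (bottomRec p q U) ≈ gf stack p q (U ^_) + y * (U * Γ (bottomRec p q U))
    bottoms-equation p q U = begin
      Γ (bottomRec p q U)
        ≈⟨ Γ-cong unfold ⟩
      Γ (λ v h → polySum stack p q (U ^_) v h + after U (bottomRec p q U) v h)
        ≈⟨ Γ-+ (polySum stack p q (U ^_)) (after U (bottomRec p q U)) ⟩
      gf stack p q (U ^_) + Γ (after U (bottomRec p q U))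
        ≈⟨ +-congˡ (Γ-after U (bottomRec p q U)) ⟩
      gf stack p q (U ^_) + y * (U * Γ (bottomRec p q U)) ∎
      where
      unfold : ∀ v h → bottomRec p q U v h ≈ polySum stack p q (U ^_) v h + after U (bottomRec p q U) v h
      unfold v zero    = sym (+-identityʳ _)
      unfold v (suc h) = refl

    anys-equation : ∀ p q U → Γ (anyRec p q U) ≈ Γ (bottomRec p q U) + y * (U * Γ (anyRec p q U))
    anys-equation p q U = begin
      Γ (anyRec p q U)
        ≈⟨ Γ-cong unfold ⟩
      Γ (λ v h → bottomRec p q U v h + after U (anyRec p q U) v h)
        ≈⟨ Γ-+ (bottomRec p q U) (after U (anyRec p q U)) ⟩
      Γ (bottomRec p q U) + Γ (after U (anyRec p q U))
        ≈⟨ +-congˡ (Γ-after U (anyRec p q U)) ⟩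
      Γ (bottomRec p q U) + y * (U * Γ (anyRec p q U)) ∎
      where
      unfold : ∀ v h → anyRec p q U v h ≈ bottomRec p q U v h + after U (anyRec p q U) v h
      unfold v zero    = sym (+-identityʳ _)
      unfold v (suc h) = refl

    outsides : Carrier → Carrier → Carrier → Carrier
    outsides p q U = Γ (outsideRec p q U)

    outsides-equation : ∀ p q U → outsides p q U ≈ y * (U * (y * (U * Γ (anyRec p q U))))
    outsides-equation p q U = trans (Γ-cong unfold) (trans (Γ-after U (after U (anyRec p q U))) (*-congˡ (*-congˡ (Γ-after U (anyRec p q U)))))
      where
      unfold : ∀ v h → outsideRec p q U v h ≈ after U (after U (anyRec p q U)) v h
      unfold v zero          = refl
      unfold v (suc zero)    = refl
      unfold v (suc (suc h)) = refl

    -- The part of the functional equation that does not involve the unknown series: single columns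
    -- and columns that stick out.
    remainder : Carrier → Carrier → Carrier → Carrier
    remainder p q U = columns U + (aboves p q U + aboves q p U + outsides p q U)

    functional-equation : ∀ p q U → gf everything p q (U ^_) ≈
      x * (remainder p q U + (p * q * gf everything p q (U ^_) + (p + q) * gf everything p q (rep U) + gf everything p q (rep₂ U)))
    functional-equation p q U = begin
      gf everything p q (U ^_)
        ≈⟨ Γ-shift-x (polySum everything p q (U ^_)) (λ _ → refl) ⟩
      x * Γ (λ v h → polySum everything p q (U ^_) (suc v) h)
        ≈⟨ *-congˡ (Γ-cong (add-column p q U)) ⟩
      x * Γ (λ v h → column U v h + (I v h + A v h + B v h + O v h))
        ≈⟨ *-congˡ (trans (Γ-+ (column U) (λ v h → I v h + A v h + B v h + O v h)) (+-congˡ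
             (trans (Γ-+ (λ v h → I v h + A v h + B v h) O) (+-congʳ
             (trans (Γ-+ (λ v h → I v h + A v h) B) (+-congʳ (Γ-+ I A))))))) ⟩
      x * (columns U + (Γ I + aboves p q U + aboves q p U + outsides p q U))
        ≈⟨ *-congˡ (+-congˡ (+-congʳ (+-congʳ (+-congʳ insides)))) ⟩
      x * (columns U + (insideSum + aboves p q U + aboves q p U + outsides p q U))
        ≈⟨ *-congˡ (solve 5 (λ c i a b o → c :+ (i :+ a :+ b :+ o) := (c :+ (a :+ b :+ o)) :+ i) refl _ _ _ _ _) ⟩
      x * (remainder p q U + insideSum) ∎
      where
      I A B O : ℕ → ℕ → Carrier
      I = polySum everything p q (λ k → p * q * U ^ k + (p + q) * rep U k + rep₂ U k)
      A = aboveRec p q U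
      B = aboveRec q p U
      O = outsideRec p q U
      insideSum : Carrier
      insideSum = p * q * gf everything p q (U ^_) + (p + q) * gf everything p q (rep U) + gf everything p q (rep₂ U)
      insides : Γ I ≈ insideSum
      insides = trans (gf-+ everything p q (λ k → p * q * U ^ k + (p + q) * rep U k) (rep₂ U)) (+-congʳ
        (trans (gf-+ everything p q (λ k → p * q * U ^ k) (λ k → (p + q) * rep U k))
          (+-cong (sym (*-gf everything p q (p * q) (U ^_))) (sym (*-gf everything p q (p + q) (rep U))))))

    module Root (p q U iD : Carrier)
      (kernel : (1# - p * q * x) * ((1# - U) * (1# - U)) ≈ x * (1# - (p + q) * (1# - U)))
      (inverse : (1# - y * U) * iD ≈ 1#) where

      G₁ G′ : Carrier
      G₁ = gf everything p q (1# ^_)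
      G′ = gf everything p q number

      -- The remainder multiplied by 1 - U. This factor turns the sum over `rep U` into the
      -- difference of the values of G^t at 1 and at U, so that only series of the statement are
      -- left.
      bracket : Carrier
      bracket = y * ((1# - U) * iD)
        + (y * (U * iD) * (gf topsDecrease p q (1# ^_) - (1# - p * (1# - U)) * gf topsDecrease p q (U ^_))
        + y * (U * iD) * (gf topsDecrease q p (1# ^_) - (1# - q * (1# - U)) * gf topsDecrease q p (U ^_))
        + y * y * (U * U * (1# - U) * (iD * iD)) * gf stack p q (U ^_))

      -- Every recursion on the height of a strip has this form; solving it multiplies by `iD`, the
      -- inverse of 1 - yU.
      resolve : ∀ a z → a ≈ z + y * (U * a) → a ≈ z * iD
      resolve a z e = begin
        a                                   ≈⟨ trans (sym (*-identityʳ a)) (*-congˡ (sym inverse)) ⟩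
        a * ((1# - y * U) * iD)             ≈⟨ solve 4 (λ a y U i → a :* ((:1 :- y :* U) :* i) := (a :- y :* (U :* a)) :* i) refl a y U iD ⟩
        (a - y * (U * a)) * iD              ≈⟨ *-congʳ (+-congʳ e) ⟩
        (z + y * (U * a) - y * (U * a)) * iD ≈⟨ *-congʳ (solve 2 (λ z b → z :+ b :- b := z) refl z _) ⟩
        z * iD                              ∎

      -- `p` and `q` are bound anew because columns that stick out at the bottom need the same
      -- formula with the two exchanged.
      above-resolved : ∀ p q → (1# - U) * aboves p q U ≈
        y * (U * iD) * (gf topsDecrease p q (1# ^_) - (1# - p * (1# - U)) * gf topsDecrease p q (U ^_))
      above-resolved p q = begin
        (1# - U) * aboves p q U
          ≈⟨ *-congˡ (resolve _ (y * (U * T)) (trans (aboves-equation p q U) (solve 4 (λ y U t a → y :* (U :* (t :+ a)) := y :* (U :* t) :+ y :* (U :* a)) refl y U T (aboves p q U)))) ⟩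
        (1# - U) * (y * (U * T) * iD)
          ≈⟨ *-congˡ (*-congʳ (*-congˡ (*-congˡ T-split))) ⟩
        (1# - U) * (y * (U * (p * H + Q)) * iD)
          ≈⟨ solve 6 (λ U y p h r i → (:1 :- U) :* (y :* (U :* (p :* h :+ r)) :* i) :=
               y :* (U :* i) :* (((:1 :- U) :* r :+ h) :- (:1 :- p :* (:1 :- U)) :* h)) refl U y p H Q iD ⟩
        y * (U * iD) * (((1# - U) * Q + H) - (1# - p * (1# - U)) * H)
          ≈⟨ *-congˡ (+-congʳ (gf-quotient topsDecrease p q (1# - U) (rep-quotient U))) ⟩
        y * (U * iD) * (gf topsDecrease p q (1# ^_) - (1# - p * (1# - U)) * H) ∎
        where
        T = gf topsDecrease p q (ψ p U)
        H = gf topsDecrease p q (U ^_)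
        Q = gf topsDecrease p q (rep U)
        T-split : T ≈ p * H + Q
        T-split = trans (gf-+ topsDecrease p q (λ k → p * U ^ k) (rep U)) (+-congʳ (sym (*-gf topsDecrease p q p (U ^_))))

      remainder-resolved : (1# - U) * remainder p q U ≈ bracket
      remainder-resolved = begin
        (1# - U) * (columns U + (aboves p q U + aboves q p U + outsides p q U))
          ≈⟨ solve 5 (λ w c a b o → w :* (c :+ (a :+ b :+ o)) := w :* c :+ (w :* a :+ w :* b :+ w :* o)) refl (1# - U) _ _ _ _ ⟩
        (1# - U) * columns U + ((1# - U) * aboves p q U + (1# - U) * aboves q p U + (1# - U) * outsides p q U)
          ≈⟨ +-cong column-part (+-cong (+-cong (above-resolved p q) (above-resolved q p)) outside-part) ⟩
        bracket ∎
        where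
        column-part : (1# - U) * columns U ≈ y * ((1# - U) * iD)
        column-part = trans
          (*-congˡ (resolve (columns U) y (trans (columns-equation U) (solve 3 (λ y U a → y :* (:1 :+ U :* a) := y :+ y :* (U :* a)) refl y U _))))
          (solve 3 (λ w y i → w :* (y :* i) := y :* (w :* i)) refl (1# - U) y iD)
        outside-part : (1# - U) * outsides p q U ≈ y * y * (U * U * (1# - U) * (iD * iD)) * gf stack p q (U ^_)
        outside-part = trans
          (*-congˡ (trans (outsides-equation p q U) (*-congˡ (*-congˡ (*-congˡ (*-congˡ
            (trans (resolve _ _ (anys-equation p q U)) (*-congʳ (resolve _ _ (bottoms-equation p q U))))))))))
          (solve 5 (λ w y U i g → w :* (y :* (U :* (y :* (U :* (g :* i :* i))))) := y :* y :* (U :* U :* w :* (i :* i)) :* g)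
            refl (1# - U) y U iD (gf stack p q (U ^_)))

      -- At a root of the kernel the terms with gf (rep₂ U) cancel.
      at-root : (1# - p * q * x) * G₁ ≈ x * remainder p q U + ((1# - p * q * x) * (1# - U) + x * (p + q)) * G′
      at-root = begin
        k * G₁
          ≈⟨ *-congˡ (gf-quotient everything p q w (rep-quotient U)) ⟨
        k * (w * Q₁ + G)
          ≈⟨ *-congˡ (+-congʳ (*-congˡ Q₁≈)) ⟩
        k * (w * (G′ - w * Q₂) + G)
          ≈⟨ solve 5 (λ k w g′ q₂ g → k :* (w :* (g′ :- w :* q₂) :+ g) := k :* w :* g′ :- k :* (w :* w) :* q₂ :+ k :* g) refl k w G′ Q₂ G ⟩
        k * w * G′ - k * (w * w) * Q₂ + k * G
          ≈⟨ +-cong (+-congˡ (-‿cong (*-congʳ kernel))) kG ⟩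
        k * w * G′ - x * (1# - (p + q) * w) * Q₂ + x * (remainder p q U + ((p + q) * (G′ - w * Q₂) + Q₂))
          ≈⟨ solve 7 (λ a x s w g′ q₂ r → a :* w :* g′ :- x :* (:1 :- s :* w) :* q₂ :+ x :* (r :+ (s :* (g′ :- w :* q₂) :+ q₂))
               := x :* r :+ (a :* w :+ x :* s) :* g′) refl k x (p + q) w G′ Q₂ (remainder p q U) ⟩
        x * remainder p q U + (k * w + x * (p + q)) * G′ ∎
        where
        k = 1# - p * q * x
        w = 1# - U
        G = gf everything p q (U ^_)
        Q₁ = gf everything p q (rep U)
        Q₂ = gf everything p q (rep₂ U)
        Q₁≈ : Q₁ ≈ G′ - w * Q₂
        Q₁≈ = trans (solve 2 (λ a b → b := a :+ b :- a) refl (w * Q₂) Q₁) (+-congʳ (gf-quotient everything p q w (rep₂-quotient U)))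
        kG : k * G ≈ x * (remainder p q U + ((p + q) * (G′ - w * Q₂) + Q₂))
        kG = begin
          k * G
            ≈⟨ solve 4 (λ p q x g → (:1 :- p :* q :* x) :* g := g :- x :* (p :* q :* g)) refl p q x G ⟩
          G - x * (p * q * G)
            ≈⟨ +-congʳ (functional-equation p q U) ⟩
          x * (remainder p q U + (p * q * G + (p + q) * Q₁ + Q₂)) - x * (p * q * G)
            ≈⟨ solve 5 (λ x r g a b → x :* (r :+ (g :+ a :+ b)) :- x :* g := x :* (r :+ (a :+ b))) refl x (remainder p q U) (p * q * G) ((p + q) * Q₁) Q₂ ⟩
          x * (remainder p q U + ((p + q) * Q₁ + Q₂))
            ≈⟨ *-congˡ (+-congˡ (+-congʳ (*-congˡ Q₁≈))) ⟩
          x * (remainder p q U + ((p + q) * (G′ - w * Q₂) + Q₂)) ∎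

-- The roots of the kernel and the elimination.

module Final {c ℓ} (K : CommutativeRing c ℓ) where

  open RingTools K using (solve; _:=_; _:+_; _:*_; _:-_; :-_; :1)
  open Recurrence K using (everything; stack)
  open FunEq K

  open CommutativeRing K
  open import Algebra.Properties.Semiring.Exp semiring using (_^_)
  open import Relation.Binary.Reasoning.Setoid setoid

  -- The statement inverts products and squares of 1 - yu± as a whole, the derivation produces
  -- products of inverses; uniqueness identifies the two.
  inverse-unique : ∀ a b b′ → a * b ≈ 1# → a * b′ ≈ 1# → b ≈ b′
  inverse-unique a b b′ e e′ = begin
    b             ≈⟨ trans (sym (*-identityʳ b)) (*-congˡ (sym e′)) ⟩
    b * (a * b′)  ≈⟨ solve 3 (λ a b c → b :* (a :* c) := a :* b :* c) refl a b b′ ⟩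
    a * b * b′    ≈⟨ trans (*-congʳ e) (*-identityˡ b′) ⟩
    b′            ∎

  inverse-* : ∀ a a′ b b′ → a * b ≈ 1# → a′ * b′ ≈ 1# → (a * a′) * (b * b′) ≈ 1#
  inverse-* a a′ b b′ e e′ = begin
    (a * a′) * (b * b′)   ≈⟨ solve 4 (λ a c b d → (a :* c) :* (b :* d) := (a :* b) :* (c :* d)) refl a a′ b b′ ⟩
    (a * b) * (a′ * b′)   ≈⟨ trans (*-cong e e′) (*-identityˡ 1#) ⟩
    1#                    ∎

  -- Here `r` stands for √(1 + (p - q)² x / 4), `s` for √D = 2tr, and `i` for 1 / (2(1 - pqx)).
  -- Numerical multiples are written as repeated sums, and the defining equations are hypotheses
  -- free of division.
  module Roots (t x p q r s i : Carrier) (x≈t² : x ≈ t * t) (s≈ : s ≈ t * r + t * r)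
    (twice-inverse : ((1# - p * q * x) + (1# - p * q * x)) * i ≈ 1#)
    (root : (r * r + r * r) + (r * r + r * r) ≈ (p - q) * (p - q) * x + ((1# + 1#) + (1# + 1#))) where

    k u₊ u₋ : Carrier
    k = 1# - p * q * x
    u₊ = 1# + ((p + q) * x + s) * i
    u₋ = 1# + ((p + q) * x - s) * i

    discriminant : s * s ≈ (p - q) * (p - q) * (x * x) + ((x + x) + (x + x))
    discriminant = begin
      s * s
        ≈⟨ *-cong s≈ s≈ ⟩
      (t * r + t * r) * (t * r + t * r)
        ≈⟨ solve 2 (λ t r → (t :* r :+ t :* r) :* (t :* r :+ t :* r) := (t :* t) :* ((r :* r :+ r :* r) :+ (r :* r :+ r :* r))) refl t r ⟩
      (t * t) * ((r * r + r * r) + (r * r + r * r))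
        ≈⟨ *-cong (sym x≈t²) root ⟩
      x * ((p - q) * (p - q) * x + ((1# + 1#) + (1# + 1#)))
        ≈⟨ solve 3 (λ x p q → x :* ((p :- q) :* (p :- q) :* x :+ ((:1 :+ :1) :+ (:1 :+ :1)))
             := (p :- q) :* (p :- q) :* (x :* x) :+ ((x :+ x) :+ (x :+ x))) refl x p q ⟩
      (p - q) * (p - q) * (x * x) + ((x + x) + (x + x)) ∎

    -- Only s² enters, so a single computation serves `s` and `- s`.
    kernel-for : ∀ s → s * s ≈ (p - q) * (p - q) * (x * x) + ((x + x) + (x + x)) →
      let w = 1# - (1# + ((p + q) * x + s) * i) in k * (w * w) ≈ x * (1# - (p + q) * w)
    kernel-for s s² = begin
      k * (w * w)
        ≈⟨ solve 5 (λ k a x s i → k :* ((:1 :- (:1 :+ (a :* x :+ s) :* i)) :* (:1 :- (:1 :+ (a :* x :+ s) :* i)))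
             := k :* (i :* i) :* ((a :* x :+ s) :* (a :* x) :+ a :* x :* s) :+ k :* (i :* i) :* (s :* s)) refl k (p + q) x s i ⟩
      k * (i * i) * (((p + q) * x + s) * ((p + q) * x) + (p + q) * x * s) + k * (i * i) * (s * s)
        ≈⟨ +-congˡ (*-congˡ s²) ⟩
      k * (i * i) * (((p + q) * x + s) * ((p + q) * x) + (p + q) * x * s) + k * (i * i) * ((p - q) * (p - q) * (x * x) + ((x + x) + (x + x)))
        -- Since (p - q)² x² + 4x = (p + q)² x² + 4xk, every term contains a factor (k + k) i, which
        -- is 1.
        ≈⟨ solve 5 (λ p q x s i → let k = :1 :- p :* q :* x in
             k :* (i :* i) :* (((p :+ q) :* x :+ s) :* ((p :+ q) :* x) :+ (p :+ q) :* x :* s) :+ k :* (i :* i) :* ((p :- q) :* (p :- q) :* (x :* x) :+ ((x :+ x) :+ (x :+ x)))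
             := ((k :+ k) :* i) :* (x :* ((p :+ q) :* (((p :+ q) :* x :+ s) :* i))) :+ ((k :+ k) :* i) :* ((k :+ k) :* i) :* x) refl p q x s i ⟩
      ((k + k) * i) * (x * ((p + q) * (((p + q) * x + s) * i))) + ((k + k) * i) * ((k + k) * i) * x
        ≈⟨ +-cong (*-congʳ twice-inverse) (*-congʳ (*-cong twice-inverse twice-inverse)) ⟩
      1# * (x * ((p + q) * (((p + q) * x + s) * i))) + 1# * 1# * x
        ≈⟨ solve 3 (λ x a n → :1 :* (x :* (a :* n)) :+ :1 :* :1 :* x := x :* (:1 :- a :* (:1 :- (:1 :+ n)))) refl x (p + q) (((p + q) * x + s) * i) ⟩
      x * (1# - (p + q) * w) ∎
      where
      w = 1# - (1# + ((p + q) * x + s) * i)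

    kernel₊ : k * ((1# - u₊) * (1# - u₊)) ≈ x * (1# - (p + q) * (1# - u₊))
    kernel₊ = kernel-for s discriminant

    kernel₋ : k * ((1# - u₋) * (1# - u₋)) ≈ x * (1# - (p + q) * (1# - u₋))
    kernel₋ = kernel-for (- s) (trans (solve 1 (λ s → (:- s) :* (:- s) := s :* s) refl s) discriminant)

    -- Vieta for k w² + x (p + q) w - x = 0 with w = 1 - u. The left side is the coefficient of
    -- G'(1) at the root u₊.
    sum-of-roots : k * (1# - u₊) + x * (p + q) ≈ - (k * (1# - u₋))
    sum-of-roots = begin
      k * (1# - u₊) + x * (p + q)
        ≈⟨ solve 5 (λ k a x s i → k :* (:1 :- (:1 :+ (a :* x :+ s) :* i)) :+ x :* a
             := x :* a :* (:1 :- (k :+ k) :* i) :- k :* (:1 :- (:1 :+ (a :* x :- s) :* i))) refl k (p + q) x s i ⟩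
      x * (p + q) * (1# - (k + k) * i) - k * (1# - u₋)
        ≈⟨ +-congʳ (*-congˡ (+-congˡ (-‿cong twice-inverse))) ⟩
      x * (p + q) * (1# - 1#) - k * (1# - u₋)
        ≈⟨ solve 2 (λ a b → a :* (:1 :- :1) :- b := :- b) refl (x * (p + q)) (k * (1# - u₋)) ⟩
      - (k * (1# - u₋)) ∎

    -- Vieta again: w₊ w₋ = -x / k, where `i + i` is the inverse of k.
    product-of-roots : (1# - u₊) * (1# - u₋) ≈ - (x * (i + i))
    product-of-roots = begin
      (1# - u₊) * (1# - u₋)
        ≈⟨ solve 4 (λ a x s i → (:1 :- (:1 :+ (a :* x :+ s) :* i)) :* (:1 :- (:1 :+ (a :* x :- s) :* i))
             := (i :* i) :* ((a :* x) :* (a :* x) :- s :* s)) refl (p + q) x s i ⟩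
      (i * i) * (((p + q) * x) * ((p + q) * x) - s * s)
        ≈⟨ *-congˡ (+-congˡ (-‿cong discriminant)) ⟩
      (i * i) * (((p + q) * x) * ((p + q) * x) - ((p - q) * (p - q) * (x * x) + ((x + x) + (x + x))))
        ≈⟨ solve 4 (λ p q x i → let k = :1 :- p :* q :* x in
             (i :* i) :* (((p :+ q) :* x) :* ((p :+ q) :* x) :- ((p :- q) :* (p :- q) :* (x :* x) :+ ((x :+ x) :+ (x :+ x))))
             := :- (((k :+ k) :* i) :* (x :* (i :+ i)))) refl p q x i ⟩
      - (((k + k) * i) * (x * (i + i)))
        ≈⟨ -‿cong (trans (*-congʳ twice-inverse) (*-identityˡ _)) ⟩
      - (x * (i + i)) ∎

    -- The terms without `s` cancel, and s = 2tr contributes the factor t. The cofactor has constant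
    -- term 2, which makes the reciprocal of u₊ - u₋ a Laurent series with a simple pole.
    difference-of-roots : u₊ - u₋ ≈ t * (((r + r) + (r + r)) * i)
    difference-of-roots = begin
      u₊ - u₋
        ≈⟨ solve 3 (λ a s i → (:1 :+ (a :+ s) :* i) :- (:1 :+ (a :- s) :* i) := (s :+ s) :* i) refl ((p + q) * x) s i ⟩
      (s + s) * i
        ≈⟨ *-congʳ (+-cong s≈ s≈) ⟩
      ((t * r + t * r) + (t * r + t * r)) * i
        ≈⟨ solve 3 (λ t r i → ((t :* r :+ t :* r) :+ (t :* r :+ t :* r)) :* i := t :* (((r :+ r) :+ (r :+ r)) :* i)) refl t r i ⟩
      t * (((r + r) + (r + r)) * i) ∎

  module Solve (N : ℕ) (t x y p q r s i : Carrier) (x≈t² : x ≈ t * t) (s≈ : s ≈ t * r + t * r)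
    (x-nil : x ^ suc N ≈ 0#) (y-nil : y ^ suc N ≈ 0#)
    (twice-inverse : ((1# - p * q * x) + (1# - p * q * x)) * i ≈ 1#)
    (root : (r * r + r * r) + (r * r + r * r) ≈ (p - q) * (p - q) * x + ((1# + 1#) + (1# + 1#))) where

    open Roots t x p q r s i x≈t² s≈ twice-inverse root
    open Truncated N x y x-nil y-nil

    module _ (i₊ i₋ : Carrier) (inv₊ : (1# - y * u₊) * i₊ ≈ 1#) (inv₋ : (1# - y * u₋) * i₋ ≈ 1#) where

      module R₊ = Root p q u₊ i₊ kernel₊ inv₊
      module R₋ = Root p q u₋ i₋ kernel₋ inv₋

      private
        F A w₊ w₋ : Carrier
        F = ((r + r) + (r + r)) * i
        A = (1# - u₊) * (1# - u₋)
        w₊ = 1# - u₊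
        w₋ = 1# - u₋

      -- By the sum of the roots the coefficient of G'(1) is -k w₋ at u₊ and -k w₊ at u₋. Weighting
      -- the two equations with w₊ and w₋ makes both coefficients equal to -k w₊ w₋, and they cancel
      -- in the difference.
      eliminated : k * ((w₊ - w₋) * R₊.G₁) ≈ x * (R₊.bracket - R₋.bracket)
      eliminated = begin
        k * ((w₊ - w₋) * R₊.G₁)
          ≈⟨ solve 4 (λ k a b g → k :* ((a :- b) :* g) := a :* (k :* g) :- b :* (k :* g)) refl k w₊ w₋ R₊.G₁ ⟩
        w₊ * (k * R₊.G₁) - w₋ * (k * R₊.G₁)
          ≈⟨ +-cong (*-congˡ (trans R₊.at-root (+-congˡ (*-congʳ sum-of-roots))))
               (-‿cong (*-congˡ (trans R₋.at-root (+-congˡ (*-congʳ sum-of-roots′))))) ⟩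
        w₊ * (x * remainder p q u₊ + - (k * w₋) * R₊.G′) - w₋ * (x * remainder p q u₋ + - (k * w₊) * R₊.G′)
          ≈⟨ solve 7 (λ a b x m n k g → a :* (x :* m :+ (:- (k :* b)) :* g) :- b :* (x :* n :+ (:- (k :* a)) :* g)
               := x :* (a :* m :- b :* n)) refl w₊ w₋ x (remainder p q u₊) (remainder p q u₋) k R₊.G′ ⟩
        x * (w₊ * remainder p q u₊ - w₋ * remainder p q u₋)
          ≈⟨ *-congˡ (+-cong R₊.remainder-resolved (-‿cong R₋.remainder-resolved)) ⟩
        x * (R₊.bracket - R₋.bracket) ∎
        where
        sum-of-roots′ : k * w₋ + x * (p + q) ≈ - (k * w₊)
        sum-of-roots′ = begin
          k * w₋ + x * (p + q)
            ≈⟨ solve 3 (λ a b c → a :+ c := (b :+ c) :- (b :- a)) refl (k * w₋) (k * w₊) (x * (p + q)) ⟩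
          (k * w₊ + x * (p + q)) - (k * w₊ - k * w₋)
            ≈⟨ +-congʳ sum-of-roots ⟩
          - (k * w₋) - (k * w₊ - k * w₋)
            ≈⟨ solve 2 (λ a b → :- a :- (b :- a) := :- b) refl (k * w₋) (k * w₊) ⟩
          - (k * w₊) ∎

      -- Here `η` plays the part of t / (u₊ - u₋). Multiplying by `i + i`, the inverse of k, and by
      -- `η` isolates t G(1), and the remaining x combines with `i + i` to the product of the roots.
      isolated : ∀ η → F * η ≈ 1# → t * R₊.G₁ ≈ A * η * (R₊.bracket - R₋.bracket)
      isolated η Fη = begin
        t * G
          ≈⟨ solve 2 (λ t g → t :* g := :1 :* :1 :* (t :* g)) refl t G ⟩
        1# * 1# * (t * G)
          ≈⟨ *-congʳ (*-cong twice-inverse Fη) ⟨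
        ((k + k) * i) * (F * η) * (t * G)
          ≈⟨ solve 6 (λ k i f η t g → ((k :+ k) :* i) :* (f :* η) :* (t :* g) := (i :+ i) :* η :* (k :* ((t :* f) :* g))) refl k i F η t G ⟩
        (i + i) * η * (k * ((t * F) * G))
          ≈⟨ *-congˡ (*-congˡ (*-congʳ (sym difference-of-roots))) ⟩
        (i + i) * η * (k * ((u₊ - u₋) * G))
          ≈⟨ solve 6 (λ i η k a b g → (i :+ i) :* η :* (k :* ((a :- b) :* g)) :=
               :- ((i :+ i) :* η :* (k :* (((:1 :- a) :- (:1 :- b)) :* g)))) refl i η k u₊ u₋ G ⟩
        - ((i + i) * η * (k * ((w₊ - w₋) * G)))
          ≈⟨ -‿cong (*-congˡ eliminated) ⟩
        - ((i + i) * η * (x * (R₊.bracket - R₋.bracket)))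
          ≈⟨ solve 4 (λ i η x b → :- ((i :+ i) :* η :* (x :* b)) := (:- (x :* (i :+ i))) :* η :* b) refl i η x _ ⟩
        - (x * (i + i)) * η * (R₊.bracket - R₋.bracket)
          ≈⟨ *-congʳ (*-congʳ product-of-roots) ⟨
        A * η * (R₊.bracket - R₋.bracket) ∎
        where
        G = R₊.G₁

      -- Over the common denominator (1 - yu₊)(1 - yu₋) the numerators differ by a multiple of u₊ -
      -- u₋. This cancels the reciprocal in front, which is why the first and the last term of the
      -- formula contain no division by u₊ - u₋; `split₂` does the same for the last.
      split₁ : w₊ * i₊ - w₋ * i₋ ≈ (y - 1#) * (u₊ - u₋) * (i₊ * i₋)
      split₁ = begin
        w₊ * i₊ - w₋ * i₋
          ≈⟨ solve 2 (λ a b → a :- b := a :* :1 :- b :* :1) refl (w₊ * i₊) (w₋ * i₋) ⟩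
        w₊ * i₊ * 1# - w₋ * i₋ * 1#
          ≈⟨ +-cong (*-congˡ inv₋) (-‿cong (*-congˡ inv₊)) ⟨
        w₊ * i₊ * ((1# - y * u₋) * i₋) - w₋ * i₋ * ((1# - y * u₊) * i₊)
          ≈⟨ solve 5 (λ u v y i j → (:1 :- u) :* i :* ((:1 :- y :* v) :* j) :- (:1 :- v) :* j :* ((:1 :- y :* u) :* i)
               := (y :- :1) :* (u :- v) :* (i :* j)) refl u₊ u₋ y i₊ i₋ ⟩
        (y - 1#) * (u₊ - u₋) * (i₊ * i₋) ∎

      split₂ : u₊ * i₊ - u₋ * i₋ ≈ (u₊ - u₋) * (i₊ * i₋)
      split₂ = begin
        u₊ * i₊ - u₋ * i₋
          ≈⟨ solve 2 (λ a b → a :- b := a :* :1 :- b :* :1) refl (u₊ * i₊) (u₋ * i₋) ⟩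
        u₊ * i₊ * 1# - u₋ * i₋ * 1#
          ≈⟨ +-cong (*-congˡ inv₋) (-‿cong (*-congˡ inv₊)) ⟨
        u₊ * i₊ * ((1# - y * u₋) * i₋) - u₋ * i₋ * ((1# - y * u₊) * i₊)
          ≈⟨ solve 5 (λ u v y i j → u :* i :* ((:1 :- y :* v) :* j) :- v :* j :* ((:1 :- y :* u) :* i)
               := (u :- v) :* (i :* j)) refl u₊ u₋ y i₊ i₋ ⟩
        (u₊ - u₋) * (i₊ * i₋) ∎

      module _ (η : Carrier) (Fη : F * η ≈ 1#) where

        private
          T₁ T₁ˢ T₊ T₊ˢ T₋ T₋ˢ B₊ B₋ : Carrier
          T₁  = gf topsDecrease p q (1# ^_)
          T₁ˢ = gf topsDecrease q p (1# ^_)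
          T₊  = gf topsDecrease p q (u₊ ^_)
          T₊ˢ = gf topsDecrease q p (u₊ ^_)
          T₋  = gf topsDecrease p q (u₋ ^_)
          T₋ˢ = gf topsDecrease q p (u₋ ^_)
          B₊  = gf stack p q (u₊ ^_)
          B₋  = gf stack p q (u₋ ^_)

          η-difference : η * (u₊ - u₋) ≈ t
          η-difference = trans (*-congˡ difference-of-roots)
            (trans (solve 3 (λ η t f → η :* (t :* f) := t :* (f :* η)) refl η t F) (trans (*-congˡ Fη) (*-identityʳ t)))

        solution : t * gf everything p q (1# ^_) ≈
          t * (y * (y - 1#) * A * (i₊ * i₋))
          + y * y * A * η * (u₊ * u₊ * w₊ * B₊ * (i₊ * i₊) - u₋ * u₋ * w₋ * B₋ * (i₋ * i₋))
          - y * u₊ * A * η * (i₊ * ((1# - p * w₊) * T₊ + (1# - q * w₊) * T₊ˢ))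
          + y * u₋ * A * η * (i₋ * ((1# - p * w₋) * T₋ + (1# - q * w₋) * T₋ˢ))
          + t * (y * A * (i₊ * i₋) * (T₁ + T₁ˢ))
        solution = begin
          t * gf everything p q (1# ^_)
            ≈⟨ isolated η Fη ⟩
          A * η * (R₊.bracket - R₋.bracket)
            ≈⟨ *-congˡ (+-cong (separate u₊ w₊ i₊ ((1# - p * w₊) * T₊) ((1# - q * w₊) * T₊ˢ) B₊)
                 (-‿cong (separate u₋ w₋ i₋ ((1# - p * w₋) * T₋) ((1# - q * w₋) * T₋ˢ) B₋))) ⟩
          A * η * ((y * (w₊ * i₊) + y * (u₊ * i₊) * (T₁ + T₁ˢ) - y * u₊ * (i₊ * H₊) + y * y * (u₊ * u₊ * w₊ * B₊ * (i₊ * i₊)))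
                 - (y * (w₋ * i₋) + y * (u₋ * i₋) * (T₁ + T₁ˢ) - y * u₋ * (i₋ * H₋) + y * y * (u₋ * u₋ * w₋ * B₋ * (i₋ * i₋))))
            ≈⟨ collect (w₊ * i₊) (w₋ * i₋) (u₊ * i₊) (u₋ * i₋) (T₁ + T₁ˢ) (i₊ * H₊) (i₋ * H₋) (u₊ * u₊ * w₊ * B₊ * (i₊ * i₊)) (u₋ * u₋ * w₋ * B₋ * (i₋ * i₋)) u₊ u₋ A ⟩
          A * η * y * (w₊ * i₊ - w₋ * i₋) + M₂ - M₃ + M₄ + A * η * y * (u₊ * i₊ - u₋ * i₋) * (T₁ + T₁ˢ)
            ≈⟨ +-cong (+-congʳ (+-congʳ (+-congʳ first))) last ⟩
          t * (y * (y - 1#) * A * (i₊ * i₋)) + M₂ - M₃ + M₄ + t * (y * A * (i₊ * i₋) * (T₁ + T₁ˢ)) ∎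
          where
          H₊ H₋ M₂ M₃ M₄ : Carrier
          H₊ = (1# - p * w₊) * T₊ + (1# - q * w₊) * T₊ˢ
          H₋ = (1# - p * w₋) * T₋ + (1# - q * w₋) * T₋ˢ
          M₂ = y * y * A * η * (u₊ * u₊ * w₊ * B₊ * (i₊ * i₊) - u₋ * u₋ * w₋ * B₋ * (i₋ * i₋))
          M₃ = y * u₊ * A * η * (i₊ * H₊)
          M₄ = y * u₋ * A * η * (i₋ * H₋)
          separate : ∀ u w i a b g →
            y * (w * i) + (y * (u * i) * (T₁ - a) + y * (u * i) * (T₁ˢ - b) + y * y * (u * u * w * (i * i)) * g) ≈
            y * (w * i) + y * (u * i) * (T₁ + T₁ˢ) - y * u * (i * (a + b)) + y * y * (u * u * w * g * (i * i))
          separate u w i a b g = solve 9 (λ y u w i a b g s t →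
            y :* (w :* i) :+ (y :* (u :* i) :* (s :- a) :+ y :* (u :* i) :* (t :- b) :+ y :* y :* (u :* u :* w :* (i :* i)) :* g) :=
            y :* (w :* i) :+ y :* (u :* i) :* (s :+ t) :- y :* u :* (i :* (a :+ b)) :+ y :* y :* (u :* u :* w :* g :* (i :* i))) refl y u w i a b g T₁ T₁ˢ
          collect : ∀ a a′ b b′ s h h′ g g′ u u′ A →
            A * η * ((y * a + y * b * s - y * u * h + y * y * g) - (y * a′ + y * b′ * s - y * u′ * h′ + y * y * g′)) ≈
            A * η * y * (a - a′) + y * y * A * η * (g - g′) - y * u * A * η * h + y * u′ * A * η * h′ + A * η * y * (b - b′) * s
          collect a a′ b b′ s h h′ g g′ u u′ A = solve 14 (λ η y a a′ b b′ s h h′ g g′ u u′ A →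
            A :* η :* ((y :* a :+ y :* b :* s :- y :* u :* h :+ y :* y :* g) :- (y :* a′ :+ y :* b′ :* s :- y :* u′ :* h′ :+ y :* y :* g′)) :=
            A :* η :* y :* (a :- a′) :+ y :* y :* A :* η :* (g :- g′) :- y :* u :* A :* η :* h :+ y :* u′ :* A :* η :* h′ :+ A :* η :* y :* (b :- b′) :* s)
            refl η y a a′ b b′ s h h′ g g′ u u′ A
          first : A * η * y * (w₊ * i₊ - w₋ * i₋) ≈ t * (y * (y - 1#) * A * (i₊ * i₋))
          first = trans (*-congˡ split₁)
            (trans (solve 5 (λ A η y d j → A :* η :* y :* ((y :- :1) :* d :* j) := (η :* d) :* (y :* (y :- :1) :* A :* j)) refl A η y (u₊ - u₋) (i₊ * i₋))
            (*-congʳ η-difference))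
          last : A * η * y * (u₊ * i₊ - u₋ * i₋) * (T₁ + T₁ˢ) ≈ t * (y * A * (i₊ * i₋) * (T₁ + T₁ˢ))
          last = trans (*-congʳ (*-congˡ split₂))
            (trans (solve 6 (λ A η y d j s → A :* η :* y :* (d :* j) :* s := (η :* d) :* (y :* A :* j :* s)) refl A η y (u₊ - u₋) (i₊ * i₋) (T₁ + T₁ˢ))
            (*-congʳ η-difference))

      -- The shape in which the Laurent series arithmetic of the statement leaves both sides.
      assembled : ∀ η i₊₋ i₊² i₋² g b₊ b₋ t₊ t₊ˢ t₋ t₋ˢ t₁ t₁ˢ →
        (((r + r) + (r + r)) * i) * η ≈ 1# →
        ((1# - y * u₊) * (1# - y * u₋)) * i₊₋ ≈ 1# →
        ((1# - y * u₊) * ((1# - y * u₊) * 1#)) * i₊² ≈ 1# →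
        ((1# - y * u₋) * ((1# - y * u₋) * 1#)) * i₋² ≈ 1# →
        g ≈ gf everything p q (1# ^_) →
        b₊ ≈ gf stack p q (u₊ ^_) → b₋ ≈ gf stack p q (u₋ ^_) →
        t₊ ≈ gf topsDecrease p q (u₊ ^_) → t₊ˢ ≈ gf topsDecrease q p (u₊ ^_) →
        t₋ ≈ gf topsDecrease p q (u₋ ^_) → t₋ˢ ≈ gf topsDecrease q p (u₋ ^_) →
        t₁ ≈ gf topsDecrease p q (1# ^_) → t₁ˢ ≈ gf topsDecrease q p (1# ^_) →
        let A = (1# - u₊) * (1# - u₋)
            term₁ = y * (y - 1#) * A * i₊₋
            term₂ = y * (y * 1#) * A * η * (u₊ * (u₊ * 1#) * (1# - u₊) * b₊ * i₊² - u₋ * (u₋ * 1#) * (1# - u₋) * b₋ * i₋²)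
            term₃ = y * u₊ * A * η * (i₊ * ((1# - p * (1# - u₊)) * t₊ + (1# - q * (1# - u₊)) * t₊ˢ))
            term₄ = y * u₋ * A * η * (i₋ * ((1# - p * (1# - u₋)) * t₋ + (1# - q * (1# - u₋)) * t₋ˢ))
            term₅ = y * A * i₊₋ * (t₁ + t₁ˢ)
        in t * (t * (t * 1#)) * g ≈
           1# * (1# * (t * 1# * (t * 1# * (t * 1# * term₁ + 1# * term₂) - t * 1# * term₃) + t * (t * 1#) * term₄) + t * (t * (t * 1#)) * term₅)
      assembled η i₊₋ i₊² i₋² g b₊ b₋ t₊ t₊ˢ t₋ t₋ˢ t₁ t₁ˢ Fη e₊₋ e₊² e₋² g≈ b₊≈ b₋≈ t₊≈ t₊ˢ≈ t₋≈ t₋ˢ≈ t₁≈ t₁ˢ≈ = begin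
        t * (t * (t * 1#)) * g
          ≈⟨ solve 2 (λ t g → t :* (t :* (t :* :1)) :* g := t :* t :* (t :* g)) refl t g ⟩
        t * t * (t * g)
          ≈⟨ *-congˡ (trans (*-congˡ g≈) (solution η Fη)) ⟩
        t * t * (t * (y * (y - 1#) * A * (i₊ * i₋))
          + y * y * A * η * (u₊ * u₊ * w₊ * B₊ * (i₊ * i₊) - u₋ * u₋ * w₋ * B₋ * (i₋ * i₋))
          - y * u₊ * A * η * (i₊ * ((1# - p * w₊) * T₊ + (1# - q * w₊) * T₊ˢ))
          + y * u₋ * A * η * (i₋ * ((1# - p * w₋) * T₋ + (1# - q * w₋) * T₋ˢ))
          + t * (y * A * (i₊ * i₋) * (T₁ + T₁ˢ)))
          ≈⟨ *-congˡ (+-cong (+-cong (+-cong (+-cong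
               (*-congˡ (*-congˡ (inverse-unique _ _ _ (inverse-* _ _ _ _ inv₊ inv₋) e₊₋)))
               (*-congˡ (+-cong (square u₊ w₊ i₊ B₊ b₊ i₊² b₊≈ inv₊ e₊²) (-‿cong (square u₋ w₋ i₋ B₋ b₋ i₋² b₋≈ inv₋ e₋²)))))
               (-‿cong (*-congˡ (*-congˡ (+-cong (*-congˡ (sym t₊≈)) (*-congˡ (sym t₊ˢ≈)))))))
               (*-congˡ (*-congˡ (+-cong (*-congˡ (sym t₋≈)) (*-congˡ (sym t₋ˢ≈))))))
               (*-congˡ (*-cong (*-congˡ (inverse-unique _ _ _ (inverse-* _ _ _ _ inv₊ inv₋) e₊₋)) (+-cong (sym t₁≈) (sym t₁ˢ≈))))) ⟩
        t * t * (t * term₁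
          + y * y * A * η * (u₊ * (u₊ * 1#) * w₊ * b₊ * i₊² - u₋ * (u₋ * 1#) * w₋ * b₋ * i₋²)
          - term₃ + term₄ + t * term₅)
          ≈⟨ solve 9 (λ t y A η d a c e f →
               t :* t :* (t :* a :+ y :* y :* A :* η :* d :- c :+ e :+ t :* f) :=
               :1 :* (:1 :* (t :* :1 :* (t :* :1 :* (t :* :1 :* a :+ :1 :* (y :* (y :* :1) :* A :* η :* d)) :- t :* :1 :* c) :+ t :* (t :* :1) :* e) :+ t :* (t :* (t :* :1)) :* f))
               refl t y A η (u₊ * (u₊ * 1#) * w₊ * b₊ * i₊² - u₋ * (u₋ * 1#) * w₋ * b₋ * i₋²) term₁ term₃ term₄ term₅ ⟩
        1# * (1# * (t * 1# * (t * 1# * (t * 1# * term₁ + 1# * term₂) - t * 1# * term₃) + t * (t * 1#) * term₄) + t * (t * (t * 1#)) * term₅) ∎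
        where
        T₁  = gf topsDecrease p q (1# ^_)
        T₁ˢ = gf topsDecrease q p (1# ^_)
        T₊  = gf topsDecrease p q (u₊ ^_)
        T₊ˢ = gf topsDecrease q p (u₊ ^_)
        T₋  = gf topsDecrease p q (u₋ ^_)
        T₋ˢ = gf topsDecrease q p (u₋ ^_)
        B₊  = gf stack p q (u₊ ^_)
        B₋  = gf stack p q (u₋ ^_)
        term₁ = y * (y - 1#) * A * i₊₋
        term₂ = y * (y * 1#) * A * η * (u₊ * (u₊ * 1#) * (1# - u₊) * b₊ * i₊² - u₋ * (u₋ * 1#) * (1# - u₋) * b₋ * i₋²)
        term₃ = y * u₊ * A * η * (i₊ * ((1# - p * (1# - u₊)) * t₊ + (1# - q * (1# - u₊)) * t₊ˢ))
        term₄ = y * u₋ * A * η * (i₋ * ((1# - p * (1# - u₋)) * t₋ + (1# - q * (1# - u₋)) * t₋ˢ))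
        term₅ = y * A * i₊₋ * (t₁ + t₁ˢ)
        square : ∀ u w j B b j² → b ≈ B → (1# - y * u) * j ≈ 1# → ((1# - y * u) * ((1# - y * u) * 1#)) * j² ≈ 1# →
                 u * u * w * B * (j * j) ≈ u * (u * 1#) * w * b * j²
        square u w j B b j² b≈ e e² = *-cong (*-cong (*-congʳ (*-congˡ (sym (*-identityʳ u)))) (sym b≈))
          (inverse-unique _ _ _ (trans (*-congʳ (*-congˡ (*-identityʳ _))) (inverse-* _ _ _ _ e e)) e²)

-- From enumerated lists of polyominoes to nested sums.

module ListSums {c ℓ} (K : CommutativeRing c ℓ) where

  open RingTools K using (solve; _:=_; _:*_; :1)
  open Sums K
  open ColSums K
  open Recurrence K hiding (above)

  open CommutativeRing K
  open import Algebra.Properties.Semiring.Exp semiring using (_^_)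
  open import Relation.Binary.Reasoning.Setoid setoid

  private
    variable
      A B : Set

  listSum : (A → Carrier) → List A → Carrier
  listSum f l = foldr _+_ 0# (map f l)

  listSum-++ : ∀ (f : A → Carrier) l m → listSum f (l ++ m) ≈ listSum f l + listSum f m
  listSum-++ f []      m = sym (+-identityˡ _)
  listSum-++ f (a ∷ l) m = trans (+-congˡ (listSum-++ f l m)) (sym (+-assoc _ _ _))

  listSum-concatMap : ∀ (f : B → Carrier) (g : A → List B) l → listSum f (concatMap g l) ≈ listSum (λ a → listSum f (g a)) l
  listSum-concatMap f g []      = refl
  listSum-concatMap f g (a ∷ l) = trans (listSum-++ f (g a) (concatMap g l)) (+-congˡ (listSum-concatMap f g l))

  listSum-map : ∀ (f : B → Carrier) (g : A → B) l → listSum f (map g l) ≈ listSum (λ a → f (g a)) l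
  listSum-map f g []      = refl
  listSum-map f g (a ∷ l) = +-congˡ (listSum-map f g l)

  listSum-filter : ∀ (f : A → Carrier) P l → listSum f (filterᵇ P l) ≈ listSum (λ a → when (P a) (f a)) l
  listSum-filter f P []      = refl
  listSum-filter f P (a ∷ l) with P a
  ... | true  = +-congˡ (listSum-filter f P l)
  ... | false = trans (listSum-filter f P l) (sym (+-identityˡ _))

  listSum-applyUpTo : ∀ (f : A → Carrier) g n → listSum f (applyUpTo g (suc n)) ≈ ∑ n (λ i → f (g i))
  listSum-applyUpTo f g zero    = +-identityʳ _
  listSum-applyUpTo f g (suc n) = trans (+-congˡ (listSum-applyUpTo f (λ i → g (suc i)) n)) (sym (∑-first n (λ i → f (g i))))

  listSum-colsUpTo : ∀ n (f : Col → Carrier) → listSum f (colsUpTo n) ≈ ∑col n f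
  listSum-colsUpTo n f = trans (listSum-concatMap f above (applyUpTo (λ b → b) (suc n)))
    (trans (listSum-applyUpTo (λ b → listSum f (above b)) (λ b → b) n) (∑-cong′ n λ b →
    trans (listSum-concatMap f (λ u → if b <b u then (b , u) ∷ [] else []) (applyUpTo (λ u → u) (suc n)))
    (trans (listSum-applyUpTo (λ u → listSum f (if b <b u then (b , u) ∷ [] else [])) (λ u → u) n) (∑-cong′ n λ u → one (b <b u) (b , u)))))
    where
    above : ℕ → List Col
    above b = concatMap (λ u → if b <b u then (b , u) ∷ [] else []) (applyUpTo (λ u → u) (suc n))
    one : ∀ t c → listSum f (if t then c ∷ [] else []) ≈ when t (f c)
    one true  c = +-identityʳ _
    one false c = refl

  listSum-colLists : ∀ m n (f : List Col → Carrier) → listSum f (colLists m n) ≈ ∑L m n f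
  listSum-colLists zero    n f = +-identityʳ _
  listSum-colLists (suc m) n f = trans (listSum-concatMap f (λ c → map (c ∷_) (colLists m n)) (colsUpTo n))
    (trans (listSum-colsUpTo n _) (∑col-cong n λ c _ →
      trans (listSum-map f (c ∷_) (colLists m n)) (listSum-colLists m n (λ cs → f (c ∷ cs)))))

  convex≡conv : ∀ n cs → Valid n cs → hasBottom0 cs ∧ hasTop n cs ∧ connected cs ∧ rowConvex n cs ≡ conv n cs
  convex≡conv n cs val = cong (λ t → hasBottom0 cs ∧ hasTop n cs ∧ t) (connected∧rowConvex≡good n cs val)

  listSum-convexPolys : ∀ m n (S S′ : List Col → Bool) → (∀ cs → S cs ≡ S′ cs) → (f : List Col → Carrier) →
    listSum f (filterᵇ S (convexPolys m n)) ≈ ∑L m n (λ cs → when (conv n cs ∧ S′ cs) (f cs))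
  listSum-convexPolys m n S S′ S≡S′ f = begin
    listSum f (filterᵇ S (convexPolys m n))
      ≈⟨ listSum-filter f S (convexPolys m n) ⟩
    listSum (λ cs → when (S cs) (f cs)) (convexPolys m n)
      ≈⟨ listSum-filter (λ cs → when (S cs) (f cs)) convex (colLists m n) ⟩
    listSum (λ cs → when (convex cs) (when (S cs) (f cs))) (colLists m n)
      ≈⟨ listSum-colLists m n (λ cs → when (convex cs) (when (S cs) (f cs))) ⟩
    ∑L m n (λ cs → when (convex cs) (when (S cs) (f cs)))
      ≈⟨ ∑L-cong m n (λ cs val → reflexive (≡.trans (cong₂ (λ s t → when s (when t (f cs))) (convex≡conv n cs val) (S≡S′ cs))
           (≡.sym (when-∧ (conv n cs) (S′ cs) (f cs))))) ⟩
    ∑L m n (λ cs → when (conv n cs ∧ S′ cs) (f cs)) ∎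
    where
    convex : List Col → Bool
    convex cs = hasBottom0 cs ∧ hasTop n cs ∧ connected cs ∧ rowConvex n cs

  coefficient : ∀ S S′ → (∀ cs → S cs ≡ S′ cs) → ∀ p q U z v n (f : List Col → Carrier) →
    (∀ cs → f cs ≈ z * (mass p q cs * U ^ gap cs)) →
    listSum f (filterᵇ S (convexPolys v n)) ≈ z * polySum S′ p q (U ^_) v n
  coefficient S S′ S≡S′ p q U z v n f e = trans (listSum-convexPolys v n S S′ S≡S′ f)
    (trans (∑L-cong v n (λ cs _ → trans (when-cong (conv n cs ∧ S′ cs) (λ _ → e cs)) (sym (*-when (conv n cs ∧ S′ cs) z _))))
      (sym (*-∑L v n z (polyTerm S′ p q (U ^_) n))))

  module Monomials (t x y p q : Carrier) (x≈t² : x ≈ t * t) (M : ℕ → ℕ → ℕ → ℕ → Carrier)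
    (M-1 : M 0 0 0 0 ≈ 1#)
    (M-t : ∀ a b c d → M (suc a) b c d ≈ t * M a b c d)
    (M-y : ∀ a b c d → M a (suc b) c d ≈ y * M a b c d)
    (M-p : ∀ a b c d → M a b (suc c) d ≈ p * M a b c d)
    (M-q : ∀ a b c d → M a b c (suc d) ≈ q * M a b c d) where

    -- The five laws assumed of `M` are those of monomials with coefficient 1. The exponent of t is
    -- 2v, so each step in v takes out t twice and turns t² into x.
    monomial : ∀ v h j k → M (2 ℕ.* v) h j k ≈ x ^ v * y ^ h * (p ^ j * q ^ k)
    monomial zero zero zero zero = trans M-1 (solve 0 (:1 := :1 :* :1 :* (:1 :* :1)) refl)
    monomial zero zero zero (suc k) = trans (M-q 0 0 0 k) (trans (*-congˡ (monomial 0 0 0 k))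
      (solve 2 (λ q z → q :* (:1 :* :1 :* (:1 :* z)) := :1 :* :1 :* (:1 :* (q :* z))) refl q (q ^ k)))
    monomial zero zero (suc j) k = trans (M-p 0 0 j k) (trans (*-congˡ (monomial 0 0 j k))
      (solve 3 (λ p w z → p :* (:1 :* :1 :* (w :* z)) := :1 :* :1 :* (p :* w :* z)) refl p (p ^ j) (q ^ k)))
    monomial zero (suc h) j k = trans (M-y 0 h j k) (trans (*-congˡ (monomial 0 h j k))
      (solve 3 (λ y w z → y :* (:1 :* w :* z) := :1 :* (y :* w) :* z) refl y (y ^ h) (p ^ j * q ^ k)))
    monomial (suc v) h j k = begin
      M (2 ℕ.* suc v) h j k
        ≡⟨ cong (λ a → M (suc a) h j k) (ℕP.+-suc v (v ℕ.+ 0)) ⟩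
      M (suc (suc (2 ℕ.* v))) h j k
        ≈⟨ trans (M-t _ h j k) (*-congˡ (trans (M-t _ h j k) (*-congˡ (monomial v h j k)))) ⟩
      t * (t * (x ^ v * y ^ h * (p ^ j * q ^ k)))
        ≈⟨ solve 4 (λ t a b c → t :* (t :* (a :* b :* c)) := t :* t :* a :* b :* c) refl t (x ^ v) (y ^ h) _ ⟩
      t * t * x ^ v * y ^ h * (p ^ j * q ^ k)
        ≈⟨ *-congʳ (*-congʳ (*-congʳ x≈t²)) ⟨
      x * x ^ v * y ^ h * (p ^ j * q ^ k) ∎

  double-sum : ∀ N x y (F G : ℕ → ℕ → Carrier) → (∀ v h → F v h ≈ x ^ v * y ^ h * G v h) →
    ∑ N (λ v → ∑ N (λ h → F v h)) ≈ ∑ N (λ v → x ^ v * ∑ N (λ h → y ^ h * G v h))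
  double-sum N x y F G e = ∑-cong′ N λ v → trans (∑-cong′ N λ h → trans (e v h) (*-assoc _ _ _)) (sym (*-∑ N (x ^ v) _))

-- Four-variable series as iterated one-variable series.

open ≡ using (refl; sym; trans)
open import Defs

ℚring : CommutativeRing _ _
ℚring = QP.+-*-commutativeRing

module P1 = PowerSeries ℚring
module P2 = PowerSeries P1.seriesRing
module P3 = PowerSeries P2.seriesRing
module P4 = PowerSeries P3.seriesRing
module S4 = CommutativeRing P4.seriesRing
module ∑Q = Sums ℚring

sumTo≡∑ : ∀ n f → sumTo n f ≡ ∑Q.∑ n f
sumTo≡∑ zero    f = refl
sumTo≡∑ (suc n) f = cong (Q._+ f (suc n)) (sumTo≡∑ n f)

sumTo-cong : ∀ n {f g} → (∀ a → a ≤ n → f a ≡ g a) → sumTo n f ≡ sumTo n g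
sumTo-cong n e = trans (sumTo≡∑ n _) (trans (∑Q.∑-cong n e) (sym (sumTo≡∑ n _)))

-- The iterated product is a sum of series at each of the three outer levels; taking a coefficient
-- commutes with these sums, and what is left is the fourfold sum of `⊛`.
⊛≡∗ : ∀ f g i h j k → (f ⊛ g) i h j k ≡ (f S4.* g) i h j k
⊛≡∗ f g i h j k = sym (
  trans (P3.∑ˢ-at i _ h j k)
  (trans (outer i _) (sumTo-cong i λ a _ →
  trans (P2.∑ˢ-at h _ j k)
  (trans (middle h _) (sumTo-cong h λ b _ →
  trans (P1.∑ˢ-at j _ k)
  (trans (sym (sumTo≡∑ j _)) (sumTo-cong j λ c _ →
  sym (sumTo≡∑ k _))))))))
  where
  module ∑1 = Sums P1.seriesRing
  module ∑2 = Sums P2.seriesRing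
  middle : ∀ n F → ∑1.∑ n F k ≡ sumTo n (λ a → F a k)
  middle n F = trans (P1.∑ˢ-at n F k) (sym (sumTo≡∑ n _))
  outer : ∀ n F → ∑2.∑ n F j k ≡ sumTo n (λ a → F a j k)
  outer n F = trans (P2.∑ˢ-at n F j k) (middle n _)

neg : PS → PS
neg f i h j k = Q.- f i h j k

mono-0 : ∀ a b c d i h j k → mono a b c d 0ℚ i h j k ≡ 0ℚ
mono-0 a b c d i h j k with ⌊ a ℕ.≟ i ⌋ ∧ ⌊ b ℕ.≟ h ⌋ ∧ ⌊ c ℕ.≟ j ⌋ ∧ ⌊ d ℕ.≟ k ⌋
... | true  = refl
... | false = refl

constant₄ : ℚ → PS
constant₄ r = P4.constant (P3.constant (P2.constant (P1.constant r)))

cst≡constant : ∀ r i h j k → cst r i h j k ≡ constant₄ r i h j k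
cst≡constant r zero    zero    zero    zero    = refl
cst≡constant r zero    zero    zero    (suc k) = refl
cst≡constant r zero    zero    (suc j) k       = refl
cst≡constant r zero    (suc h) j       k       = refl
cst≡constant r (suc i) h       j       k       = refl

·≡cst⊛ : ∀ r f i h j k → (r · f) i h j k ≡ (cst r ⊛ f) i h j k
·≡cst⊛ r f i h j k = sym (
  trans (⊛≡∗ (cst r) f i h j k)
  (trans (S4.*-cong {cst r} {constant₄ r} {f} {f} (cst≡constant r) (S4.refl {f}) i h j k)
  (trans (P4.constant-∗ _ f i h j k)
  (trans (P3.constant-∗ _ (f i) h j k)
  (trans (P2.constant-∗ _ (f i h) j k)
  (P1.constant-∗ _ (f i h j) k))))))

private
  via : ∀ {v v′} f {q} i h j k → (∀ i h j k → v i h j k ≡ v′ i h j k) →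
        (v′ S4.* f) i h j k ≡ q → (v ⊛ f) i h j k ≡ q
  via {v} {v′} f i h j k e p = trans (⊛≡∗ v f i h j k)
    (trans (S4.*-cong {v} {v′} {f} {f} e (S4.refl {f}) i h j k) p)

  T Y P Q′ : PS
  T  = P4.var
  Y  = P4.constant P3.var
  P  = P4.constant (P3.constant P2.var)
  Q′ = P4.constant (P3.constant (P2.constant P1.var))

  T-var : ∀ i h j k → Tv i h j k ≡ T i h j k
  T-var 0 h j k = refl
  T-var 1 zero zero zero = refl
  T-var 1 zero zero (suc k) = refl
  T-var 1 zero (suc j) k = refl
  T-var 1 (suc h) j k = refl
  T-var (suc (suc i)) h j k = refl

  Y-var : ∀ i h j k → Yv i h j k ≡ Y i h j k
  Y-var 0 0 j k = refl
  Y-var 0 1 zero zero = refl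
  Y-var 0 1 zero (suc k) = refl
  Y-var 0 1 (suc j) k = refl
  Y-var 0 (suc (suc h)) j k = refl
  Y-var (suc i) h j k = refl

  P-var : ∀ i h j k → Pv i h j k ≡ P i h j k
  P-var 0 0 0 k = refl
  P-var 0 0 1 zero = refl
  P-var 0 0 1 (suc k) = refl
  P-var 0 0 (suc (suc j)) k = refl
  P-var 0 (suc h) j k = refl
  P-var (suc i) h j k = refl

  Q-var : ∀ i h j k → Qv i h j k ≡ Q′ i h j k
  Q-var 0 0 0 0 = refl
  Q-var 0 0 0 1 = refl
  Q-var 0 0 0 (suc (suc k)) = refl
  Q-var 0 0 (suc j) k = refl
  Q-var 0 (suc h) j k = refl
  Q-var (suc i) h j k = refl

Tv⊛-zero : ∀ f h j k → (Tv ⊛ f) 0 h j k ≡ 0ℚ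
Tv⊛-zero f h j k = via f 0 h j k T-var (P4.var-∗-zero f h j k)

Tv⊛-suc : ∀ f i h j k → (Tv ⊛ f) (suc i) h j k ≡ f i h j k
Tv⊛-suc f i h j k = via f (suc i) h j k T-var (P4.var-∗-suc f i h j k)

Yv⊛-zero : ∀ f i j k → (Yv ⊛ f) i 0 j k ≡ 0ℚ
Yv⊛-zero f i j k = via f i 0 j k Y-var
  (trans (P4.constant-∗ _ f i 0 j k) (P3.var-∗-zero (f i) j k))

Yv⊛-suc : ∀ f i h j k → (Yv ⊛ f) i (suc h) j k ≡ f i h j k
Yv⊛-suc f i h j k = via f i (suc h) j k Y-var
  (trans (P4.constant-∗ _ f i (suc h) j k) (P3.var-∗-suc (f i) h j k))

Pv⊛-zero : ∀ f i h k → (Pv ⊛ f) i h 0 k ≡ 0ℚ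
Pv⊛-zero f i h k = via f i h 0 k P-var
  (trans (P4.constant-∗ _ f i h 0 k) (trans (P3.constant-∗ _ (f i) h 0 k) (P2.var-∗-zero (f i h) k)))

Pv⊛-suc : ∀ f i h j k → (Pv ⊛ f) i h (suc j) k ≡ f i h j k
Pv⊛-suc f i h j k = via f i h (suc j) k P-var
  (trans (P4.constant-∗ _ f i h (suc j) k)
  (trans (P3.constant-∗ _ (f i) h (suc j) k) (P2.var-∗-suc (f i h) j k)))

Qv⊛-zero : ∀ f i h j → (Qv ⊛ f) i h j 0 ≡ 0ℚ
Qv⊛-zero f i h j = via f i h j 0 Q-var
  (trans (P4.constant-∗ _ f i h j 0)
  (trans (P3.constant-∗ _ (f i) h j 0)
  (trans (P2.constant-∗ _ (f i h) j 0) (P1.var-∗-zero (f i h j)))))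

Qv⊛-suc : ∀ f i h j k → (Qv ⊛ f) i h j (suc k) ≡ f i h j k
Qv⊛-suc f i h j k = via f i h j (suc k) Q-var
  (trans (P4.constant-∗ _ f i h j (suc k))
  (trans (P3.constant-∗ _ (f i) h j (suc k))
  (trans (P2.constant-∗ _ (f i h) j (suc k)) (P1.var-∗-suc (f i h j) k))))

private
  -- In this form a shift of the exponents is visible by computation, since `suc a ≡ᵇ suc i` reduces
  -- to `a ≡ᵇ i`.
  mono′ : ∀ a b c d r i h j k → mono a b c d r i h j k ≡
          (if (a ≡ᵇ i) ∧ (b ≡ᵇ h) ∧ (c ≡ᵇ j) ∧ (d ≡ᵇ k) then r else 0ℚ)
  mono′ a b c d r i h j k
    rewrite isYes≗does (a ℕ.≟ i) | isYes≗does (b ℕ.≟ h) | isYes≗does (c ℕ.≟ j) | isYes≗does (d ℕ.≟ k) = refl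

  ∧-false : ∀ (x y z : Bool) {r : ℚ} → (if x ∧ y ∧ z ∧ false then r else 0ℚ) ≡ 0ℚ
  ∧-false false y     z     = refl
  ∧-false true  false z     = refl
  ∧-false true  true  false = refl
  ∧-false true  true  true  = refl

  ∧-false₂ : ∀ (x y z : Bool) {r : ℚ} → (if x ∧ y ∧ false ∧ z then r else 0ℚ) ≡ 0ℚ
  ∧-false₂ false y     z = refl
  ∧-false₂ true  false z = refl
  ∧-false₂ true  true  z = refl

  ∧-false₁ : ∀ (x z : Bool) {r : ℚ} → (if x ∧ false ∧ z then r else 0ℚ) ≡ 0ℚ
  ∧-false₁ false z = refl
  ∧-false₁ true  z = refl

mono-T : ∀ a b c d r → mono (suc a) b c d r ≈ (Tv ⊛ mono a b c d r)
mono-T a b c d r zero    h j k = sym (Tv⊛-zero (mono a b c d r) h j k)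
mono-T a b c d r (suc i) h j k =
  trans (mono′ (suc a) b c d r (suc i) h j k)
  (trans (sym (mono′ a b c d r i h j k)) (sym (Tv⊛-suc (mono a b c d r) i h j k)))

mono-Y : ∀ a b c d r → mono a (suc b) c d r ≈ (Yv ⊛ mono a b c d r)
mono-Y a b c d r i zero j k = trans (mono′ a (suc b) c d r i 0 j k)
  (trans (∧-false₁ (a ≡ᵇ i) ((c ≡ᵇ j) ∧ (d ≡ᵇ k))) (sym (Yv⊛-zero (mono a b c d r) i j k)))
mono-Y a b c d r i (suc h) j k =
  trans (mono′ a (suc b) c d r i (suc h) j k)
  (trans (sym (mono′ a b c d r i h j k)) (sym (Yv⊛-suc (mono a b c d r) i h j k)))

mono-P : ∀ a b c d r → mono a b (suc c) d r ≈ (Pv ⊛ mono a b c d r)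
mono-P a b c d r i h zero k = trans (mono′ a b (suc c) d r i h 0 k)
  (trans (∧-false₂ (a ≡ᵇ i) (b ≡ᵇ h) (d ≡ᵇ k)) (sym (Pv⊛-zero (mono a b c d r) i h k)))
mono-P a b c d r i h (suc j) k =
  trans (mono′ a b (suc c) d r i h (suc j) k)
  (trans (sym (mono′ a b c d r i h j k)) (sym (Pv⊛-suc (mono a b c d r) i h j k)))

mono-Q : ∀ a b c d r → mono a b c (suc d) r ≈ (Qv ⊛ mono a b c d r)
mono-Q a b c d r i h j zero = trans (mono′ a b c (suc d) r i h j 0)
  (trans (∧-false (a ≡ᵇ i) (b ≡ᵇ h) (c ≡ᵇ j)) (sym (Qv⊛-zero (mono a b c d r) i h j)))
mono-Q a b c d r i h j (suc k) =
  trans (mono′ a b c (suc d) r i h j (suc k))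
  (trans (sym (mono′ a b c d r i h j k)) (sym (Qv⊛-suc (mono a b c d r) i h j k)))

-- Series modulo total degree greater than N.

infix 4 _≈[_]_
-- Equality in the quotient by the ideal of series of order above N. The carrier stays `PS`, so
-- every series of the statement is an element of every quotient.
record _≈[_]_ (f : PS) (N : ℕ) (g : PS) : Set where
  constructor agree
  field at : ∀ i h j k → i ℕ.+ h ℕ.+ j ℕ.+ k ≤ N → f i h j k ≡ g i h j k
open _≈[_]_ public

≈⇒≈[] : ∀ {f g} N → f ≈ g → f ≈[ N ] g
≈⇒≈[] N e = agree λ i h j k _ → e i h j k

-- A single coefficient is already visible modulo its own total degree.
≈[]⇒≈ : ∀ {f g} → (∀ N → f ≈[ N ] g) → f ≈ g
≈[]⇒≈ e i h j k = at (e _) i h j k ℕP.≤-refl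

module _ (N : ℕ) where

  -- A coefficient of a product uses only coefficients of the factors whose total degree is no
  -- larger.
  ⊛-cong : ∀ {f f′ g g′} → f ≈[ N ] f′ → g ≈[ N ] g′ → (f ⊛ g) ≈[ N ] (f′ ⊛ g′)
  ⊛-cong e e′ = agree λ i h j k le →
    sumTo-cong i λ a a≤ → sumTo-cong h λ b b≤ → sumTo-cong j λ c c≤ → sumTo-cong k λ d d≤ →
    cong₂ Q._*_
      (at e a b c d (ℕP.≤-trans (ℕP.+-mono-≤ (ℕP.+-mono-≤ (ℕP.+-mono-≤ a≤ b≤) c≤) d≤) le))
      (at e′ _ _ _ _ (ℕP.≤-trans
        (ℕP.+-mono-≤ (ℕP.+-mono-≤ (ℕP.+-mono-≤ (ℕP.m∸n≤m i a) (ℕP.m∸n≤m h b)) (ℕP.m∸n≤m j c)) (ℕP.m∸n≤m k d)) le))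

  private
    full : ∀ {f g f′ g′} → (f ≈ f′) → (g ≈ g′) → f S4.≈ g → f′ ≈[ N ] g′
    full ef eg e = agree λ i h j k _ → trans (sym (ef i h j k)) (trans (e i h j k) (eg i h j k))

    ∗≡⊛ : ∀ f g → (f S4.* g) ≈ (f ⊛ g)
    ∗≡⊛ f g i h j k = sym (⊛≡∗ f g i h j k)

    ∗∗≡⊛⊛ˡ : ∀ f g e → ((f S4.* g) S4.* e) ≈ ((f ⊛ g) ⊛ e)
    ∗∗≡⊛⊛ˡ f g e i h j k = trans (S4.*-cong {_} {_} {e} {e} (∗≡⊛ f g) (S4.refl {e}) i h j k) (∗≡⊛ (f ⊛ g) e i h j k)

    ∗∗≡⊛⊛ʳ : ∀ f g e → (f S4.* (g S4.* e)) ≈ (f ⊛ (g ⊛ e))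
    ∗∗≡⊛⊛ʳ f g e i h j k = trans (S4.*-cong {f} {f} {_} {_} (S4.refl {f}) (∗≡⊛ g e) i h j k) (∗≡⊛ f (g ⊛ e) i h j k)

    𝟙⊛ : ∀ f → (𝟙 ⊛ f) ≈[ N ] f
    𝟙⊛ f = agree λ i h j k _ → trans (sym (·≡cst⊛ 1ℚ f i h j k)) (QP.*-identityˡ _)

    ⊛-comm : ∀ f g → (f ⊛ g) ≈[ N ] (g ⊛ f)
    ⊛-comm f g = full (∗≡⊛ f g) (∗≡⊛ g f) (S4.*-comm f g)

    ≈-refl : ∀ {f} → f ≈[ N ] f
    ≈-refl = agree λ _ _ _ _ _ → refl

    ≈-trans : ∀ {f g h} → f ≈[ N ] g → g ≈[ N ] h → f ≈[ N ] h
    ≈-trans e e′ = agree λ i h j k le → trans (at e i h j k le) (at e′ i h j k le)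

    ⊕-cong : ∀ {f f′ g g′} → f ≈[ N ] f′ → g ≈[ N ] g′ → (f ⊕ g) ≈[ N ] (f′ ⊕ g′)
    ⊕-cong e e′ = agree λ i h j k le → cong₂ Q._+_ (at e i h j k le) (at e′ i h j k le)

    𝟘⊕ : ∀ f → (𝟘 ⊕ f) ≈[ N ] f
    𝟘⊕ f = agree λ i h j k _ → trans (cong (Q._+ f i h j k) (mono-0 0 0 0 0 i h j k)) (QP.+-identityˡ _)

    ⊕-comm : ∀ f g → (f ⊕ g) ≈[ N ] (g ⊕ f)
    ⊕-comm f g = agree λ i h j k _ → QP.+-comm (f i h j k) (g i h j k)

    negˡ : ∀ f → (neg f ⊕ f) ≈[ N ] 𝟘
    negˡ f = agree λ i h j k _ → trans (QP.+-inverseˡ (f i h j k)) (sym (mono-0 0 0 0 0 i h j k))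

    ⊛-distribʳ : ∀ h f g → ((f ⊕ g) ⊛ h) ≈[ N ] ((f ⊛ h) ⊕ (g ⊛ h))
    ⊛-distribʳ e f g = full (∗≡⊛ (f ⊕ g) e) (λ i h j k → cong₂ Q._+_ (∗≡⊛ f e i h j k) (∗≡⊛ g e i h j k))
      (S4.distribʳ e f g)

  truncRing : CommutativeRing _ _
  truncRing = record
    { Carrier = PS
    ; _≈_ = _≈[ N ]_
    ; _+_ = _⊕_
    ; _*_ = _⊛_
    ; -_ = neg
    ; 0# = 𝟘
    ; 1# = 𝟙
    ; isCommutativeRing = record
      { isRing = record
        { +-isAbelianGroup = record
          { isGroup = record
            { isMonoid = record
              { isSemigroup = record
                { isMagma = record
                  { isEquivalence = record
                    { refl = ≈-refl
                    ; sym = λ e → agree λ i h j k le → sym (at e i h j k le)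
                    ; trans = ≈-trans }
                  ; ∙-cong = ⊕-cong }
                ; assoc = λ f g e → agree λ i h j k _ → QP.+-assoc (f i h j k) (g i h j k) (e i h j k) }
              ; identity = 𝟘⊕ , (λ f → ≈-trans (⊕-comm f 𝟘) (𝟘⊕ f)) }
            ; inverse = negˡ , (λ f → ≈-trans (⊕-comm f (neg f)) (negˡ f))
            ; ⁻¹-cong = λ e → agree λ i h j k le → cong Q.-_ (at e i h j k le) }
          ; comm = ⊕-comm }
        ; *-cong = ⊛-cong
        ; *-assoc = λ f g e → full (∗∗≡⊛⊛ˡ f g e) (∗∗≡⊛⊛ʳ f g e) (S4.*-assoc f g e)
        ; *-identity = 𝟙⊛ , (λ f → ≈-trans (⊛-comm f 𝟙) (𝟙⊛ f))
        ; distrib = (λ e f g → ≈-trans (⊛-comm e (f ⊕ g)) (≈-trans (⊛-distribʳ e f g) (⊕-cong (⊛-comm f e) (⊛-comm g e))))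
                  , ⊛-distribʳ
        }
      ; *-comm = ⊛-comm
      }
    }

-- The square of the binomial series with exponent 1/2.

module HalfBinom where

  open P1
  module S1 = CommutativeRing P1.seriesRing
  open RingTools ℚring using (solve; _:=_; _:+_; _:*_; _:-_; :1)
  module SR = RingTools P1.seriesRing

  fromℕ : ℕ → ℚ
  fromℕ n = + n Q./ 1

  fromℕ-+ : ∀ m n → fromℕ (m ℕ.+ n) ≡ fromℕ m Q.+ fromℕ n
  fromℕ-+ m n = QP.toℚᵘ-injective (
    UP.≃-trans (QP.toℚᵘ-fromℚᵘ (U.mkℚᵘ (+ (m ℕ.+ n)) 0))
    (UP.≃-trans (U.*≡* (cong (ℤ._* + 1) (≡.trans (ℤP.pos-+ m n) (cong₂ ℤ._+_ (sym (ℤP.*-identityʳ (+ m))) (sym (ℤP.*-identityʳ (+ n)))))))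
    (UP.≃-sym (UP.≃-trans (QP.toℚᵘ-homo-+ (fromℕ m) (fromℕ n))
      (UP.+-cong (QP.toℚᵘ-fromℚᵘ (U.mkℚᵘ (+ m) 0)) (QP.toℚᵘ-fromℚᵘ (U.mkℚᵘ (+ n) 0)))))))

  fromℕ-inverse : ∀ n → fromℕ (suc n) Q.* (+ 1 Q./ suc n) ≡ 1ℚ
  fromℕ-inverse n = QP.toℚᵘ-injective (
    UP.≃-trans (QP.toℚᵘ-homo-* (fromℕ (suc n)) (+ 1 Q./ suc n))
    (UP.≃-trans (UP.*-cong (QP.toℚᵘ-fromℚᵘ (U.mkℚᵘ (+ suc n) 0)) (QP.toℚᵘ-fromℚᵘ (U.mkℚᵘ (+ 1) n)))
    (U.*≡* (trans (ℤP.*-identityʳ (+ suc n ℤ.* + 1)) (trans (ℤP.*-identityʳ (+ suc n)) (sym (trans (ℤP.*-identityˡ (+ suc (n ℕ.+ 0))) (cong (λ k → + suc k) (ℕP.+-identityʳ n)))))))))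

  θ : Series → Series
  θ f n = fromℕ n Q.* f n

  -- The product rule: on the term with indices a and n - a, multiplication by n is multiplication
  -- by a plus multiplication by n - a.
  θ-∗ : ∀ f g → θ (f ∗ g) ≋ (λ n → (θ f ∗ g) n Q.+ (f ∗ θ g) n)
  θ-∗ f g n = trans (∑Q.*-∑ n (fromℕ n) _)
    (trans (∑Q.∑-cong n term) (∑Q.∑-+ n _ _))
    where
    term : ∀ a → a ≤ n → fromℕ n Q.* (f a Q.* g (n ℕ.∸ a)) ≡
           fromℕ a Q.* f a Q.* g (n ℕ.∸ a) Q.+ f a Q.* (fromℕ (n ℕ.∸ a) Q.* g (n ℕ.∸ a))
    term a a≤n = trans
      (cong (Q._* (f a Q.* g (n ℕ.∸ a))) (trans (cong fromℕ (sym (ℕP.m+[n∸m]≡n a≤n))) (fromℕ-+ a (n ℕ.∸ a))))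
      (solve 4 (λ x y z w → (x :+ y) :* (z :* w) := x :* z :* w :+ z :* (y :* w)) refl (fromℕ a) (fromℕ (n ℕ.∸ a)) (f a) (g (n ℕ.∸ a)))

  half : Series
  half n = ½ Q.* halfBinom n

  -- (1 + z) f′ = f / 2 for f = √(1+z), written with the Euler operator θ = z d/dz.
  θ-halfBinom : θ halfBinom ≋ (var ∗ (λ n → half n Q.- θ halfBinom n))
  θ-halfBinom zero    = sym (var-∗-zero (λ n → half n Q.- θ halfBinom n))
  θ-halfBinom (suc n) = trans
    (trans (solve 4 (λ a h b i → a :* (h :* b :* i) := (a :* i) :* (h :* b)) refl (fromℕ (suc n)) (halfBinom n) (½ Q.- fromℕ n) (+ 1 Q./ suc n))
    (trans (cong (Q._* (halfBinom n Q.* (½ Q.- fromℕ n))) (fromℕ-inverse n))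
    (solve 3 (λ h k m → :1 :* (h :* (k :- m)) := k :* h :- m :* h) refl (halfBinom n) ½ (fromℕ n))))
    (sym (var-∗-suc (λ m → half m Q.- θ halfBinom m) n))

  half+half : (λ n → half n Q.+ half n) ≋ halfBinom
  half+half n = trans (sym (QP.*-distribʳ-+ (halfBinom n) ½ ½)) (QP.*-identityˡ (halfBinom n))

  square : Series
  square = halfBinom ∗ halfBinom

  -- By the product rule the square s inherits the differential equation (1 + z) s′ = s, whose
  -- solutions are the multiples of 1 + z.
  θ-square : θ square ≋ (var ∗ (λ n → square n Q.- θ square n))
  θ-square = begin
    θ square
      ≈⟨ θ-∗ h h ⟩
    θ h S1.* h S1.+ h S1.* θ h
      ≈⟨ S1.+-cong {θ h S1.* h} {D S1.* h} {h S1.* θ h} {h S1.* D}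
           (S1.*-congʳ {h} {θ h} {D} θ-halfBinom) (S1.*-congˡ {h} {θ h} {D} θ-halfBinom) ⟩
    D S1.* h S1.+ h S1.* D
      ≈⟨ SR.solve 4 (λ z k t h → (z SR.:* (k SR.:- t)) SR.:* h SR.:+ h SR.:* (z SR.:* (k SR.:- t))
           SR.:= z SR.:* ((k SR.:+ k) SR.:* h SR.:- (t SR.:* h SR.:+ h SR.:* t))) (λ _ → refl) var half (θ h) h ⟩
    var S1.* ((half S1.+ half) S1.* h S1.- (θ h S1.* h S1.+ h S1.* θ h))
      ≈⟨ S1.*-congˡ {var} {(half S1.+ half) S1.* h S1.- (θ h S1.* h S1.+ h S1.* θ h)} {square S1.- θ square}
           (λ n → cong₂ Q._-_ (S1.*-congʳ {h} {half S1.+ half} {h} half+half n) (sym (θ-∗ h h n))) ⟩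
    var S1.* (square S1.- θ square) ∎
    where
    open import Relation.Binary.Reasoning.Setoid S1.setoid
    h : Series
    h = halfBinom
    D : Series
    D = var S1.* (half S1.- θ h)

  square-suc : ∀ n → fromℕ (suc n) Q.* square (suc n) ≡ square n Q.- fromℕ n Q.* square n
  square-suc n = trans (θ-square (suc n)) (var-∗-suc (λ m → square m Q.- θ square m) n)

  square-next : ∀ n → square (suc n) Q.- fromℕ (suc n) Q.* square (suc n) ≡ 0ℚ → square (suc (suc n)) ≡ 0ℚ
  square-next n eq = trans
    (solve 1 (λ s → s := :1 :* s) refl s)
    (trans (cong (Q._* s) (sym (fromℕ-inverse (suc n))))
    (trans (solve 3 (λ a i s → a :* i :* s := i :* (a :* s)) refl a i s)
    (trans (cong (i Q.*_) (trans (square-suc (suc n)) eq))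
    (QP.*-zeroʳ i))))
    where
    s = square (suc (suc n))
    a = fromℕ (suc (suc n))
    i = + 1 Q./ suc (suc n)

  -- The recursion is (n + 1) s(n+1) = (1 - n) s(n). Its factor vanishes at n = 1, and from then on
  -- all coefficients are zero.
  square-vanishes : ∀ n → square (suc (suc n)) ≡ 0ℚ
  square-vanishes zero    = square-next 0 refl
  square-vanishes (suc n) = square-next (suc n)
    (trans (cong (λ s → s Q.- fromℕ (suc (suc n)) Q.* s) (square-vanishes n))
           (cong (λ z → 0ℚ Q.- z) (QP.*-zeroʳ (fromℕ (suc (suc n))))))

  1+var : Series
  1+var 0             = 1ℚ
  1+var 1             = 1ℚ
  1+var (suc (suc _)) = 0ℚ

  square≋1+var : square ≋ 1+var
  square≋1+var 0             = refl
  square≋1+var 1             = refl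
  square≋1+var (suc (suc n)) = square-vanishes n

open HalfBinom using (square; square≋1+var; 1+var)

-- Orders of vanishing and the truncations in the definitions.

Below : ℕ → PS → Set
Below n f = ∀ i h j k → i ℕ.+ h ℕ.+ j ℕ.+ k < n → f i h j k ≡ 0ℚ

sumTo-0 : ∀ n {f} → (∀ a → a ≤ n → f a ≡ 0ℚ) → sumTo n f ≡ 0ℚ
sumTo-0 n e = trans (sumTo≡∑ n _) (∑Q.∑-0 n e)

total-split : ∀ {i h j k a b c d} → a ≤ i → b ≤ h → c ≤ j → d ≤ k →
  (a ℕ.+ b ℕ.+ c ℕ.+ d) ℕ.+ ((i ℕ.∸ a) ℕ.+ (h ℕ.∸ b) ℕ.+ (j ℕ.∸ c) ℕ.+ (k ℕ.∸ d)) ≡ i ℕ.+ h ℕ.+ j ℕ.+ k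
total-split {i} {h} {j} {k} {a} {b} {c} {d} a≤ b≤ c≤ d≤ = trans
  (solve 8 (λ a b c d a′ b′ c′ d′ → (a :+ b :+ c :+ d) :+ (a′ :+ b′ :+ c′ :+ d′) := (a :+ a′) :+ (b :+ b′) :+ (c :+ c′) :+ (d :+ d′))
     refl a b c d (i ℕ.∸ a) (h ℕ.∸ b) (j ℕ.∸ c) (k ℕ.∸ d))
  (cong₂ ℕ._+_ (cong₂ ℕ._+_ (cong₂ ℕ._+_ (ℕP.m+[n∸m]≡n a≤) (ℕP.m+[n∸m]≡n b≤)) (ℕP.m+[n∸m]≡n c≤)) (ℕP.m+[n∸m]≡n d≤))
  where open ℕSolver.+-*-Solver

-- In each term of a coefficient of total degree at most n, either the index in `e` has total degree
-- 0, where `e` vanishes, or the index in `f` has total degree below n.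
Below-⊛ : ∀ {n e f} → Below 1 e → Below n f → Below (suc n) (e ⊛ f)
Below-⊛ {n} {e} {f} e₀ f₀ i h j k (s≤s le) =
  sumTo-0 i λ a a≤ → sumTo-0 h λ b b≤ → sumTo-0 j λ c c≤ → sumTo-0 k λ d d≤ → term a b c d (total-split a≤ b≤ c≤ d≤)
  where
  term : ∀ a b c d → (a ℕ.+ b ℕ.+ c ℕ.+ d) ℕ.+ ((i ℕ.∸ a) ℕ.+ (h ℕ.∸ b) ℕ.+ (j ℕ.∸ c) ℕ.+ (k ℕ.∸ d)) ≡ i ℕ.+ h ℕ.+ j ℕ.+ k →
         e a b c d Q.* f (i ℕ.∸ a) (h ℕ.∸ b) (j ℕ.∸ c) (k ℕ.∸ d) ≡ 0ℚ
  term a b c d split with ℕP.<-cmp (a ℕ.+ b ℕ.+ c ℕ.+ d) 0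
  ... | tri≈ _ eq _ = trans (cong (Q._* f (i ℕ.∸ a) (h ℕ.∸ b) (j ℕ.∸ c) (k ℕ.∸ d)) (e₀ a b c d (subst (_< 1) (sym eq) (s≤s z≤n)))) (QP.*-zeroˡ (f (i ℕ.∸ a) (h ℕ.∸ b) (j ℕ.∸ c) (k ℕ.∸ d)))
  ... | tri> _ _ gt = trans (cong (e a b c d Q.*_) (f₀ (i ℕ.∸ a) (h ℕ.∸ b) (j ℕ.∸ c) (k ℕ.∸ d)
          (ℕP.<-≤-trans (subst ((i ℕ.∸ a) ℕ.+ (h ℕ.∸ b) ℕ.+ (j ℕ.∸ c) ℕ.+ (k ℕ.∸ d) <_) split
            (ℕP.m<n+m ((i ℕ.∸ a) ℕ.+ (h ℕ.∸ b) ℕ.+ (j ℕ.∸ c) ℕ.+ (k ℕ.∸ d)) gt)) le))) (QP.*-zeroʳ (e a b c d))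

Below-^^ : ∀ {e} → Below 1 e → ∀ n → Below n (e ^^ n)
Below-^^ e₀ zero    i h j k ()
Below-^^ {e} e₀ (suc n) = Below-⊛ {n} {e} {e ^^ n} e₀ (Below-^^ e₀ n)

Below-const : ∀ {f} → const f ≡ 0ℚ → Below 1 f
Below-const eq zero zero zero zero lt = eq
Below-const eq zero zero zero (suc k) (s≤s ())
Below-const eq zero zero (suc j) k (s≤s ())
Below-const eq zero (suc h) j k (s≤s ())
Below-const eq (suc i) h j k (s≤s ())

sumPS-stable : ∀ (F : ℕ → PS) → (∀ n → Below n (F n)) → ∀ {M N} → M ≤ N →
  ∀ i h j k → i ℕ.+ h ℕ.+ j ℕ.+ k ≤ M → sumPS N F i h j k ≡ sumPS M F i h j k
sumPS-stable F F₀ {M} {zero}  z≤n i h j k le = refl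
sumPS-stable F F₀ {M} {suc N} M≤N i h j k le with ℕP.m≤n⇒m<n∨m≡n M≤N
... | inj₂ refl      = refl
... | inj₁ (s≤s M≤N′) = trans
  (cong₂ Q._+_ (sumPS-stable F F₀ M≤N′ i h j k le) (F₀ (suc N) i h j k (s≤s (ℕP.≤-trans le M≤N′))))
  (QP.+-identityʳ _)

-- `inv₁` and `sqrt₁` cut their sums at a bound that varies with the coefficient. Modulo degree
-- above N the single bound N does for all coefficients, and the result is a polynomial to which
-- ring laws apply.
diagonal≈sumPS : ∀ (F : ℕ → PS) → (∀ n → Below n (F n)) → ∀ N →
  (λ i h j k → sumPS (i ℕ.+ h ℕ.+ j ℕ.+ k) F i h j k) ≈[ N ] sumPS N F
diagonal≈sumPS F F₀ N = agree λ i h j k le → sym (sumPS-stable F F₀ le i h j k ℕP.≤-refl)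

cst-+ : ∀ a b → cst (a Q.+ b) ≈ (cst a ⊕ cst b)
cst-+ a b i h j k with ⌊ 0 ℕ.≟ i ⌋ ∧ ⌊ 0 ℕ.≟ h ⌋ ∧ ⌊ 0 ℕ.≟ j ⌋ ∧ ⌊ 0 ℕ.≟ k ⌋
... | true  = refl
... | false = refl

cst-* : ∀ a b → cst (a Q.* b) ≈ (cst a ⊛ cst b)
cst-* a b i h j k = trans scale (·≡cst⊛ a (cst b) i h j k)
  where
  scale : cst (a Q.* b) i h j k ≡ a Q.* cst b i h j k
  scale with ⌊ 0 ℕ.≟ i ⌋ ∧ ⌊ 0 ℕ.≟ h ⌋ ∧ ⌊ 0 ℕ.≟ j ⌋ ∧ ⌊ 0 ℕ.≟ k ⌋
  ... | true  = refl
  ... | false = sym (QP.*-zeroʳ a)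

≈[]-weaken : ∀ {f g M N} → M ≤ N → f ≈[ N ] g → f ≈[ M ] g
≈[]-weaken M≤N e = agree λ i h j k le → at e i h j k (ℕP.≤-trans le M≤N)

module _ (N : ℕ) where
  private
    R = truncRing N
    module R = CommutativeRing R
    module S = Sums R
    module E = PolyEval R
    module PR = PowerSeries R
  open import Algebra.Properties.Semiring.Exp R.semiring using (_^_)

  ^^≡^ : ∀ f n → f ^^ n ≡ f ^ n
  ^^≡^ f zero    = refl
  ^^≡^ f (suc n) = cong (f ⊛_) (^^≡^ f n)

  sumPS≡∑ : ∀ n {F G} → (∀ a → F a ≡ G a) → sumPS n F ≡ S.∑ n G
  sumPS≡∑ zero    e = e 0
  sumPS≡∑ (suc n) e = cong₂ _⊕_ (sumPS≡∑ n e) (e (suc n))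

  nilpotent : ∀ e → const e ≡ 0ℚ → (e ^ suc N) ≈[ N ] 𝟘
  nilpotent e e₀ = subst (_≈[ N ] 𝟘) (^^≡^ e (suc N))
    (agree λ i h j k le → trans (Below-^^ {e} (Below-const {e} e₀) (suc N) i h j k (s≤s le)) (sym (mono-0 0 0 0 0 i h j k)))

  inv₁-inverse : ∀ f → const f ≡ 1ℚ → (f ⊛ inv₁ f) ≈[ N ] 𝟙
  inv₁-inverse f f₀ = E.geometric-inverse N f (inv₁ f) (nilpotent (𝟙 ⊖ f) e₀)
    (subst (inv₁ f ≈[ N ]_) (sumPS≡∑ N (^^≡^ (𝟙 ⊖ f)))
      (diagonal≈sumPS ((𝟙 ⊖ f) ^^_) (Below-^^ {𝟙 ⊖ f} (Below-const {𝟙 ⊖ f} e₀)) N))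
    where
    e₀ : const (𝟙 ⊖ f) ≡ 0ℚ
    e₀ = cong (1ℚ Q.+_) (cong Q.-_ f₀)

  invPS-inverse : ∀ f → ¬ (const f ≡ 0ℚ) → (f ⊛ invPS f) ≈[ N ] 𝟙
  invPS-inverse f f₀ with const f QP.≟ 0ℚ
  ... | yes eq = contradiction eq f₀
  ... | no neq = E.scale-inverse (cst r) f (inv₁ (r · f)) (r · f) (r · inv₁ (r · f))
      (≈⇒≈[] N (·≡cst⊛ r f)) (≈⇒≈[] N (·≡cst⊛ r (inv₁ (r · f))))
      (inv₁-inverse (r · f) (QP.*-inverseˡ (const f)))
    where
    instance
      nz : Q.NonZero (const f)
      nz = Q.≢-nonZero neq
    r : ℚ
    r = 1/ (const f)

  cst-∑ : ∀ n f → S.∑ n (λ a → cst (f a)) ≈[ N ] cst (∑Q.∑ n f)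
  cst-∑ zero    f = R.refl {cst (f 0)}
  cst-∑ (suc n) f = R.trans {S.∑ (suc n) (λ a → cst (f a))} {cst (∑Q.∑ n f) ⊕ cst (f (suc n))} {cst (∑Q.∑ (suc n) f)}
    (R.+-congʳ {cst (f (suc n))} {S.∑ n (λ a → cst (f a))} {cst (∑Q.∑ n f)} (cst-∑ n f))
    (R.sym {cst (∑Q.∑ (suc n) f)} {cst (∑Q.∑ n f) ⊕ cst (f (suc n))} (≈⇒≈[] N (cst-+ (∑Q.∑ n f) (f (suc n)))))

  binom : ℕ → PS
  binom n = cst (halfBinom n)

  binom-∗ : (binom PR.∗ binom) PR.≋ E.one-plus-var
  binom-∗ n = R.trans {(binom PR.∗ binom) n} {S.∑ n (λ a → cst (halfBinom a Q.* halfBinom (n ℕ.∸ a)))} {E.one-plus-var n}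
    (S.∑-cong′ n {λ a → binom a ⊛ binom (n ℕ.∸ a)} {λ a → cst (halfBinom a Q.* halfBinom (n ℕ.∸ a))} (λ a →
      R.sym {cst (halfBinom a Q.* halfBinom (n ℕ.∸ a))} {binom a ⊛ binom (n ℕ.∸ a)} (≈⇒≈[] N (cst-* (halfBinom a) (halfBinom (n ℕ.∸ a))))))
    (R.trans {S.∑ n (λ a → cst (halfBinom a Q.* halfBinom (n ℕ.∸ a)))} {cst (square n)} {E.one-plus-var n}
      (cst-∑ n (λ a → halfBinom a Q.* halfBinom (n ℕ.∸ a))) (subst (λ q → cst q ≈[ N ] E.one-plus-var n) (sym (square≋1+var n)) (coefficient n)))
    where
    coefficient : ∀ n → cst (1+var n) ≈[ N ] E.one-plus-var n
    coefficient 0             = R.refl {𝟙}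
    coefficient 1             = R.refl {𝟙}
    coefficient (suc (suc n)) = R.refl {𝟘}

  sqrt₁≈eval : ∀ f → const f ≡ 1ℚ → sqrt₁ f ≈[ N ] E.eval (f ⊖ 𝟙) N binom
  sqrt₁≈eval f f₀ = R.trans {sqrt₁ f} {sumPS N F} {E.eval e N binom}
    (diagonal≈sumPS F below N)
    (subst (_≈[ N ] E.eval e N binom) (sym (sumPS≡∑ N {F} {F} (λ _ → refl)))
      (S.∑-cong′ N {F} {λ n → binom n ⊛ e ^ n} (λ n → subst (λ p → F n ≈[ N ] (binom n ⊛ p)) (^^≡^ e n) (≈⇒≈[] N (·≡cst⊛ (halfBinom n) (e ^^ n))))))
    where
    e : PS
    e = f ⊖ 𝟙
    F : ℕ → PS
    F n = halfBinom n · (e ^^ n)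
    below : ∀ n → Below n (F n)
    below n i h j k lt = trans
      (cong (halfBinom n Q.*_) (Below-^^ {e} (Below-const {e} (cong (Q._- 1ℚ) f₀)) n i h j k lt))
      (QP.*-zeroʳ (halfBinom n))

-- Evaluating 1 + z faithfully needs a positive degree bound, so the argument runs modulo degree
-- above N + 1 and is weakened afterwards.
sqrt₁-square : ∀ N f → const f ≡ 1ℚ → (sqrt₁ f ⊛ sqrt₁ f) ≈[ N ] f
sqrt₁-square N f f₀ = ≈[]-weaken (ℕP.n≤1+n N) (PolyEval.series-square-root (truncRing (suc N)) N (binom (suc N)) f (sqrt₁ f)
  (binom-∗ (suc N)) (nilpotent (suc N) (f ⊖ 𝟙) (cong (Q._- 1ℚ) f₀)) (sqrt₁≈eval (suc N) f f₀))

-- Generating functions modulo degree greater than N.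

mono-0-t : ∀ a b c d r i h j k → i < a → mono a b c d r i h j k ≡ 0ℚ
mono-0-t a b c d r i h j k lt = cong
  (λ z → if z ∧ ⌊ b ℕ.≟ h ⌋ ∧ ⌊ c ℕ.≟ j ⌋ ∧ ⌊ d ℕ.≟ k ⌋ then r else 0ℚ) (==-false {a} {i} (λ e → ℕP.<-irrefl (sym e) lt))

mono-0-y : ∀ a b c d r i h j k → h < b → mono a b c d r i h j k ≡ 0ℚ
mono-0-y a b c d r i h j k lt = trans (cong
  (λ z → if ⌊ a ℕ.≟ i ⌋ ∧ z ∧ ⌊ c ℕ.≟ j ⌋ ∧ ⌊ d ℕ.≟ k ⌋ then r else 0ℚ) (==-false {b} {h} (λ e → ℕP.<-irrefl (sym e) lt)))
  (absorb ⌊ a ℕ.≟ i ⌋)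
  where
  absorb : ∀ z → (if z ∧ false then r else 0ℚ) ≡ 0ℚ
  absorb true  = refl
  absorb false = refl

-- The weight is divisible by t^(2v) and y^hh. The bound v ≤ 2v suffices for t, because `genFun`
-- lets v run up to the exponent of t.
weight-vanishes : ∀ sw cs v hh U i h j k → i < v ⊎ h < hh → weight sw cs v hh U i h j k ≡ 0ℚ
weight-vanishes sw cs v hh U i h j k out =
  sumTo-0 i λ a a≤i → sumTo-0 h λ b b≤h → sumTo-0 j λ c _ → sumTo-0 k λ d _ →
    trans (cong (Q._* (U ^^ (leftHeight cs ℕ.∸ 1)) (i ℕ.∸ a) (h ℕ.∸ b) (j ℕ.∸ c) (k ℕ.∸ d)) (vanish a b c d a≤i b≤h out))
          (QP.*-zeroˡ ((U ^^ (leftHeight cs ℕ.∸ 1)) (i ℕ.∸ a) (h ℕ.∸ b) (j ℕ.∸ c) (k ℕ.∸ d)))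
  where
  e₁ e₂ : ℕ
  e₁ = if sw then countU cs else countB cs
  e₂ = if sw then countB cs else countU cs
  vanish : ∀ a b c d → a ≤ i → b ≤ h → i < v ⊎ h < hh → mono (2 ℕ.* v) hh e₁ e₂ 1ℚ a b c d ≡ 0ℚ
  vanish a b c d a≤i b≤h (inj₁ i<v)  = mono-0-t (2 ℕ.* v) hh e₁ e₂ 1ℚ a b c d (ℕP.<-≤-trans (ℕP.≤-<-trans a≤i i<v) (ℕP.m≤m+n v (v ℕ.+ 0)))
  vanish a b c d a≤i b≤h (inj₂ h<hh) = mono-0-y (2 ℕ.* v) hh e₁ e₂ 1ℚ a b c d (ℕP.≤-<-trans b≤h h<hh)

summand : (List Col → Bool) → Bool → PS → ℕ → ℕ → PS
summand S sw U v hh = sumList (map (λ cs → weight sw cs v hh U) (filterᵇ S (convexPolys v hh)))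

summand-vanishes : ∀ S sw U v hh i h j k → i < v ⊎ h < hh → summand S sw U v hh i h j k ≡ 0ℚ
summand-vanishes S sw U v hh i h j k out = go (filterᵇ S (convexPolys v hh))
  where
  go : ∀ l → sumList (map (λ cs → weight sw cs v hh U) l) i h j k ≡ 0ℚ
  go []       = mono-0 0 0 0 0 i h j k
  go (cs ∷ l) = cong₂ Q._+_ (weight-vanishes sw cs v hh U i h j k out) (go l)

sumPS-extend : ∀ (F : ℕ → PS) {m N} → m ≤ N → ∀ i h j k → (∀ v → m < v → F v i h j k ≡ 0ℚ) →
  sumPS N F i h j k ≡ sumPS m F i h j k
sumPS-extend F {m} {zero}  z≤n i h j k e = refl
sumPS-extend F {m} {suc N} m≤N i h j k e with ℕP.m≤n⇒m<n∨m≡n m≤N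
... | inj₂ refl       = refl
... | inj₁ (s≤s m≤N′) = trans
  (cong₂ Q._+_ (sumPS-extend F m≤N′ i h j k e) (e (suc N) (s≤s m≤N′))) (QP.+-identityʳ (sumPS m F i h j k))

sumPS-0 : ∀ N (F : ℕ → PS) i h j k → (∀ v → F v i h j k ≡ 0ℚ) → sumPS N F i h j k ≡ 0ℚ
sumPS-0 zero    F i h j k e = e 0
sumPS-0 (suc N) F i h j k e = cong₂ Q._+_ (sumPS-0 N F i h j k e) (e (suc N))

sumPS-cong : ∀ N (F G : ℕ → PS) i h j k → (∀ v → F v i h j k ≡ G v i h j k) → sumPS N F i h j k ≡ sumPS N G i h j k
sumPS-cong zero    F G i h j k e = e 0
sumPS-cong (suc N) F G i h j k e = cong₂ Q._+_ (sumPS-cong N F G i h j k e) (e (suc N))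

genFun≈sumPS : ∀ N S sw U → genFun S sw U ≈[ N ] sumPS N (λ v → sumPS N (summand S sw U v))
genFun≈sumPS N S sw U = agree λ i h j k le → sym (trans
  (sumPS-extend (λ v → sumPS N (summand S sw U v)) {i} {N} (i≤N i h j k le) i h j k
    (λ v i<v → sumPS-0 N (summand S sw U v) i h j k (λ hh → summand-vanishes S sw U v hh i h j k (inj₁ i<v))))
  (sumPS-cong i (λ v → sumPS N (summand S sw U v)) (λ v → sumPS h (summand S sw U v)) i h j k (λ v →
    sumPS-extend (summand S sw U v) {h} {N} (h≤N i h j k le) i h j k
      (λ hh h<hh → summand-vanishes S sw U v hh i h j k (inj₂ h<hh)))))
  where
  i≤N : ∀ i h j k → i ℕ.+ h ℕ.+ j ℕ.+ k ≤ N → i ≤ N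
  i≤N i h j k le = ℕP.≤-trans (ℕP.≤-trans (ℕP.m≤m+n i h) (ℕP.≤-trans (ℕP.m≤m+n (i ℕ.+ h) j) (ℕP.m≤m+n (i ℕ.+ h ℕ.+ j) k))) le
  h≤N : ∀ i h j k → i ℕ.+ h ℕ.+ j ℕ.+ k ≤ N → h ≤ N
  h≤N i h j k le = ℕP.≤-trans (ℕP.≤-trans (ℕP.m≤n+m h i) (ℕP.≤-trans (ℕP.m≤m+n (i ℕ.+ h) j) (ℕP.m≤m+n (i ℕ.+ h ℕ.+ j) k))) le

Xv≈Tv² : ∀ N → Xv ≈[ N ] (Tv ⊛ Tv)
Xv≈Tv² N = ≈⇒≈[] N (mono-T 1 0 0 0 1ℚ)

module GenFun (N : ℕ) where
  private
    R = truncRing N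
    module R = CommutativeRing R
    module S = Sums R
    module L = ListSums R
    module C = Recurrence R
    module T = FunEq.Truncated R N Xv Yv (nilpotent N Xv refl) (nilpotent N Yv refl)
  open import Algebra.Properties.Semiring.Exp R.semiring using (_^_)

  module M = L.Monomials Tv Xv Yv Pv Qv (Xv≈Tv² N) (λ a b c d → mono a b c d 1ℚ) (R.refl {𝟙})
    (λ a b c d → ≈⇒≈[] N (mono-T a b c d 1ℚ)) (λ a b c d → ≈⇒≈[] N (mono-Y a b c d 1ℚ))
    (λ a b c d → ≈⇒≈[] N (mono-P a b c d 1ℚ)) (λ a b c d → ≈⇒≈[] N (mono-Q a b c d 1ℚ))

  factors : ∀ z m m′ U e → m ≈[ N ] m′ → ((z ⊛ m) ⊛ (U ^ e)) ≈[ N ] (z ⊛ (m′ ⊛ (U ^ e)))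
  factors z m m′ U e eq = R.trans {(z ⊛ m) ⊛ (U ^ e)} {z ⊛ (m ⊛ (U ^ e))} {z ⊛ (m′ ⊛ (U ^ e))}
    (R.*-assoc z m (U ^ e))
    (R.*-congˡ {z} {m ⊛ (U ^ e)} {m′ ⊛ (U ^ e)} (R.*-congʳ {U ^ e} {m} {m′} eq))

  weight≈ : ∀ sw cs v hh U m → ((Pv ^ (if sw then countU cs else countB cs)) ⊛ (Qv ^ (if sw then countB cs else countU cs))) ≈[ N ] m →
    weight sw cs v hh U ≈[ N ] (((Xv ^ v) ⊛ (Yv ^ hh)) ⊛ (m ⊛ (U ^ C.gap cs)))
  weight≈ sw cs v hh U m eq = R.trans
    {weight sw cs v hh U} {(((Xv ^ v) ⊛ (Yv ^ hh)) ⊛ m₀) ⊛ (U ^ C.gap cs)} {((Xv ^ v) ⊛ (Yv ^ hh)) ⊛ (m ⊛ (U ^ C.gap cs))}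
    (R.*-cong {mono (2 ℕ.* v) hh e₁ e₂ 1ℚ} {((Xv ^ v) ⊛ (Yv ^ hh)) ⊛ m₀} {U ^^ C.gap cs} {U ^ C.gap cs}
      (M.monomial v hh e₁ e₂) (subst ((U ^^ C.gap cs) ≈[ N ]_) (^^≡^ N U (C.gap cs)) (R.refl {U ^^ C.gap cs})))
    (factors ((Xv ^ v) ⊛ (Yv ^ hh)) m₀ m U (C.gap cs) eq)
    where
    e₁ e₂ : ℕ
    e₁ = if sw then countU cs else countB cs
    e₂ = if sw then countB cs else countU cs
    m₀ : PS
    m₀ = (Pv ^ e₁) ⊛ (Qv ^ e₂)

  genFun≈gf : ∀ S S′ → (∀ cs → S cs ≡ S′ cs) → ∀ sw p q U →
    (∀ cs → ((Pv ^ (if sw then countU cs else countB cs)) ⊛ (Qv ^ (if sw then countB cs else countU cs))) ≈[ N ] C.mass p q cs) →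
    genFun S sw U ≈[ N ] T.gf S′ p q (U ^_)
  genFun≈gf S S′ S≡S′ sw p q U mass≈ = R.trans {genFun S sw U} {S.∑ N (λ v → S.∑ N (summand S sw U v))} {T.gf S′ p q (U ^_)}
    (subst (genFun S sw U ≈[ N ]_) (sumPS≡∑ N N (λ v → sumPS≡∑ N N (λ hh → refl))) (genFun≈sumPS N S sw U))
    (L.double-sum N Xv Yv (summand S sw U) (C.polySum S′ p q (U ^_)) (λ v hh →
      L.coefficient S S′ S≡S′ p q U ((Xv ^ v) ⊛ (Yv ^ hh)) v hh (λ cs → weight sw cs v hh U)
        (λ cs → weight≈ sw cs v hh U (C.mass p q cs) (mass≈ cs))))

  straight : ∀ cs → ((Pv ^ countB cs) ⊛ (Qv ^ countU cs)) ≈[ N ] C.mass Pv Qv cs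
  straight cs = R.refl {(Pv ^ countB cs) ⊛ (Qv ^ countU cs)}

  -- `weight` exchanges the exponents of p and q, while `mass` exchanges the variables; the two
  -- differ by the order of the factors.
  swapped : ∀ cs → ((Pv ^ countU cs) ⊛ (Qv ^ countB cs)) ≈[ N ] C.mass Qv Pv cs
  swapped cs = R.*-comm (Pv ^ countU cs) (Qv ^ countB cs)

  Gall≈ : ∀ U → Gall U ≈[ N ] T.gf C.everything Pv Qv (U ^_)
  Gall≈ U = genFun≈gf (λ _ → true) C.everything (λ _ → refl) false Pv Qv U straight

  Gt≈ : ∀ U → Gt U ≈[ N ] T.gf topsDecrease Pv Qv (U ^_)
  Gt≈ U = genFun≈gf isT topsDecrease isT≡topsDecrease false Pv Qv U straight

  Gtsw≈ : ∀ U → Gtsw U ≈[ N ] T.gf topsDecrease Qv Pv (U ^_)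
  Gtsw≈ U = genFun≈gf isT topsDecrease isT≡topsDecrease true Qv Pv U swapped

  Gbt≈ : ∀ U → Gbt U ≈[ N ] T.gf C.stack Pv Qv (U ^_)
  Gbt≈ U = genFun≈gf isBT C.stack (λ cs → cong₂ _∧_ (isT≡topsDecrease cs) (isB≡bottomsIncrease cs)) false Pv Qv U straight

-- The series u± and the conclusion.

divT₁-Tv : ∀ f g → f ≈ (Tv ⊛ g) → divT 1 f ≈ g
divT₁-Tv f g e i h j k = trans (cong (λ a → f a h j k) (ℕP.+-comm i 1)) (trans (e (suc i) h j k) (Tv⊛-suc g i h j k))

divT₂-Tv : ∀ f g → f ≈ (Tv ⊛ (Tv ⊛ g)) → divT 2 f ≈ g
divT₂-Tv f g e i h j k = trans (cong (λ a → f a h j k) (ℕP.+-comm i 2))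
  (trans (e (suc (suc i)) h j k) (trans (Tv⊛-suc (Tv ⊛ g) (suc i) h j k) (Tv⊛-suc g i h j k)))

two·≈ : ∀ f → ((+ 2 Q./ 1) · f) ≈ (f ⊕ f)
two·≈ f i h j k = trans (QP.*-distribʳ-+ (f i h j k) 1ℚ 1ℚ) (cong₂ Q._+_ (QP.*-identityˡ (f i h j k)) (QP.*-identityˡ (f i h j k)))

four·≈ : ∀ f → ((+ 4 Q./ 1) · f) ≈ ((f ⊕ f) ⊕ (f ⊕ f))
four·≈ f i h j k = trans (QP.*-distribʳ-+ (f i h j k) (+ 2 Q./ 1) (+ 2 Q./ 1)) (cong₂ Q._+_ (two·≈ f i h j k) (two·≈ f i h j k))

four-quarters : ∀ f → ((((+ 1 Q./ 4) · f) ⊕ ((+ 1 Q./ 4) · f)) ⊕ (((+ 1 Q./ 4) · f) ⊕ ((+ 1 Q./ 4) · f))) ≈ f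
four-quarters f i h j k = trans (sym (four·≈ ((+ 1 Q./ 4) · f) i h j k))
  (trans (sym (QP.*-assoc (+ 4 Q./ 1) (+ 1 Q./ 4) (f i h j k))) (QP.*-identityˡ (f i h j k)))

-- These are the series for `r` and `i` of the abstract argument, then (u₊ - u₋) / t and D / t².
rser inv2C Fser Eser : PS
rser  = sqrt₁ ((+ 1 Q./ 4) · divT 2 Dser)
inv2C = invPS ((+ 2 Q./ 1) · (𝟙 ⊖ Pv ⊛ Qv ⊛ Xv))
Fser  = ((rser ⊕ rser) ⊕ (rser ⊕ rser)) ⊛ inv2C
Eser  = ((Pv ⊖ Qv) ⊛ (Pv ⊖ Qv)) ⊛ Xv ⊕ ((𝟙 ⊕ 𝟙) ⊕ (𝟙 ⊕ 𝟙))

Dser≈ : ∀ N → Dser ≈[ N ] (Tv ⊛ (Tv ⊛ Eser))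
Dser≈ N = RootAlgebra.discriminant-t² (truncRing N) Tv Xv (Pv ⊖ Qv) ((+ 4 Q./ 1) · Xv) (Xv≈Tv² N) (≈⇒≈[] N (four·≈ Xv))

root : ∀ N → (((rser ⊛ rser) ⊕ (rser ⊛ rser)) ⊕ ((rser ⊛ rser) ⊕ (rser ⊛ rser))) ≈[ N ] Eser
root N = R.trans {_} {(e ⊕ e) ⊕ (e ⊕ e)} {Eser} (RootAlgebra.four-cong (truncRing N) (rser ⊛ rser) e (sqrt₁-square N e refl))
  (≈⇒≈[] N (λ i h j k → trans (four-quarters (divT 2 Dser) i h j k) (divT₂-Tv Dser Eser (≈[]⇒≈ Dser≈) i h j k)))
  where
  module R = CommutativeRing (truncRing N)
  e : PS
  e = (+ 1 Q./ 4) · divT 2 Dser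

module Assemble (N : ℕ) where
  private
    R = truncRing N
    module R = CommutativeRing R
    module A = RootAlgebra R
    module G = GenFun N
    C : PS
    C = 𝟙 ⊖ Pv ⊛ Qv ⊛ Xv

  sqrtD≈ : sqrtD ≈[ N ] ((Tv ⊛ rser) ⊕ (Tv ⊛ rser))
  sqrtD≈ = ≈⇒≈[] N (two·≈ (Tv ⊛ rser))

  twice-inverse : ((C ⊕ C) ⊛ inv2C) ≈[ N ] 𝟙
  twice-inverse = A.inverse-congˡ ((+ 2 Q./ 1) · C) (C ⊕ C) inv2C (≈⇒≈[] N (two·≈ C)) (invPS-inverse N ((+ 2 Q./ 1) · C) (λ ()))

  module F = Final.Solve R N Tv Xv Yv Pv Qv rser sqrtD inv2C (Xv≈Tv² N) sqrtD≈ (nilpotent N Xv refl) (nilpotent N Yv refl) twice-inverse (root N)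
  module Rt = Final.Roots R Tv Xv Pv Qv rser sqrtD inv2C (Xv≈Tv² N) sqrtD≈ twice-inverse (root N)

  roots-apart : (uPlus ⊖ uMinus) ≈[ N ] (Tv ⊛ Fser)
  roots-apart = Rt.difference-of-roots

-- Division by t lowers degrees, so agreement modulo one N would not carry over to the same N. The
-- congruences for all N are therefore first combined into an exact equality.
difference≈ : divT 1 (uPlus ⊖ uMinus) ≈ Fser
difference≈ = divT₁-Tv (uPlus ⊖ uMinus) Fser (≈[]⇒≈ Assemble.roots-apart)

-- The power series part of `RHS.δ`, that is t / (u₊ - u₋).
η : PS
η = invPS (divT 1 (uPlus ⊖ uMinus))

η-inverse : ∀ N → (Fser ⊛ η) ≈[ N ] 𝟙
η-inverse N = RootAlgebra.inverse-congˡ (truncRing N) (divT 1 (uPlus ⊖ uMinus)) Fser η (≈⇒≈[] N difference≈)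
  (invPS-inverse N (divT 1 (uPlus ⊖ uMinus)) (λ ()))

open RHS using (Dp; Dm)

-- The exponent 3 is the shift of `RHS.total`: each of the three terms that contain `RHS.δ` adds one
-- factor 1/t to the common denominator.
final : ∀ N → ((Tv ^^ 3) ⊛ Gall 𝟙) ≈[ N ] ((Tv ^^ 0) ⊛ ser RHS.total)
-- Each `λ ()` has the constant term of the series to be inverted evaluated and found different from
-- 0.
final N = F.assembled (invPS Dp) (invPS Dm) (invPS-inverse N Dp (λ ())) (invPS-inverse N Dm (λ ()))
  η (invPS (Dp ⊛ Dm)) (invPS (Dp ^^ 2)) (invPS (Dm ^^ 2))
  (Gall 𝟙) (Gbt uPlus) (Gbt uMinus) (Gt uPlus) (Gtsw uPlus) (Gt uMinus) (Gtsw uMinus) (Gt 𝟙) (Gtsw 𝟙)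
  (η-inverse N) (invPS-inverse N (Dp ⊛ Dm) (λ ())) (invPS-inverse N (Dp ^^ 2) (λ ())) (invPS-inverse N (Dm ^^ 2) (λ ()))
  (G.Gall≈ 𝟙) (G.Gbt≈ uPlus) (G.Gbt≈ uMinus) (G.Gt≈ uPlus) (G.Gtsw≈ uPlus) (G.Gt≈ uMinus) (G.Gtsw≈ uMinus) (G.Gt≈ 𝟙) (G.Gtsw≈ 𝟙)
  where
  open Assemble N
  module G = GenFun N

theorem3p2 : ι (Gall 𝟙) ≈L RHS.total
theorem3p2 = ≈[]⇒≈ {(Tv ^^ 3) ⊛ Gall 𝟙} {(Tv ^^ 0) ⊛ ser RHS.total} final
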